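{- Let $f=a_0+a_1x+\cdots+a_nx^n\in\mathbb{Z}[x]$ be a primitive polynomial. Suppose that $a_0=\pm p^k d$ for some positive integers $k$ and $d$ and a prime number $p$ with $p\nmid a_1 d$, and that every zero $\theta\in\mathbb{C}$ of $f$ satisfies $|\theta|>d$. Then $f$ is irreducible in $\mathbb{Z}[x]$.
   Context: A polynomial $a_0+a_1x+\cdots+a_nx^n\in\mathbb{Z}[x]$ is primitive if $\gcd(a_0,a_1,\ldots,a_n)=1$. -}

module Defs where

open import Algebra.Bundles using (RawSemiring)
open import Data.Integer.Base as ℤ using (ℤ; 0ℤ; 1ℤ)
import Data.Integer.GCD as ℤ
import Data.Integer.Properties as ℤ
open import Data.List.Base using (List; []; _∷_; map; foldr)
open import Data.Nat.Base as ℕ using (ℕ; zero; suc)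
import Data.Nat.Properties as ℕ
open import Data.Product.Base using (∃; _×_; _,_; proj₁; proj₂)
open import Data.Rational.Base as ℚ
  using (ℚ; mkℚ; 0ℚ; 1ℚ; ½; _+_; _*_; _-_; -_; ∣_∣; _<_; _≤_; _/_; ↥_; ↧ₙ_)
import Data.Rational.Properties as ℚ
open import Data.Rational.Solver using (module +-*-Solver)
import Data.Rational.Unnormalised.Base as ℚᵘ
import Data.Rational.Unnormalised.Properties as ℚᵘ
open import Data.Sum.Base using (inj₁; inj₂)
open import Level using (0ℓ)
open import Relation.Binary.PropositionalEquality
  using (_≡_; refl; sym; trans; cong; cong₂; subst; module ≡-Reasoning)
open import Relation.Nullary using (yes; no; contradiction)

-- a₀ ∷ a₁ ∷ … ∷ aₙ ∷ [] stands for a₀ + a₁x + ⋯ + aₙxⁿ.  Trailing zeros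
-- are allowed, so equality of polynomials is _≈ₚ_ and not _≡_.

ℤ[x] : Set
ℤ[x] = List ℤ

coeff : ℤ[x] → ℕ → ℤ
coeff []      _       = 0ℤ
coeff (a ∷ f) zero    = a
coeff (a ∷ f) (suc i) = coeff f i

infix  4 _≈ₚ_
infixl 6 _+ₚ_
infixl 7 _*ₚ_

_≈ₚ_ : ℤ[x] → ℤ[x] → Set
f ≈ₚ g = ∀ i → coeff f i ≡ coeff g i

_+ₚ_ : ℤ[x] → ℤ[x] → ℤ[x]
[]      +ₚ g       = g
(a ∷ f) +ₚ []      = a ∷ f
(a ∷ f) +ₚ (b ∷ g) = (a ℤ.+ b) ∷ (f +ₚ g)

_*ₚ_ : ℤ[x] → ℤ[x] → ℤ[x]
[]      *ₚ g = []
(a ∷ f) *ₚ g = map (a ℤ.*_) g +ₚ (0ℤ ∷ (f *ₚ g))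

ℤ[x]-rawSemiring : RawSemiring 0ℓ 0ℓ
ℤ[x]-rawSemiring = record
  { Carrier = ℤ[x]
  ; _≈_     = _≈ₚ_
  ; _+_     = _+ₚ_
  ; _*_     = _*ₚ_
  ; 0#      = []
  ; 1#      = 1ℤ ∷ []
  }

Primitive : ℤ[x] → Set
Primitive f = foldr ℤ.gcd 0ℤ f ≡ 1ℤ

∣p∣<q : ∀ {p q} → p < q → - p < q → ∣ p ∣ < q
∣p∣<q {p} {q} p<q -p<q with ℚ.∣p∣≡p∨∣p∣≡-p p
... | inj₁ eq = subst (_< q) (sym eq) p<q
... | inj₂ eq = subst (_< q) (sym eq) -p<q

∣p∣≤∣p-q∣+∣q∣ : ∀ p q → ∣ p ∣ ≤ ∣ p - q ∣ + ∣ q ∣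
∣p∣≤∣p-q∣+∣q∣ p q =
  subst (λ r → ∣ r ∣ ≤ ∣ p - q ∣ + ∣ q ∣)
        (solve 2 (λ p q → (p :- q) :+ q := p) refl p q)
        (ℚ.∣p+q∣≤∣p∣+∣q∣ (p - q) q)
  where open +-*-Solver

*-pos : ∀ {p q} → 0ℚ < p → 0ℚ < q → 0ℚ < p * q
*-pos {p} {q} 0<p 0<q = ℚ.positive⁻¹ (p * q)
  where instance
    _ = ℚ.positive 0<p
    _ = ℚ.positive 0<q
    _ = ℚ.pos*pos⇒pos p q

*-nonNeg : ∀ {p q} → 0ℚ ≤ p → 0ℚ ≤ q → 0ℚ ≤ p * q
*-nonNeg {p} {q} 0≤p 0≤q = ℚ.nonNegative⁻¹ (p * q)
  where instance
    _ = ℚ.nonNegative 0≤p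
    _ = ℚ.nonNegative 0≤q
    _ = ℚ.nonNeg*nonNeg⇒nonNeg p q

*-mono-≤ : ∀ {p q r s} → 0ℚ ≤ p → 0ℚ ≤ s → p ≤ q → r ≤ s → p * r ≤ q * s
*-mono-≤ {p} {q} {r} {s} 0≤p 0≤s p≤q r≤s = ℚ.≤-trans
  (ℚ.*-monoˡ-≤-nonNeg p {{ℚ.nonNegative 0≤p}} r≤s)
  (ℚ.*-monoʳ-≤-nonNeg s {{ℚ.nonNegative 0≤s}} p≤q)

ι : ℕ → ℚ
ι n = ℤ.+ n / 1

toℚᵘ-/ : ∀ i n → ℚ.toℚᵘ (i / suc n) ℚᵘ.≃ ℚᵘ.mkℚᵘ i n
toℚᵘ-/ i n = ℚ.toℚᵘ-fromℚᵘ (ℚᵘ.mkℚᵘ i n)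

ι-mono-≤ : ∀ {m n} → m ℕ.≤ n → ι m ≤ ι n
ι-mono-≤ {m} {n} m≤n = ℚ.toℚᵘ-cancel-≤
  (ℚᵘ.≤-respˡ-≃ (ℚᵘ.≃-sym (toℚᵘ-/ (ℤ.+ m) 0))
  (ℚᵘ.≤-respʳ-≃ (ℚᵘ.≃-sym (toℚᵘ-/ (ℤ.+ n) 0))
  (ℚᵘ.*≤* (ℤ.*-monoʳ-≤-nonNeg (ℤ.+ 1) (ℤ.+≤+ m≤n)))))

ι-mono-< : ∀ {m n} → m ℕ.< n → ι m < ι n
ι-mono-< {m} {n} m<n = ℚ.toℚᵘ-cancel-<
  (ℚᵘ.<-respˡ-≃ (ℚᵘ.≃-sym (toℚᵘ-/ (ℤ.+ m) 0))
  (ℚᵘ.<-respʳ-≃ (ℚᵘ.≃-sym (toℚᵘ-/ (ℤ.+ n) 0))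
  (ℚᵘ.*<* (ℤ.*-monoʳ-<-pos (ℤ.+ 1) (ℤ.+<+ m<n)))))

0≤ι : ∀ n → 0ℚ ≤ ι n
0≤ι n = ι-mono-≤ {0} {n} ℕ.z≤n

ι-+ : ∀ m n → ι (m ℕ.+ n) ≡ ι m + ι n
ι-+ m n = ℚ.toℚᵘ-injective (begin
  ℚ.toℚᵘ (ι (m ℕ.+ n))
    ≈⟨ toℚᵘ-/ (ℤ.+ (m ℕ.+ n)) 0 ⟩
  ℚᵘ.mkℚᵘ (ℤ.+ (m ℕ.+ n)) 0
    ≈⟨ ℚᵘ.*≡* (cong (ℤ._* ℤ.+ 1) (sym (cong₂ ℤ._+_ (ℤ.*-identityʳ (ℤ.+ m)) (ℤ.*-identityʳ (ℤ.+ n))))) ⟩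
  ℚᵘ.mkℚᵘ (ℤ.+ m) 0 ℚᵘ.+ ℚᵘ.mkℚᵘ (ℤ.+ n) 0
    ≈⟨ ℚᵘ.+-cong (toℚᵘ-/ (ℤ.+ m) 0) (toℚᵘ-/ (ℤ.+ n) 0) ⟨
  ℚ.toℚᵘ (ι m) ℚᵘ.+ ℚ.toℚᵘ (ι n)
    ≈⟨ ℚ.toℚᵘ-homo-+ (ι m) (ι n) ⟨
  ℚ.toℚᵘ (ι m + ι n) ∎)
  where open ℚᵘ.≃-Reasoning

ι-* : ∀ m n → ι (m ℕ.* n) ≡ ι m * ι n
ι-* m n = ℚ.toℚᵘ-injective (begin
  ℚ.toℚᵘ (ι (m ℕ.* n))
    ≈⟨ toℚᵘ-/ (ℤ.+ (m ℕ.* n)) 0 ⟩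
  ℚᵘ.mkℚᵘ (ℤ.+ (m ℕ.* n)) 0
    ≈⟨ ℚᵘ.*≡* (cong (ℤ._* ℤ.+ 1) (ℤ.pos-* m n)) ⟩
  ℚᵘ.mkℚᵘ (ℤ.+ m) 0 ℚᵘ.* ℚᵘ.mkℚᵘ (ℤ.+ n) 0
    ≈⟨ ℚᵘ.*-cong (toℚᵘ-/ (ℤ.+ m) 0) (toℚᵘ-/ (ℤ.+ n) 0) ⟨
  ℚ.toℚᵘ (ι m) ℚᵘ.* ℚ.toℚᵘ (ι n)
    ≈⟨ ℚ.toℚᵘ-homo-* (ι m) (ι n) ⟨
  ℚ.toℚᵘ (ι m * ι n) ∎)
  where open ℚᵘ.≃-Reasoning

/-*-ι : ∀ m n → (ℤ.+ m / suc n) * ι (suc n) ≡ ι m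
/-*-ι m n = ℚ.toℚᵘ-injective (begin
  ℚ.toℚᵘ ((ℤ.+ m / suc n) * ι (suc n))
    ≈⟨ ℚ.toℚᵘ-homo-* (ℤ.+ m / suc n) (ι (suc n)) ⟩
  ℚ.toℚᵘ (ℤ.+ m / suc n) ℚᵘ.* ℚ.toℚᵘ (ι (suc n))
    ≈⟨ ℚᵘ.*-cong (toℚᵘ-/ (ℤ.+ m) n) (toℚᵘ-/ (ℤ.+ suc n) 0) ⟩
  ℚᵘ.mkℚᵘ (ℤ.+ m) n ℚᵘ.* ℚᵘ.mkℚᵘ (ℤ.+ suc n) 0
    ≈⟨ ℚᵘ.*≡* (trans (ℤ.*-identityʳ _)
         (cong (λ k → ℤ.+ m ℤ.* ℤ.+ k) (sym (ℕ.*-identityʳ (suc n))))) ⟩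
  ℚᵘ.mkℚᵘ (ℤ.+ m) 0
    ≈⟨ toℚᵘ-/ (ℤ.+ m) 0 ⟨
  ℚ.toℚᵘ (ι m) ∎)
  where open ℚᵘ.≃-Reasoning

∣p∣≡∣↥p∣/↧ₙp : ∀ p → ∣ p ∣ ≡ ℤ.+ ℤ.∣ ↥ p ∣ / ↧ₙ p
∣p∣≡∣↥p∣/↧ₙp p@record{} = sym (ℚ.↥p/↧p≡p ∣ p ∣)

1/ₙ→0 : ∀ {ε} → 0ℚ < ε → ∃ λ N → ∀ n → N ℕ.≤ n → 1ℤ / suc n ≤ ε
1/ₙ→0 {mkℚ (ℤ.+ zero) b _}     (ℚ.*<* (ℤ.+<+ ()))
1/ₙ→0 {mkℚ (ℤ.-[1+ a ]) b _}   (ℚ.*<* ())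
1/ₙ→0 {mkℚ (ℤ.+ suc a) b _} _ = b , λ n b≤n → ℚ.toℚᵘ-cancel-≤
  (ℚᵘ.≤-respˡ-≃ (ℚᵘ.≃-sym (toℚᵘ-/ 1ℤ n))
  (ℚᵘ.*≤* (ℤ.+≤+ (ℕ.*-mono-≤ {1} {suc a} (ℕ.s≤s ℕ.z≤n) (ℕ.s≤s b≤n)))))

IsCauchy : (ℕ → ℚ) → Set
IsCauchy x = ∀ ε → 0ℚ < ε →
  ∃ λ N → ∀ m n → N ℕ.≤ m → N ℕ.≤ n → ∣ x m - x n ∣ < ε

record ℝ : Set where
  constructor mkℝ
  field
    seq    : ℕ → ℚ
    cauchy : IsCauchy seq

open ℝ public

infix  4 _≈ʳ_ _<ʳ_
infixl 6 _+ʳ_ _-ʳ_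
infixl 7 _*ʳ_
infix  8 -ʳ_

_≈ʳ_ : ℝ → ℝ → Set
x ≈ʳ y = ∀ ε → 0ℚ < ε → ∃ λ N → ∀ n → N ℕ.≤ n → ∣ seq x n - seq y n ∣ < ε

_<ʳ_ : ℝ → ℝ → Set
x <ʳ y = ∃ λ ε → 0ℚ < ε × ∃ λ N → ∀ n → N ℕ.≤ n → seq x n + ε ≤ seq y n

fromℚ : ℚ → ℝ
fromℚ q = mkℝ (λ _ → q) λ ε 0<ε → 0 , λ _ _ _ _ →
  subst (λ r → ∣ r ∣ < ε) (sym (ℚ.+-inverseʳ q)) 0<ε

fromℕ : ℕ → ℝ
fromℕ n = fromℚ (ι n)

IsCauchy-+ : ∀ x y → IsCauchy x → IsCauchy y → IsCauchy (λ n → x n + y n)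
IsCauchy-+ x y cx cy ε 0<ε
  with cx (ε * ½) (*-pos 0<ε (ℚ.positive⁻¹ ½)) | cy (ε * ½) (*-pos 0<ε (ℚ.positive⁻¹ ½))
... | M , hM | N , hN = M ℕ.⊔ N , λ m n ≤m ≤n → begin-strict
  ∣ (x m + y m) - (x n + y n) ∣
    ≡⟨ cong ∣_∣ (solve 4 (λ a b c d → (a :+ b) :- (c :+ d) := (a :- c) :+ (b :- d)) refl
         (x m) (y m) (x n) (y n)) ⟩
  ∣ (x m - x n) + (y m - y n) ∣
    ≤⟨ ℚ.∣p+q∣≤∣p∣+∣q∣ (x m - x n) (y m - y n) ⟩
  ∣ x m - x n ∣ + ∣ y m - y n ∣
    <⟨ ℚ.+-mono-< (hM m n (ℕ.m⊔n≤o⇒m≤o M N ≤m) (ℕ.m⊔n≤o⇒m≤o M N ≤n))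
                  (hN m n (ℕ.m⊔n≤o⇒n≤o M N ≤m) (ℕ.m⊔n≤o⇒n≤o M N ≤n)) ⟩
  ε * ½ + ε * ½
    ≡⟨ solve 1 (λ e → e :* con ½ :+ e :* con ½ := e) refl ε ⟩
  ε ∎
  where
    open ℚ.≤-Reasoning
    open +-*-Solver

IsCauchy-neg : ∀ x → IsCauchy x → IsCauchy (λ n → - x n)
IsCauchy-neg x cx ε 0<ε with cx ε 0<ε
... | N , h = N , λ m n ≤m ≤n → subst (_< ε) (eq m n) (h m n ≤m ≤n)
  where
    open +-*-Solver
    eq : ∀ m n → ∣ x m - x n ∣ ≡ ∣ (- x m) - (- x n) ∣
    eq m n = trans (sym (ℚ.∣-p∣≡∣p∣ (x m - x n)))
      (cong ∣_∣ (solve 2 (λ a b → :- (a :- b) := (:- a) :- (:- b)) refl (x m) (x n)))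

IsCauchy-bounded : ∀ x → IsCauchy x →
  ∃ λ B → 0ℚ < B × ∃ λ N → ∀ n → N ℕ.≤ n → ∣ x n ∣ ≤ B
IsCauchy-bounded x cx with cx 1ℚ (ℚ.positive⁻¹ 1ℚ)
... | N , h = 1ℚ + ∣ x N ∣
            , ℚ.+-mono-<-≤ (ℚ.positive⁻¹ 1ℚ) (ℚ.0≤∣p∣ (x N))
            , N
            , λ n ≤n → ℚ.≤-trans (∣p∣≤∣p-q∣+∣q∣ (x n) (x N))
                         (ℚ.+-monoˡ-≤ ∣ x N ∣ (ℚ.<⇒≤ (h n N ≤n ℕ.≤-refl)))

private
  quotient : ∀ {ε c} → 0ℚ < ε → 0ℚ < c → ∃ λ δ → 0ℚ < δ × c * δ ≡ ε
  quotient {ε} {c} 0<ε 0<c = ε * (ℚ.1/ c)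
    , *-pos 0<ε (ℚ.positive⁻¹ (ℚ.1/ c) {{ℚ.1/pos⇒pos c}})
    , (begin
        c * (ε * (ℚ.1/ c))  ≡⟨ solve 3 (λ c e i → c :* (e :* i) := e :* (c :* i)) refl c ε (ℚ.1/ c) ⟩
        ε * (c * (ℚ.1/ c))  ≡⟨ cong (ε *_) (ℚ.*-inverseʳ c) ⟩
        ε * 1ℚ              ≡⟨ ℚ.*-identityʳ ε ⟩
        ε                   ∎)
    where
      open ≡-Reasoning
      open +-*-Solver
      instance
        c-pos : ℚ.Positive c
        c-pos = ℚ.positive 0<c
        c-nonZero : ℚ.NonZero c
        c-nonZero = ℚ.pos⇒nonZero c

  product-gap : ∀ {A B δ} a b c d → 0ℚ < A → 0ℚ < B → ∣ a ∣ ≤ A → ∣ d ∣ ≤ B →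
    ∣ a - c ∣ < δ → ∣ b - d ∣ < δ → ∣ a * b - c * d ∣ < (A + B) * δ
  product-gap {A} {B} {δ} a b c d 0<A 0<B a≤A d≤B a-c<δ b-d<δ = begin-strict
    ∣ a * b - c * d ∣
      ≡⟨ cong ∣_∣ (solve 4 (λ a b c d → a :* b :- c :* d := a :* (b :- d) :+ (a :- c) :* d) refl
           a b c d) ⟩
    ∣ a * (b - d) + (a - c) * d ∣
      ≤⟨ ℚ.∣p+q∣≤∣p∣+∣q∣ (a * (b - d)) ((a - c) * d) ⟩
    ∣ a * (b - d) ∣ + ∣ (a - c) * d ∣
      ≡⟨ cong₂ _+_ (ℚ.∣p*q∣≡∣p∣*∣q∣ a (b - d)) (ℚ.∣p*q∣≡∣p∣*∣q∣ (a - c) d) ⟩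
    ∣ a ∣ * ∣ b - d ∣ + ∣ a - c ∣ * ∣ d ∣
      ≤⟨ ℚ.+-mono-≤
           (ℚ.*-monoʳ-≤-nonNeg ∣ b - d ∣ {{ℚ.∣-∣-nonNeg (b - d)}} a≤A)
           (ℚ.*-monoˡ-≤-nonNeg ∣ a - c ∣ {{ℚ.∣-∣-nonNeg (a - c)}} d≤B) ⟩
    A * ∣ b - d ∣ + ∣ a - c ∣ * B
      <⟨ ℚ.+-mono-< (ℚ.*-monoʳ-<-pos A {{ℚ.positive 0<A}} b-d<δ)
                    (ℚ.*-monoˡ-<-pos B {{ℚ.positive 0<B}} a-c<δ) ⟩
    A * δ + δ * B
      ≡⟨ solve 3 (λ a b d → a :* d :+ d :* b := (a :+ b) :* d) refl A B δ ⟩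
    (A + B) * δ ∎
    where
      open ℚ.≤-Reasoning
      open +-*-Solver

IsCauchy-* : ∀ x y → IsCauchy x → IsCauchy y → IsCauchy (λ n → x n * y n)
IsCauchy-* x y cx cy ε 0<ε =
  let A , 0<A , K , hK = IsCauchy-bounded x cx
      B , 0<B , L , hL = IsCauchy-bounded y cy
      δ , 0<δ , Cδ≡ε   = quotient 0<ε (ℚ.+-mono-< 0<A 0<B)
      M , hM = cx δ 0<δ
      N , hN = cy δ 0<δ
  in (K ℕ.⊔ L) ℕ.⊔ (M ℕ.⊔ N) , λ m n ≤m ≤n →
    let KL≤m = ℕ.m⊔n≤o⇒m≤o (K ℕ.⊔ L) (M ℕ.⊔ N) ≤m
        KL≤n = ℕ.m⊔n≤o⇒m≤o (K ℕ.⊔ L) (M ℕ.⊔ N) ≤n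
        MN≤m = ℕ.m⊔n≤o⇒n≤o (K ℕ.⊔ L) (M ℕ.⊔ N) ≤m
        MN≤n = ℕ.m⊔n≤o⇒n≤o (K ℕ.⊔ L) (M ℕ.⊔ N) ≤n
    in subst (∣ x m * y m - x n * y n ∣ <_) Cδ≡ε
         (product-gap (x m) (y m) (x n) (y n) 0<A 0<B
           (hK m (ℕ.m⊔n≤o⇒m≤o K L KL≤m)) (hL n (ℕ.m⊔n≤o⇒n≤o K L KL≤n))
           (hM m n (ℕ.m⊔n≤o⇒m≤o M N MN≤m) (ℕ.m⊔n≤o⇒m≤o M N MN≤n))
           (hN m n (ℕ.m⊔n≤o⇒n≤o M N MN≤m) (ℕ.m⊔n≤o⇒n≤o M N MN≤n)))

_+ʳ_ : ℝ → ℝ → ℝ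
x +ʳ y = mkℝ (λ n → seq x n + seq y n) (IsCauchy-+ (seq x) (seq y) (cauchy x) (cauchy y))

-ʳ_ : ℝ → ℝ
-ʳ x = mkℝ (λ n → - seq x n) (IsCauchy-neg (seq x) (cauchy x))

_-ʳ_ : ℝ → ℝ → ℝ
x -ʳ y = x +ʳ (-ʳ y)

_*ʳ_ : ℝ → ℝ → ℝ
x *ʳ y = mkℝ (λ n → seq x n * seq y n) (IsCauchy-* (seq x) (seq y) (cauchy x) (cauchy y))

-- isqrt n = ⌊√n⌋
isqrt : ℕ → ℕ
isqrt zero    = zero
isqrt (suc n) with suc (isqrt n) ℕ.* suc (isqrt n) ℕ.≤? suc n
... | yes _ = suc (isqrt n)
... | no  _ = isqrt n

isqrt-spec : ∀ n → isqrt n ℕ.* isqrt n ℕ.≤ n × n ℕ.< suc (isqrt n) ℕ.* suc (isqrt n)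
isqrt-spec zero    = ℕ.z≤n , ℕ.s≤s ℕ.z≤n
isqrt-spec (suc n) with suc (isqrt n) ℕ.* suc (isqrt n) ℕ.≤? suc n
... | yes ≤n = ≤n , ℕ.≤-<-trans (proj₂ (isqrt-spec n))
                      (ℕ.*-mono-< (ℕ.n<1+n (suc (isqrt n))) (ℕ.n<1+n (suc (isqrt n))))
... | no  ≰n = ℕ.m≤n⇒m≤1+n (proj₁ (isqrt-spec n)) , ℕ.≰⇒> ≰n

-- With ∣q∣ = a/b, this is ⌊√(ab(n+1)²)⌋ / (b(n+1)), a lower approximation
-- of √∣q∣ = √(ab)/b with error less than 1/(n+1).
√∣_∣-approx : ℚ → ℕ → ℚ
√∣ q ∣-approx n =
  ℤ.+ isqrt (ℤ.∣ ↥ q ∣ ℕ.* ↧ₙ q ℕ.* (suc n ℕ.* suc n)) / (↧ₙ q ℕ.* suc n)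

module _ (q : ℚ) (n : ℕ) where

  private
    a b N M r : ℕ
    a = ℤ.∣ ↥ q ∣
    b = ↧ₙ q
    N = b ℕ.* suc n
    M = a ℕ.* b ℕ.* (suc n ℕ.* suc n)
    r = isqrt M

    s : ℚ
    s = √∣ q ∣-approx n

    sN≡r : s * ι N ≡ ι r
    sN≡r = /-*-ι r (n ℕ.+ ℚ.denominator-1 q ℕ.* suc n)

    ιN : ι N ≡ ι b * ι (suc n)
    ιN = ι-* b (suc n)

    ∣q∣b≡a : ∣ q ∣ * ι b ≡ ι a
    ∣q∣b≡a = trans (cong (_* ι b) (∣p∣≡∣↥p∣/↧ₙp q)) (/-*-ι a (ℚ.denominator-1 q))

    ιM : ι M ≡ ∣ q ∣ * (ι N * ι N)
    ιM = begin
      ι M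
        ≡⟨ trans (ι-* (a ℕ.* b) (suc n ℕ.* suc n)) (cong₂ _*_ (ι-* a b) (ι-* (suc n) (suc n))) ⟩
      ι a * ι b * (ι (suc n) * ι (suc n))
        ≡⟨ cong (λ z → z * ι b * (ι (suc n) * ι (suc n))) (sym ∣q∣b≡a) ⟩
      ∣ q ∣ * ι b * ι b * (ι (suc n) * ι (suc n))
        ≡⟨ solve 3 (λ q b d → q :* b :* b :* (d :* d) := q :* ((b :* d) :* (b :* d))) refl
             ∣ q ∣ (ι b) (ι (suc n)) ⟩
      ∣ q ∣ * ((ι b * ι (suc n)) * (ι b * ι (suc n)))
        ≡⟨ cong (λ z → ∣ q ∣ * (z * z)) (sym ιN) ⟩
      ∣ q ∣ * (ι N * ι N) ∎
      where
        open ≡-Reasoning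
        open +-*-Solver

    0<ιN : 0ℚ < ι N
    0<ιN = ι-mono-< {0} {N} (ℕ.s≤s ℕ.z≤n)

    0<ιN² : 0ℚ < ι N * ι N
    0<ιN² = *-pos 0<ιN 0<ιN

  √-approx-nonNeg : 0ℚ ≤ √∣ q ∣-approx n
  √-approx-nonNeg = ℚ.*-cancelʳ-≤-pos (ι N) {{ℚ.positive 0<ιN}} (begin
    0ℚ * ι N ≡⟨ ℚ.*-zeroˡ (ι N) ⟩
    0ℚ       ≤⟨ 0≤ι r ⟩
    ι r      ≡⟨ sN≡r ⟨
    s * ι N  ∎)
    where open ℚ.≤-Reasoning

  √-approx-lower : √∣ q ∣-approx n * √∣ q ∣-approx n ≤ ∣ q ∣
  √-approx-lower = ℚ.*-cancelʳ-≤-pos (ι N * ι N) {{ℚ.positive 0<ιN²}} (begin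
    s * s * (ι N * ι N)
      ≡⟨ solve 2 (λ s n → s :* s :* (n :* n) := (s :* n) :* (s :* n)) refl s (ι N) ⟩
    (s * ι N) * (s * ι N)
      ≡⟨ cong₂ _*_ sN≡r sN≡r ⟩
    ι r * ι r
      ≡⟨ ι-* r r ⟨
    ι (r ℕ.* r)
      ≤⟨ ι-mono-≤ (proj₁ (isqrt-spec M)) ⟩
    ι M
      ≡⟨ ιM ⟩
    ∣ q ∣ * (ι N * ι N) ∎)
    where
      open ℚ.≤-Reasoning
      open +-*-Solver

  √-approx-upper : ∣ q ∣ < (√∣ q ∣-approx n + 1ℤ / suc n) * (√∣ q ∣-approx n + 1ℤ / suc n)
  √-approx-upper = ℚ.*-cancelʳ-<-nonNeg (ι N * ι N) {{ℚ.nonNegative (ℚ.<⇒≤ 0<ιN²)}} (begin-strict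
    ∣ q ∣ * (ι N * ι N)
      ≡⟨ ιM ⟨
    ι M
      <⟨ ι-mono-< (proj₂ (isqrt-spec M)) ⟩
    ι (suc r ℕ.* suc r)
      ≡⟨ ι-* (suc r) (suc r) ⟩
    ι (suc r) * ι (suc r)
      ≤⟨ *-mono-≤ (0≤ι (suc r)) (ℚ.≤-trans (0≤ι (suc r)) 1+r≤) 1+r≤ 1+r≤ ⟩
    (s + e) * ι N * ((s + e) * ι N)
      ≡⟨ solve 2 (λ t n → t :* n :* (t :* n) := t :* t :* (n :* n)) refl (s + e) (ι N) ⟩
    (s + e) * (s + e) * (ι N * ι N) ∎)
    where
      open ℚ.≤-Reasoning
      open +-*-Solver
      e : ℚ
      e = 1ℤ / suc n
      1+r≤ : ι (suc r) ≤ (s + e) * ι N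
      1+r≤ = begin
        ι (suc r)
          ≤⟨ ι-mono-≤ (ℕ.≤-trans (ℕ.≤-reflexive (ℕ.+-comm 1 r))
                                 (ℕ.+-monoʳ-≤ r {1} {b} (ℕ.s≤s ℕ.z≤n))) ⟩
        ι (r ℕ.+ b)
          ≡⟨ ι-+ r b ⟩
        ι r + ι b
          ≡⟨ cong₂ _+_ (sym sN≡r)
               (trans (sym (ℚ.*-identityˡ (ι b))) (cong (_* ι b) (sym (/-*-ι 1 n)))) ⟩
        s * ι N + e * ι (suc n) * ι b
          ≡⟨ cong (s * ι N +_)
               (trans (solve 3 (λ e d b → e :* d :* b := e :* (b :* d)) refl e (ι (suc n)) (ι b))
                      (cong (e *_) (sym ιN))) ⟩
        s * ι N + e * ι N
          ≡⟨ ℚ.*-distribʳ-+ (ι N) s e ⟨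
        (s + e) * ι N ∎

√-gap : ∀ h s t e u v → 0ℚ < h → 0ℚ ≤ t → 0ℚ ≤ e → e ≤ h →
  s * s ≤ u → v < (t + e) * (t + e) → u < h * h + v → s - t < h + h
√-gap h s t e u v 0<h 0≤t 0≤e e≤h ss≤u v< u< with s - t ℚ.<? h + h
... | yes s-t< = s-t<
... | no  s-t≮ = contradiction (begin-strict
    u                       <⟨ u< ⟩
    h * h + v               <⟨ ℚ.+-monoʳ-< (h * h) v< ⟩
    h * h + (t + e) * (t + e)
      ≤⟨ ℚ.+-monoʳ-≤ (h * h) (*-mono-≤ 0≤t+e 0≤t+h t+e≤t+h t+e≤t+h) ⟩
    h * h + (t + h) * (t + h)
      ≡⟨ ℚ.+-identityʳ _ ⟨
    h * h + (t + h) * (t + h) + 0ℚ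
      ≤⟨ ℚ.+-monoʳ-≤ (h * h + (t + h) * (t + h)) (ℚ.+-mono-≤ 0≤2ht 0≤2ht) ⟩
    h * h + (t + h) * (t + h) + (h * (t + h) + h * (t + h))
      ≡⟨ solve 2 (λ h t → h :* h :+ (t :+ h) :* (t :+ h) :+ (h :* (t :+ h) :+ h :* (t :+ h))
                       := (t :+ (h :+ h)) :* (t :+ (h :+ h))) refl h t ⟩
    (t + (h + h)) * (t + (h + h))
      ≤⟨ *-mono-≤ 0≤t+2h (ℚ.≤-trans 0≤t+2h t+2h≤s) t+2h≤s t+2h≤s ⟩
    s * s                   ≤⟨ ss≤u ⟩
    u ∎) (ℚ.<-irrefl refl)
  where
    open ℚ.≤-Reasoning
    open +-*-Solver
    0≤h = ℚ.<⇒≤ 0<h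
    0≤t+e = ℚ.+-mono-≤ 0≤t 0≤e
    0≤t+h = ℚ.+-mono-≤ 0≤t 0≤h
    0≤t+2h = ℚ.+-mono-≤ 0≤t (ℚ.+-mono-≤ 0≤h 0≤h)
    t+e≤t+h = ℚ.+-monoʳ-≤ t e≤h
    0≤2ht = *-nonNeg 0≤h 0≤t+h
    t+2h≤s : t + (h + h) ≤ s
    t+2h≤s = subst (t + (h + h) ≤_) (solve 2 (λ s t → t :+ (s :- t) := s) refl s t)
               (ℚ.+-monoʳ-≤ t (ℚ.≮⇒≥ s-t≮))

IsCauchy-√ : ∀ x → IsCauchy x → IsCauchy (λ n → √∣ x n ∣-approx n)
IsCauchy-√ x cx ε 0<ε =
  let M , hM = cx (h * h) (*-pos 0<h 0<h)
      N , hN = 1/ₙ→0 0<h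
      gap : ∀ m n → M ℕ.⊔ N ℕ.≤ m → M ℕ.⊔ N ℕ.≤ n → s m - s n < h + h
      gap m n ≤m ≤n = √-gap h (s m) (s n) (1ℤ / suc n) ∣ x m ∣ ∣ x n ∣ 0<h (√-approx-nonNeg (x n) n) (0≤1/ n)
        (hN n (ℕ.m⊔n≤o⇒n≤o M N ≤n))
        (√-approx-lower (x m) m) (√-approx-upper (x n) n)
        (ℚ.≤-<-trans (∣p∣≤∣p-q∣+∣q∣ (x m) (x n))
          (ℚ.+-monoˡ-< ∣ x n ∣ (hM m n (ℕ.m⊔n≤o⇒m≤o M N ≤m) (ℕ.m⊔n≤o⇒m≤o M N ≤n))))
  in M ℕ.⊔ N , λ m n ≤m ≤n → subst (∣ s m - s n ∣ <_) h+h≡ε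
       (∣p∣<q (gap m n ≤m ≤n) (subst (_< h + h) (flip (s m) (s n)) (gap n m ≤n ≤m)))
  where
    open +-*-Solver
    h : ℚ
    h = ε * ½
    s : ℕ → ℚ
    s n = √∣ x n ∣-approx n
    0<h : 0ℚ < h
    0<h = *-pos 0<ε (ℚ.positive⁻¹ ½)
    h+h≡ε : h + h ≡ ε
    h+h≡ε = solve 1 (λ e → e :* con ½ :+ e :* con ½ := e) refl ε
    flip : ∀ p q → q - p ≡ - (p - q)
    flip = solve 2 (λ p q → q :- p := :- (p :- q)) refl
    0≤1/ : ∀ n → 0ℚ ≤ 1ℤ / suc n
    0≤1/ n = ℚ.nonNegative⁻¹ (1ℤ / suc n) {{ℚ.normalize-nonNeg 1 (suc n)}}

-- The square root of the absolute value; the absolute value only serves to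
-- make it total, since 0 ≤ x is not decidable.
√∣_∣ : ℝ → ℝ
√∣ x ∣ = mkℝ (λ n → √∣ seq x n ∣-approx n) (IsCauchy-√ (seq x) (cauchy x))

record ℂ : Set where
  constructor _+i_
  field
    re im : ℝ

open ℂ public

infix  4 _≈ᶜ_
infixl 6 _+ᶜ_
infixl 7 _*ᶜ_

_≈ᶜ_ : ℂ → ℂ → Set
z ≈ᶜ w = re z ≈ʳ re w × im z ≈ʳ im w

_+ᶜ_ : ℂ → ℂ → ℂ
z +ᶜ w = (re z +ʳ re w) +i (im z +ʳ im w)

_*ᶜ_ : ℂ → ℂ → ℂ
z *ᶜ w = (re z *ʳ re w -ʳ im z *ʳ im w) +i (re z *ʳ im w +ʳ im z *ʳ re w)

fromℤ : ℤ → ℂ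
fromℤ a = fromℚ (a / 1) +i fromℚ 0ℚ

0ᶜ : ℂ
0ᶜ = fromℤ 0ℤ

∣_∣ᶜ : ℂ → ℝ
∣ z ∣ᶜ = √∣ re z *ʳ re z +ʳ im z *ʳ im z ∣

eval : ℤ[x] → ℂ → ℂ
eval []      θ = 0ᶜ
eval (a ∷ f) θ = fromℤ a +ᶜ θ *ᶜ eval f θ

IsZero : ℤ[x] → ℂ → Set
IsZero f θ = eval f θ ≈ᶜ 0ᶜ

{-# OPTIONS --safe #-}

-- Let f = g h.  As p does not divide a₁ = b₀c₁ + b₁c₀, it does not divide both
-- constant terms, say p ∤ b₀; then b₀ divides d, so ∣b₀∣ ≤ d.  If g were not
-- constant, b₀ would be ± its leading coefficient times the product of its
-- zeros, whose moduli all exceed d: a contradiction.  So g is constant, hence a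
-- unit because f is primitive.
--
-- The zeros are real Cauchy sequences, so the product formula is obtained by
-- approximation over ℚ(i).  Every nonconstant polynomial takes arbitrarily small
-- values at points of ℚ(i), since its modulus can be decreased by an amount that
-- is bounded below wherever it is not small.  Repeated deflation at such points
-- shows that (i) near an approximate zero there is a better one, which produces
-- a genuine zero as a limit, and (ii) if all approximate zeros satisfy ∣z∣² ≥ ρ
-- then the constant term is at least as large as the product formula predicts.
-- One genuine zero with ∣θ∣ > d makes the resulting inequality strict.
module Submission where

open import Defs
open import Algebra.Consequences.Propositional using (comm∧idˡ⇒id; comm∧distrˡ⇒distrʳ)
import Algebra.Definitions.RawSemiring as RawSemiring
open import Algebra.Structures using (IsCommutativeRing)
open import Data.Empty using (⊥; ⊥-elim)
open import Data.Integer.Base as ℤ using (ℤ; +_; -[1+_]; 0ℤ; 1ℤ)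
import Data.Integer.Divisibility as ℤ∣
import Data.Integer.Divisibility.Signed as Signed
import Data.Integer.GCD as ℤ
import Data.Integer.Properties as ℤ
import Data.Integer.Tactic.RingSolver as ℤ
open import Data.List.Base using ([]; _∷_; map; foldr)
open import Data.Nat.Base as ℕ using (ℕ; zero; suc)
open import Data.Nat.Coprimality using (Coprime; coprime-divisor)
open import Data.Nat.Divisibility as ℕ using (divides)
open import Data.Nat.Primality using (Prime; prime⇒irreducible; prime⇒nonTrivial)
import Data.Nat.Properties as ℕ
open import Data.Product.Base using (_×_; _,_; proj₁; proj₂; ∃; ∃₂)
import Data.Rational.Properties as ℚ
import Data.Rational.Unnormalised.Base as ℚᵘ
import Data.Rational.Unnormalised.Properties as ℚᵘ
open import Data.Sum.Base using (_⊎_; inj₁; inj₂; [_,_]′)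
open import Data.Vec.Base using (Vec; []; _∷_)
open import Level using (0ℓ)
open import Relation.Binary.PropositionalEquality
open import Relation.Nullary using (yes; no; contradiction; ¬_; Dec)
open import Relation.Nullary.Decidable using (dec⇒maybe; from-no; from-yes)
open import Tactic.RingSolver using (solve-∀)
open import Tactic.RingSolver.Core.AlmostCommutativeRing using (AlmostCommutativeRing; fromCommutativeRing)

-- Order on the Cauchy reals is undecidable, on ℚ it can be tested; hence every case split is made
-- at points of ℚ(i), and ℂ enters only when the hypothesis on zeros is applied to a limit. The
-- price is that no point met need be an exact zero, so each step carries a tolerance. In the
-- inductions on the degree that tolerance has to be fixed before the polynomial is known, because
-- deflating at a point gives a quotient that depends on the point. The hypothesis yields |θ| > d
-- zero by zero, with a margin depending on the zero and no positive lower bound given in advance.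
-- So only one margin is used. For the other zeros |θ| > d is weakened to |θ| ≥ 1, and further to
-- |θ|² ≥ 1 - σ, since an approximate zero is merely close to a genuine one. A nonzero integer
-- leading coefficient then gives |b₀|² ≥ E(1 - σ)ⁿ with E > d², which exceeds d² for small σ.

module Zeros where
  open import Data.Rational.Base as ℚ
    using (ℚ; 0ℚ; 1ℚ; ½; _+_; _*_; _-_; -_; ∣_∣; _<_; _≤_; _/_)

  -- Inequalities in ℚ

  ℚ-ring : AlmostCommutativeRing 0ℓ 0ℓ
  ℚ-ring = fromCommutativeRing ℚ.+-*-commutativeRing λ p → dec⇒maybe (0ℚ ℚ.≟ p)

  infixl 6 _+₀_
  infixl 7 _*₀_

  _+₀_ : ∀ {p q} → 0ℚ ≤ p → 0ℚ ≤ q → 0ℚ ≤ p + q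
  _+₀_ = ℚ.+-mono-≤

  _*₀_ : ∀ {p q} → 0ℚ ≤ p → 0ℚ ≤ q → 0ℚ ≤ p * q
  _*₀_ = *-nonNeg

  Δ : ∀ {p q} → p ≤ q → 0ℚ ≤ q - p
  Δ {p} {q} p≤q = subst (_≤ q - p) (ℚ.+-inverseʳ p) (ℚ.+-monoˡ-≤ (- p) p≤q)

  Δ< : ∀ {p q} → p < q → 0ℚ < q - p
  Δ< {p} {q} p<q = subst (_< q - p) (ℚ.+-inverseʳ p) (ℚ.+-monoˡ-< (- p) p<q)

  -- Most inequalities below are certified this way: the surplus `r` is a combination of quantities
  -- known to be nonnegative, `Δ` turning hypotheses into such quantities, and a ring identity does
  -- the rest.
  ≤-by : ∀ {p q r} → 0ℚ ≤ r → q ≡ p + r → p ≤ q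
  ≤-by {p} {q} {r} 0≤r eq = subst₂ _≤_ (ℚ.+-identityʳ p) (sym eq) (ℚ.+-monoʳ-≤ p 0≤r)

  <-by : ∀ {p q r} → 0ℚ < r → q ≡ p + r → p < q
  <-by {p} {q} {r} 0<r eq = subst₂ _<_ (ℚ.+-identityʳ p) (sym eq) (ℚ.+-monoʳ-< p 0<r)

  <⇒≱ : ∀ {p q} → p < q → ¬ q ≤ p
  <⇒≱ p<q q≤p = ℚ.<-irrefl refl (ℚ.<-≤-trans p<q q≤p)

  0≤½ : 0ℚ ≤ ½
  0≤½ = ℚ.nonNegative⁻¹ ½

  0≤1 : 0ℚ ≤ 1ℚ
  0≤1 = ℚ.nonNegative⁻¹ 1ℚ

  0<1 : 0ℚ < 1ℚ
  0<1 = ℚ.positive⁻¹ 1ℚ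

  0<½ : 0ℚ < ½
  0<½ = ℚ.positive⁻¹ ½

  ½≤1 : ½ ≤ 1ℚ
  ½≤1 = from-yes (½ ℚ.≤? 1ℚ)

  p≤∣p∣ : ∀ p → p ≤ ∣ p ∣
  p≤∣p∣ p with ℚ.≤-total 0ℚ p
  ... | inj₁ 0≤p = ℚ.≤-reflexive (sym (ℚ.0≤p⇒∣p∣≡p 0≤p))
  ... | inj₂ p≤0 = ℚ.≤-trans p≤0 (ℚ.0≤∣p∣ p)

  -p*-p≡p*p : ∀ p → - p * - p ≡ p * p
  -p*-p≡p*p = solve-∀ ℚ-ring

  ∣p∣*∣p∣ : ∀ p → ∣ p ∣ * ∣ p ∣ ≡ p * p
  ∣p∣*∣p∣ p with ℚ.∣p∣≡p∨∣p∣≡-p p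
  ... | inj₁ eq = cong₂ _*_ eq eq
  ... | inj₂ eq = trans (cong₂ _*_ eq eq) (-p*-p≡p*p p)

  0≤p² : ∀ p → 0ℚ ≤ p * p
  0≤p² p = subst (0ℚ ≤_) (∣p∣*∣p∣ p) (ℚ.0≤∣p∣ p *₀ ℚ.0≤∣p∣ p)

  square-cancel-≤ : ∀ {p q} → 0ℚ ≤ q → p * p ≤ q * q → p ≤ q
  square-cancel-≤ {p} {q} 0≤q pp≤qq with p ℚ.≤? q
  ... | yes p≤q = p≤q
  ... | no  p≰q = contradiction pp≤qq (<⇒≱ (<-by
    (*-pos 0<p-q (ℚ.+-mono-<-≤ 0<p-q (0≤q +₀ 0≤q))) (identity p q)))
    where
      identity : ∀ p q → p * p ≡ q * q + (p - q) * (p - q + (q + q))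
      identity = solve-∀ ℚ-ring
      0<p-q : 0ℚ < p - q
      0<p-q = Δ< (ℚ.≰⇒> p≰q)

  -- The field of Gaussian rationals as a commutative ring

  infix  9 _+𝐢_
  record ℚ[i] : Set where
    constructor _+𝐢_
    field
      ℜ ℑ : ℚ

  open ℚ[i] public

  infixl 6 _⊕_ _⊖_
  infixl 7 _⊗_
  infix  8 ⊝_

  _⊕_ _⊗_ _⊖_ : ℚ[i] → ℚ[i] → ℚ[i]
  z ⊕ w = (ℜ z + ℜ w) +𝐢 (ℑ z + ℑ w)
  z ⊗ w = (ℜ z * ℜ w - ℑ z * ℑ w) +𝐢 (ℜ z * ℑ w + ℑ z * ℜ w)

  ⊝_ conj : ℚ[i] → ℚ[i]
  ⊝ z = (- ℜ z) +𝐢 (- ℑ z)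
  conj z = ℜ z +𝐢 (- ℑ z)

  z ⊖ w = z ⊕ (⊝ w)

  ⟨_⟩ : ℚ → ℚ[i]
  ⟨ r ⟩ = r +𝐢 0ℚ

  0ᴳ 1ᴳ : ℚ[i]
  0ᴳ = ⟨ 0ℚ ⟩
  1ᴳ = ⟨ 1ℚ ⟩

  ⊗-comm : ∀ z w → z ⊗ w ≡ w ⊗ z
  ⊗-comm z w = cong₂ _+𝐢_ (real (ℜ z) (ℑ z) (ℜ w) (ℑ w)) (imag (ℜ z) (ℑ z) (ℜ w) (ℑ w))
    where
      real : ∀ a b c d → a * c - b * d ≡ c * a - d * b
      real = solve-∀ ℚ-ring
      imag : ∀ a b c d → a * d + b * c ≡ c * b + d * a
      imag = solve-∀ ℚ-ring

  ⊗-assoc : ∀ u z w → (u ⊗ z) ⊗ w ≡ u ⊗ (z ⊗ w)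
  ⊗-assoc u z w = cong₂ _+𝐢_
    (real (ℜ u) (ℑ u) (ℜ z) (ℑ z) (ℜ w) (ℑ w)) (imag (ℜ u) (ℑ u) (ℜ z) (ℑ z) (ℜ w) (ℑ w))
    where
      real : ∀ a b c d e f → (a * c - b * d) * e - (a * d + b * c) * f ≡ a * (c * e - d * f) - b * (c * f + d * e)
      real = solve-∀ ℚ-ring
      imag : ∀ a b c d e f → (a * c - b * d) * f + (a * d + b * c) * e ≡ a * (c * f + d * e) + b * (c * e - d * f)
      imag = solve-∀ ℚ-ring

  ⊗-identityˡ : ∀ z → 1ᴳ ⊗ z ≡ z
  ⊗-identityˡ z = cong₂ _+𝐢_ (real (ℜ z) (ℑ z)) (imag (ℜ z) (ℑ z))
    where
      real : ∀ a b → 1ℚ * a - 0ℚ * b ≡ a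
      real = solve-∀ ℚ-ring
      imag : ∀ a b → 1ℚ * b + 0ℚ * a ≡ b
      imag = solve-∀ ℚ-ring

  ⊗-distribˡ-⊕ : ∀ u z w → u ⊗ (z ⊕ w) ≡ u ⊗ z ⊕ u ⊗ w
  ⊗-distribˡ-⊕ u z w = cong₂ _+𝐢_
    (real (ℜ u) (ℑ u) (ℜ z) (ℑ z) (ℜ w) (ℑ w)) (imag (ℜ u) (ℑ u) (ℜ z) (ℑ z) (ℜ w) (ℑ w))
    where
      real : ∀ a b c d e f → a * (c + e) - b * (d + f) ≡ a * c - b * d + (a * e - b * f)
      real = solve-∀ ℚ-ring
      imag : ∀ a b c d e f → a * (d + f) + b * (c + e) ≡ a * d + b * c + (a * f + b * e)
      imag = solve-∀ ℚ-ring

  ℚ[i]-isCommutativeRing : IsCommutativeRing _≡_ _⊕_ _⊗_ ⊝_ 0ᴳ 1ᴳ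
  ℚ[i]-isCommutativeRing = record
    { isRing = record
      { +-isAbelianGroup = record
        { isGroup = record
          { isMonoid = record
            { isSemigroup = record
              { isMagma = isMagma _⊕_
              ; assoc = λ u z w → cong₂ _+𝐢_ (ℚ.+-assoc (ℜ u) (ℜ z) (ℜ w)) (ℚ.+-assoc (ℑ u) (ℑ z) (ℑ w)) }
            ; identity = (λ z → cong₂ _+𝐢_ (ℚ.+-identityˡ (ℜ z)) (ℚ.+-identityˡ (ℑ z)))
                       , (λ z → cong₂ _+𝐢_ (ℚ.+-identityʳ (ℜ z)) (ℚ.+-identityʳ (ℑ z))) }
          ; inverse = (λ z → cong₂ _+𝐢_ (ℚ.+-inverseˡ (ℜ z)) (ℚ.+-inverseˡ (ℑ z)))
                    , (λ z → cong₂ _+𝐢_ (ℚ.+-inverseʳ (ℜ z)) (ℚ.+-inverseʳ (ℑ z)))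
          ; ⁻¹-cong = cong ⊝_ }
        ; comm = λ z w → cong₂ _+𝐢_ (ℚ.+-comm (ℜ z) (ℜ w)) (ℚ.+-comm (ℑ z) (ℑ w)) }
      ; *-cong = cong₂ _⊗_
      ; *-assoc = ⊗-assoc
      ; *-identity = comm∧idˡ⇒id ⊗-comm ⊗-identityˡ
      ; distrib = ⊗-distribˡ-⊕ , comm∧distrˡ⇒distrʳ ⊗-comm ⊗-distribˡ-⊕ }
    ; *-comm = ⊗-comm }
    where open import Relation.Binary.PropositionalEquality.Algebra using (isMagma)

  _≟_ : (z w : ℚ[i]) → Dec (z ≡ w)
  (a +𝐢 b) ≟ (c +𝐢 d) with a ℚ.≟ c | b ℚ.≟ d
  ... | yes refl | yes refl = yes refl
  ... | no a≢c   | _        = no λ { refl → a≢c refl }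
  ... | _        | no b≢d   = no λ { refl → b≢d refl }

  ℚ[i]-ring : AlmostCommutativeRing 0ℓ 0ℓ
  ℚ[i]-ring = fromCommutativeRing (record { isCommutativeRing = ℚ[i]-isCommutativeRing }) λ z → dec⇒maybe (0ᴳ ≟ z)

  -- Two rational-valued sizes on ℚ(i)

  -- The modulus is not rational-valued, so two substitutes share its work: the 1-norm satisfies the
  -- triangle inequality and is submultiplicative, while the squared modulus `N` is exactly
  -- multiplicative. They are comparable, since `N` is at most the square of the 1-norm, which is at
  -- most twice `N`.
  ∥_∥ N : ℚ[i] → ℚ
  ∥ z ∥ = ∣ ℜ z ∣ + ∣ ℑ z ∣
  N z = ℜ z * ℜ z + ℑ z * ℑ z

  0≤∥_∥ : ∀ z → 0ℚ ≤ ∥ z ∥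
  0≤∥ z ∥ = ℚ.0≤∣p∣ (ℜ z) +₀ ℚ.0≤∣p∣ (ℑ z)

  0≤N : ∀ z → 0ℚ ≤ N z
  0≤N z = 0≤p² (ℜ z) +₀ 0≤p² (ℑ z)

  ∥-∥-⊕ : ∀ z w → ∥ z ⊕ w ∥ ≤ ∥ z ∥ + ∥ w ∥
  ∥-∥-⊕ z w = ≤-by
    (Δ (ℚ.∣p+q∣≤∣p∣+∣q∣ (ℜ z) (ℜ w)) +₀ Δ (ℚ.∣p+q∣≤∣p∣+∣q∣ (ℑ z) (ℑ w)))
    (identity (∣ ℜ z ∣) (∣ ℑ z ∣) (∣ ℜ w ∣) (∣ ℑ w ∣) (∣ ℜ z + ℜ w ∣) (∣ ℑ z + ℑ w ∣))
    where
      identity : ∀ a b c d s t → a + b + (c + d) ≡ s + t + (a + c - s + (b + d - t))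
      identity = solve-∀ ℚ-ring

  ∥-∥-⊝ : ∀ z → ∥ ⊝ z ∥ ≡ ∥ z ∥
  ∥-∥-⊝ z = cong₂ _+_ (ℚ.∣-p∣≡∣p∣ (ℜ z)) (ℚ.∣-p∣≡∣p∣ (ℑ z))

  ∥-∥-conj : ∀ z → ∥ conj z ∥ ≡ ∥ z ∥
  ∥-∥-conj z = cong (λ p → ∣ ℜ z ∣ + p) (ℚ.∣-p∣≡∣p∣ (ℑ z))

  ∥-∥-⊖ : ∀ z w → ∥ z ⊖ w ∥ ≤ ∥ z ∥ + ∥ w ∥
  ∥-∥-⊖ z w = subst (λ r → ∥ z ⊖ w ∥ ≤ ∥ z ∥ + r) (∥-∥-⊝ w) (∥-∥-⊕ z (⊝ w))

  ∥-∥-⊗ : ∀ z w → ∥ z ⊗ w ∥ ≤ ∥ z ∥ * ∥ w ∥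
  ∥-∥-⊗ (a +𝐢 b) (c +𝐢 d) = begin
    ∣ a * c - b * d ∣ + ∣ a * d + b * c ∣
      ≤⟨ ℚ.+-mono-≤ (ℚ.∣p-q∣≤∣p∣+∣q∣ (a * c) (b * d)) (ℚ.∣p+q∣≤∣p∣+∣q∣ (a * d) (b * c)) ⟩
    ∣ a * c ∣ + ∣ b * d ∣ + (∣ a * d ∣ + ∣ b * c ∣)
      ≡⟨ cong₂ _+_ (cong₂ _+_ (ℚ.∣p*q∣≡∣p∣*∣q∣ a c) (ℚ.∣p*q∣≡∣p∣*∣q∣ b d))
                   (cong₂ _+_ (ℚ.∣p*q∣≡∣p∣*∣q∣ a d) (ℚ.∣p*q∣≡∣p∣*∣q∣ b c)) ⟩
    ∣ a ∣ * ∣ c ∣ + ∣ b ∣ * ∣ d ∣ + (∣ a ∣ * ∣ d ∣ + ∣ b ∣ * ∣ c ∣)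
      ≡⟨ identity (∣ a ∣) (∣ b ∣) (∣ c ∣) (∣ d ∣) ⟩
    (∣ a ∣ + ∣ b ∣) * (∣ c ∣ + ∣ d ∣) ∎
    where
      open ℚ.≤-Reasoning
      identity : ∀ a b c d → a * c + b * d + (a * d + b * c) ≡ (a + b) * (c + d)
      identity = solve-∀ ℚ-ring

  N≡ : ∀ z → N z ≡ ∣ ℜ z ∣ * ∣ ℜ z ∣ + ∣ ℑ z ∣ * ∣ ℑ z ∣
  N≡ z = sym (cong₂ _+_ (∣p∣*∣p∣ (ℜ z)) (∣p∣*∣p∣ (ℑ z)))

  N≤∥-∥² : ∀ z → N z ≤ ∥ z ∥ * ∥ z ∥
  N≤∥-∥² z = subst (_≤ ∥ z ∥ * ∥ z ∥) (sym (N≡ z))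
    (≤-by (0≤ab +₀ 0≤ab) (identity (∣ ℜ z ∣) (∣ ℑ z ∣)))
    where
      identity : ∀ a b → (a + b) * (a + b) ≡ a * a + b * b + (a * b + a * b)
      identity = solve-∀ ℚ-ring
      0≤ab : 0ℚ ≤ ∣ ℜ z ∣ * ∣ ℑ z ∣
      0≤ab = ℚ.0≤∣p∣ (ℜ z) *₀ ℚ.0≤∣p∣ (ℑ z)

  ∥-∥²≤2N : ∀ z → ∥ z ∥ * ∥ z ∥ ≤ N z + N z
  ∥-∥²≤2N z = subst (λ n → ∥ z ∥ * ∥ z ∥ ≤ n + n) (sym (N≡ z))
    (≤-by (0≤p² (∣ ℜ z ∣ - ∣ ℑ z ∣)) (identity (∣ ℜ z ∣) (∣ ℑ z ∣)))
    where
      identity : ∀ a b → a * a + b * b + (a * a + b * b) ≡ (a + b) * (a + b) + (a - b) * (a - b)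
      identity = solve-∀ ℚ-ring

  N-⊗ : ∀ z w → N (z ⊗ w) ≡ N z * N w
  N-⊗ z w = identity (ℜ z) (ℑ z) (ℜ w) (ℑ w)
    where
      identity : ∀ a b c d → (a * c - b * d) * (a * c - b * d) + (a * d + b * c) * (a * d + b * c) ≡
                             (a * a + b * b) * (c * c + d * d)
      identity = solve-∀ ℚ-ring

  -- The cross term 2ℜ(z̄w) is the first-order effect of adding w, so lowering the modulus amounts
  -- to making ℜ(z̄w) sufficiently negative.
  N-⊕ : ∀ z w → N (z ⊕ w) ≡ N z + (ℜ (conj z ⊗ w) + ℜ (conj z ⊗ w)) + N w
  N-⊕ z w = identity (ℜ z) (ℑ z) (ℜ w) (ℑ w)
    where
      identity : ∀ a b c d → (a + c) * (a + c) + (b + d) * (b + d) ≡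
        a * a + b * b + (a * c - - b * d + (a * c - - b * d)) + (c * c + d * d)
      identity = solve-∀ ℚ-ring

  ℜ≤∥-∥ : ∀ z → ℜ z ≤ ∥ z ∥
  ℜ≤∥-∥ z = ≤-by (Δ (p≤∣p∣ (ℜ z)) +₀ ℚ.0≤∣p∣ (ℑ z)) (identity (ℜ z) (∣ ℜ z ∣) (∣ ℑ z ∣))
    where
      identity : ∀ a s t → s + t ≡ a + (s - a + t)
      identity = solve-∀ ℚ-ring

  -- Passing through `N` costs a factor 2 for each factor on the left, hence 4 for the squares and 2
  -- in the end. This is how a bound on a product yields one on a factor.
  ∥-∥∥-∥≤2∥-⊗-∥ : ∀ z w → ∥ z ∥ * ∥ w ∥ ≤ ∥ z ⊗ w ∥ + ∥ z ⊗ w ∥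
  ∥-∥∥-∥≤2∥-⊗-∥ z w = square-cancel-≤ (0≤∥ z ⊗ w ∥ +₀ 0≤∥ z ⊗ w ∥) (begin
    ∥ z ∥ * ∥ w ∥ * (∥ z ∥ * ∥ w ∥)
      ≡⟨ squares (∥ z ∥) (∥ w ∥) ⟩
    ∥ z ∥ * ∥ z ∥ * (∥ w ∥ * ∥ w ∥)
      ≤⟨ *-mono-≤ (0≤p² ∥ z ∥) (0≤N w +₀ 0≤N w) (∥-∥²≤2N z) (∥-∥²≤2N w) ⟩
    (N z + N z) * (N w + N w)
      ≡⟨ expand (N z) (N w) ⟩
    N z * N w + N z * N w + (N z * N w + N z * N w)
      ≡⟨ cong (λ n → n + n + (n + n)) (sym (N-⊗ z w)) ⟩
    N (z ⊗ w) + N (z ⊗ w) + (N (z ⊗ w) + N (z ⊗ w))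
      ≤⟨ ℚ.+-mono-≤ (ℚ.+-mono-≤ N≤ N≤) (ℚ.+-mono-≤ N≤ N≤) ⟩
    ∥ z ⊗ w ∥ * ∥ z ⊗ w ∥ + ∥ z ⊗ w ∥ * ∥ z ⊗ w ∥ + (∥ z ⊗ w ∥ * ∥ z ⊗ w ∥ + ∥ z ⊗ w ∥ * ∥ z ⊗ w ∥)
      ≡⟨ collect (∥ z ⊗ w ∥) ⟩
    (∥ z ⊗ w ∥ + ∥ z ⊗ w ∥) * (∥ z ⊗ w ∥ + ∥ z ⊗ w ∥) ∎)
    where
      open ℚ.≤-Reasoning
      N≤ = N≤∥-∥² (z ⊗ w)
      squares : ∀ p q → p * q * (p * q) ≡ p * p * (q * q)
      squares = solve-∀ ℚ-ring
      expand : ∀ m n → (m + m) * (n + n) ≡ m * n + m * n + (m * n + m * n)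
      expand = solve-∀ ℚ-ring
      collect : ∀ p → p * p + p * p + (p * p + p * p) ≡ (p + p) * (p + p)
      collect = solve-∀ ℚ-ring

  ∥⟨_⟩∥ : ∀ {r} → 0ℚ ≤ r → ∥ ⟨ r ⟩ ∥ ≡ r
  ∥⟨_⟩∥ {r} 0≤r = trans (ℚ.+-identityʳ ∣ r ∣) (ℚ.0≤p⇒∣p∣≡p 0≤r)

  -- Powers, division and the Archimedean property

  infixr 8 _^_ _^ᴳ_

  _^_ : ℚ → ℕ → ℚ
  p ^ zero  = 1ℚ
  p ^ suc n = p * p ^ n

  0≤^ : ∀ {p} → 0ℚ ≤ p → ∀ n → 0ℚ ≤ p ^ n
  0≤^ 0≤p zero    = 0≤1
  0≤^ 0≤p (suc n) = 0≤p *₀ 0≤^ 0≤p n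

  0<^ : ∀ {p} → 0ℚ < p → ∀ n → 0ℚ < p ^ n
  0<^ 0<p zero    = 0<1
  0<^ 0<p (suc n) = *-pos 0<p (0<^ 0<p n)

  ^≤1 : ∀ {p} → 0ℚ ≤ p → p ≤ 1ℚ → ∀ n → p ^ n ≤ 1ℚ
  ^≤1 0≤p p≤1 zero    = ℚ.≤-refl
  ^≤1 0≤p p≤1 (suc n) = *-mono-≤ 0≤p 0≤1 p≤1 (^≤1 0≤p p≤1 n)

  _^ᴳ_ : ℚ[i] → ℕ → ℚ[i]
  z ^ᴳ zero  = 1ᴳ
  z ^ᴳ suc n = z ⊗ z ^ᴳ n

  ^ᴳ-homo-* : ∀ z m n → z ^ᴳ (m ℕ.+ n) ≡ z ^ᴳ m ⊗ z ^ᴳ n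
  ^ᴳ-homo-* z zero    n = identity (z ^ᴳ n)
    where
      identity : ∀ w → w ≡ 1ᴳ ⊗ w
      identity = solve-∀ ℚ[i]-ring
  ^ᴳ-homo-* z (suc m) n = trans (cong (z ⊗_) (^ᴳ-homo-* z m n)) (identity z (z ^ᴳ m) (z ^ᴳ n))
    where
      identity : ∀ u v w → u ⊗ (v ⊗ w) ≡ u ⊗ v ⊗ w
      identity = solve-∀ ℚ[i]-ring

  ^ᴳ-distrib-* : ∀ z w n → (z ⊗ w) ^ᴳ n ≡ z ^ᴳ n ⊗ w ^ᴳ n
  ^ᴳ-distrib-* z w zero    = refl
  ^ᴳ-distrib-* z w (suc n) = trans (cong (z ⊗ w ⊗_) (^ᴳ-distrib-* z w n))
    (identity z w (z ^ᴳ n) (w ^ᴳ n))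
    where
      identity : ∀ u v p q → u ⊗ v ⊗ (p ⊗ q) ≡ u ⊗ p ⊗ (v ⊗ q)
      identity = solve-∀ ℚ[i]-ring

  1ᴳ^ : ∀ n → 1ᴳ ^ᴳ n ≡ 1ᴳ
  1ᴳ^ zero    = refl
  1ᴳ^ (suc n) = cong (1ᴳ ⊗_) (1ᴳ^ n)

  ^ᴳ-assocʳ : ∀ z m n → (z ^ᴳ m) ^ᴳ n ≡ z ^ᴳ (m ℕ.* n)
  ^ᴳ-assocʳ z zero    n = 1ᴳ^ n
  ^ᴳ-assocʳ z (suc m) n = trans (^ᴳ-distrib-* z (z ^ᴳ m) n)
    (trans (cong (z ^ᴳ n ⊗_) (^ᴳ-assocʳ z m n)) (sym (^ᴳ-homo-* z n (m ℕ.* n))))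

  div : ∀ {ε c} → 0ℚ < ε → 0ℚ < c → ∃ λ δ → 0ℚ < δ × c * δ ≡ ε
  div {ε} {c} 0<ε 0<c = ε * (ℚ.1/ c)
    , *-pos 0<ε (ℚ.positive⁻¹ (ℚ.1/ c) {{ℚ.1/pos⇒pos c}})
    , (begin
        c * (ε * (ℚ.1/ c))  ≡⟨ swap c ε (ℚ.1/ c) ⟩
        ε * (c * (ℚ.1/ c))  ≡⟨ cong (ε *_) (ℚ.*-inverseʳ c) ⟩
        ε * 1ℚ              ≡⟨ ℚ.*-identityʳ ε ⟩
        ε                   ∎)
    where
      open ≡-Reasoning
      swap : ∀ p q r → p * (q * r) ≡ q * (p * r)
      swap = solve-∀ ℚ-ring
      instance
        c-pos : ℚ.Positive c
        c-pos = ℚ.positive 0<c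
        c-nonZero : ℚ.NonZero c
        c-nonZero = ℚ.pos⇒nonZero c

  min : ∀ {p q} → 0ℚ < p → 0ℚ < q → ∃ λ r → 0ℚ < r × r ≤ p × r ≤ q
  min {p} {q} 0<p 0<q with ℚ.≤-total p q
  ... | inj₁ p≤q = p , 0<p , ℚ.≤-refl , p≤q
  ... | inj₂ q≤p = q , 0<q , q≤p , ℚ.≤-refl

  ι*½^≤1 : ∀ n → ι (suc n) * ½ ^ n ≤ 1ℚ
  ι*½^≤1 zero    = ℚ.≤-refl
  ι*½^≤1 (suc n) = subst (λ p → p * (½ * ½ ^ n) ≤ 1ℚ) (sym (ι-+ 1 (suc n)))
    (≤-by (0≤½ *₀ Δ (ι*½^≤1 n) +₀ 0≤½ *₀ Δ (^≤1 0≤½ ½≤1 n)) (identity (ι (suc n)) (½ ^ n)))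
    where
      identity : ∀ m h → 1ℚ ≡ (1ℚ + m) * (½ * h) + (½ * (1ℚ - m * h) + ½ * (1ℚ - h))
      identity = solve-∀ ℚ-ring

  ½^→0 : ∀ {ε} → 0ℚ < ε → ∃ λ n → ∀ m → n ℕ.≤ m → ½ ^ m ≤ ε
  ½^→0 {ε} 0<ε = let n , h = 1/ₙ→0 0<ε in n , λ m n≤m → ℚ.≤-trans (bound m) (h m n≤m)
    where
      bound : ∀ m → ½ ^ m ≤ 1ℤ / suc m
      bound m = ℚ.*-cancelʳ-≤-pos (ι (suc m)) {{ℚ.positive (ι-mono-< {0} {suc m} (ℕ.s≤s ℕ.z≤n))}}
        (subst₂ _≤_ (ℚ.*-comm (ι (suc m)) (½ ^ m)) (sym (/-*-ι 1 m)) (ι*½^≤1 m))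

  archimedean : ∀ b {c} → 0ℚ < c → ∃ λ n → b ≤ ι n * c
  archimedean b {c} 0<c with b ℚ.≤? 0ℚ
  ... | yes b≤0 = 0 , subst (b ≤_) (sym (ℚ.*-zeroˡ c)) b≤0
  ... | no  b≰0 =
    let δ , 0<δ , bδ≡c = div 0<c (ℚ.≰⇒> b≰0)
        n , h = 1/ₙ→0 0<δ
    in suc n , subst (b ≤_) (cong (ι (suc n) *_) bδ≡c)
         (≤-by ((ℚ.<⇒≤ (ℚ.≰⇒> b≰0) *₀ 0≤ι (suc n)) *₀ Δ (h n ℕ.≤-refl))
           (trans (identity b (ι (suc n)) δ (1ℤ / suc n))
             (cong (_+ b * ι (suc n) * (δ - 1ℤ / suc n))
               (trans (cong (b *_) (/-*-ι 1 n)) (ℚ.*-identityʳ b)))))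
    where
      identity : ∀ b m d e → m * (b * d) ≡ b * (e * m) + b * m * (d - e)
      identity = solve-∀ ℚ-ring

  -- The embedding of ℤ in ℚ

  κ : ℤ → ℚ
  κ a = a / 1

  κ-+ : ∀ a b → κ (a ℤ.+ b) ≡ κ a + κ b
  κ-+ a b = ℚ.toℚᵘ-injective (begin
    ℚ.toℚᵘ (κ (a ℤ.+ b))                ≈⟨ toℚᵘ-/ (a ℤ.+ b) 0 ⟩
    ℚᵘ.mkℚᵘ (a ℤ.+ b) 0                 ≈⟨ ℚᵘ.*≡* (cong (ℤ._* + 1) (sym
                                             (cong₂ ℤ._+_ (ℤ.*-identityʳ a) (ℤ.*-identityʳ b)))) ⟩
    ℚᵘ.mkℚᵘ a 0 ℚᵘ.+ ℚᵘ.mkℚᵘ b 0        ≈⟨ ℚᵘ.+-cong (toℚᵘ-/ a 0) (toℚᵘ-/ b 0) ⟨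
    ℚ.toℚᵘ (κ a) ℚᵘ.+ ℚ.toℚᵘ (κ b)      ≈⟨ ℚ.toℚᵘ-homo-+ (κ a) (κ b) ⟨
    ℚ.toℚᵘ (κ a + κ b)                  ∎)
    where open ℚᵘ.≃-Reasoning

  κ-* : ∀ a b → κ (a ℤ.* b) ≡ κ a * κ b
  κ-* a b = ℚ.toℚᵘ-injective (begin
    ℚ.toℚᵘ (κ (a ℤ.* b))                ≈⟨ toℚᵘ-/ (a ℤ.* b) 0 ⟩
    ℚᵘ.mkℚᵘ a 0 ℚᵘ.* ℚᵘ.mkℚᵘ b 0        ≈⟨ ℚᵘ.*-cong (toℚᵘ-/ a 0) (toℚᵘ-/ b 0) ⟨
    ℚ.toℚᵘ (κ a) ℚᵘ.* ℚ.toℚᵘ (κ b)      ≈⟨ ℚ.toℚᵘ-homo-* (κ a) (κ b) ⟨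
    ℚ.toℚᵘ (κ a * κ b)                  ∎)
    where open ℚᵘ.≃-Reasoning

  κ-injective : ∀ {a b} → κ a ≡ κ b → a ≡ b
  κ-injective {a} {b} eq with ℚᵘ.≃-trans (ℚᵘ.≃-sym (toℚᵘ-/ a 0))
                                (ℚᵘ.≃-trans (ℚᵘ.≃-reflexive (cong ℚ.toℚᵘ eq)) (toℚᵘ-/ b 0))
  ... | ℚᵘ.*≡* a*1≡b*1 = trans (sym (ℤ.*-identityʳ a)) (trans a*1≡b*1 (ℤ.*-identityʳ b))

  -- Directions on the rational unit circle

  -- A point of the unit circle which is not a root of unity.
  opaque
    W : ℚ[i]
    W = (+ 3 / 5) +𝐢 (+ 4 / 5)

    ℜW : ℜ W ≡ + 3 / 5
    ℜW = refl

    ℑW : ℑ W ≡ + 4 / 5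
    ℑW = refl

  N-W^ : ∀ n → N (W ^ᴳ n) ≡ 1ℚ
  N-W^ zero    = refl
  N-W^ (suc n) = trans (N-⊗ W (W ^ᴳ n)) (cong₂ _*_ (cong₂ (λ p q → p * p + q * q) ℜW ℑW) (N-W^ n))

  -- (3 + 4i)ⁿ ≡ 3 + 4i modulo 5 for n ≥ 1.
  5W^≡3+4i : ∀ n → ∃₂ λ a b →
    ℜ (W ^ᴳ suc n) * κ (+ 5) ^ suc n ≡ κ (+ 5 ℤ.* a ℤ.+ + 3) ×
    ℑ (W ^ᴳ suc n) * κ (+ 5) ^ suc n ≡ κ (+ 5 ℤ.* b ℤ.+ + 4)
  5W^≡3+4i zero    = 0ℤ , 0ℤ
    , cong₂ (λ p q → (p * 1ℚ - q * 0ℚ) * (κ (+ 5) * 1ℚ)) ℜW ℑW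
    , cong₂ (λ p q → (p * 0ℚ + q * 1ℚ) * (κ (+ 5) * 1ℚ)) ℜW ℑW
  5W^≡3+4i (suc n) with 5W^≡3+4i n
  ... | a , b , eqA , eqB = a′ , b′ , (begin
      (ℜ W * x - ℑ W * y) * (κ (+ 5) * P)
        ≡⟨ cong₂ (λ p q → (p * x - q * y) * (κ (+ 5) * P)) ℜW ℑW ⟩
      (+ 3 / 5 * x - + 4 / 5 * y) * (κ (+ 5) * P)
        ≡⟨ real x y P ⟩
      κ (+ 3) * (x * P) + κ -[1+ 3 ] * (y * P)
        ≡⟨ cong₂ (λ p q → κ (+ 3) * p + κ -[1+ 3 ] * q) eqA eqB ⟩
      κ (+ 3) * κ A + κ -[1+ 3 ] * κ B
        ≡⟨ cong₂ _+_ (κ-* (+ 3) A) (κ-* -[1+ 3 ] B) ⟨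
      κ (+ 3 ℤ.* A) + κ (-[1+ 3 ] ℤ.* B)
        ≡⟨ κ-+ (+ 3 ℤ.* A) (-[1+ 3 ] ℤ.* B) ⟨
      κ (+ 3 ℤ.* A ℤ.+ -[1+ 3 ] ℤ.* B)
        ≡⟨ cong κ (stepA a b) ⟩
      κ (+ 5 ℤ.* a′ ℤ.+ + 3) ∎) , (begin
      (ℜ W * y + ℑ W * x) * (κ (+ 5) * P)
        ≡⟨ cong₂ (λ p q → (p * y + q * x) * (κ (+ 5) * P)) ℜW ℑW ⟩
      (+ 3 / 5 * y + + 4 / 5 * x) * (κ (+ 5) * P)
        ≡⟨ imag x y P ⟩
      κ (+ 4) * (x * P) + κ (+ 3) * (y * P)
        ≡⟨ cong₂ (λ p q → κ (+ 4) * p + κ (+ 3) * q) eqA eqB ⟩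
      κ (+ 4) * κ A + κ (+ 3) * κ B
        ≡⟨ cong₂ _+_ (κ-* (+ 4) A) (κ-* (+ 3) B) ⟨
      κ (+ 4 ℤ.* A) + κ (+ 3 ℤ.* B)
        ≡⟨ κ-+ (+ 4 ℤ.* A) (+ 3 ℤ.* B) ⟨
      κ (+ 4 ℤ.* A ℤ.+ + 3 ℤ.* B)
        ≡⟨ cong κ (stepB a b) ⟩
      κ (+ 5 ℤ.* b′ ℤ.+ + 4) ∎)
    where
      open ≡-Reasoning
      x = ℜ (W ^ᴳ suc n)
      y = ℑ (W ^ᴳ suc n)
      P = κ (+ 5) ^ suc n
      A = + 5 ℤ.* a ℤ.+ + 3
      B = + 5 ℤ.* b ℤ.+ + 4
      -- Multiplying A + Bi by 3 + 4i gives 3A - 4B and 4A + 3B; their constants are -7 = 5(-2) + 3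
      -- and 24 = 5·4 + 4.
      a′ = + 3 ℤ.* a ℤ.+ -[1+ 3 ] ℤ.* b ℤ.+ -[1+ 1 ]
      b′ = + 4 ℤ.* a ℤ.+ + 3 ℤ.* b ℤ.+ + 4
      real : ∀ x y P → (+ 3 / 5 * x - + 4 / 5 * y) * (κ (+ 5) * P) ≡
                       κ (+ 3) * (x * P) + κ -[1+ 3 ] * (y * P)
      real = solve-∀ ℚ-ring
      imag : ∀ x y P → (+ 3 / 5 * y + + 4 / 5 * x) * (κ (+ 5) * P) ≡
                       κ (+ 4) * (x * P) + κ (+ 3) * (y * P)
      imag = solve-∀ ℚ-ring
      stepA : ∀ a b → + 3 ℤ.* (+ 5 ℤ.* a ℤ.+ + 3) ℤ.+ -[1+ 3 ] ℤ.* (+ 5 ℤ.* b ℤ.+ + 4) ≡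
                      + 5 ℤ.* (+ 3 ℤ.* a ℤ.+ -[1+ 3 ] ℤ.* b ℤ.+ -[1+ 1 ]) ℤ.+ + 3
      stepA = ℤ.solve-∀
      stepB : ∀ a b → + 4 ℤ.* (+ 5 ℤ.* a ℤ.+ + 3) ℤ.+ + 3 ℤ.* (+ 5 ℤ.* b ℤ.+ + 4) ≡
                      + 5 ℤ.* (+ 4 ℤ.* a ℤ.+ + 3 ℤ.* b ℤ.+ + 4) ℤ.+ + 4
      stepB = ℤ.solve-∀

  -- The scaled imaginary part is 4 modulo 5, so it cannot vanish: no positive power of `W` is real.
  ℑW^≢0 : ∀ n → ¬ ℑ (W ^ᴳ suc n) ≡ 0ℚ
  ℑW^≢0 n ℑ≡0 with 5W^≡3+4i n
  ... | _ , b , _ , eq = from-no (5 ℕ.∣? 4) (divides ℤ.∣ b ∣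
    (trans (cong ℤ.∣_∣ -4≡5b) (trans (ℤ.abs-* (+ 5) b) (ℕ.*-comm 5 ℤ.∣ b ∣))))
    where
      0≡5b+4 : 0ℤ ≡ + 5 ℤ.* b ℤ.+ + 4
      0≡5b+4 = κ-injective (trans (sym (ℚ.*-zeroˡ (κ (+ 5) ^ suc n)))
                 (trans (cong (_* κ (+ 5) ^ suc n) (sym ℑ≡0)) eq))
      cancel : ∀ c → (c ℤ.+ + 4) ℤ.+ -[1+ 3 ] ≡ c
      cancel = ℤ.solve-∀
      -4≡5b : -[1+ 3 ] ≡ + 5 ℤ.* b
      -4≡5b = trans (cong (ℤ._+ -[1+ 3 ]) 0≡5b+4) (cancel (+ 5 ℤ.* b))

  0<p² : ∀ {p} → ¬ p ≡ 0ℚ → 0ℚ < p * p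
  0<p² {p} p≢0 with p * p ℚ.≤? 0ℚ
  ... | no  pp≰0 = ℚ.≰⇒> pp≰0
  ... | yes pp≤0 = contradiction (ℚ.∣p∣≡0⇒p≡0 p (ℚ.≤-antisym ∣p∣≤0 (ℚ.0≤∣p∣ p))) p≢0
    where
      ∣p∣≤0 : ∣ p ∣ ≤ 0ℚ
      ∣p∣≤0 = square-cancel-≤ ℚ.≤-refl (subst (_≤ 0ℚ) (sym (∣p∣*∣p∣ p)) pp≤0)

  -- Doubling an angle with cosine x ≥ 0 at least doubles 1 - x, so repeated
  -- squaring reaches the left half-plane.
  left-half-plane : ∀ k J e → ½ ^ J < 1ℚ - ℜ (W ^ᴳ (suc e ℕ.* suc k)) →
    ∃ λ e′ → ℜ (W ^ᴳ (suc e′ ℕ.* suc k)) < 0ℚ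
  left-half-plane k J e h with ℜ (W ^ᴳ (suc e ℕ.* suc k)) ℚ.<? 0ℚ
  ... | yes x<0 = e , x<0
  left-half-plane k zero    e h | no x≮0 = contradiction
    (<-by (Δ< h) (identity (ℜ (W ^ᴳ (suc e ℕ.* suc k))))) x≮0
    where
      identity : ∀ x → 0ℚ ≡ x + (1ℚ - x - 1ℚ)
      identity = solve-∀ ℚ-ring
  -- The exponent is counted by `suc e`, so doubling it takes `e` to `e + suc e`; each doubling uses
  -- up one factor ½ of the lower bound on 1 - x.
  left-half-plane k (suc J) e h | no x≮0 = left-half-plane k J (e ℕ.+ suc e)
    (subst (λ z → ½ ^ J < 1ℚ - ℜ z) (sym double) bound)
    where
      m = suc e ℕ.* suc k
      v = W ^ᴳ m
      double : W ^ᴳ ((suc e ℕ.+ suc e) ℕ.* suc k) ≡ v ⊗ v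
      double = trans (cong (W ^ᴳ_) (ℕ.*-distribʳ-+ (suc k) (suc e) (suc e))) (^ᴳ-homo-* W m m)
      identity : ∀ x y h → 1ℚ - (x * x - y * y) ≡
        h + ((1ℚ - x - ½ * h) + (1ℚ - x - ½ * h) + (½ * h * x + (1ℚ - x - ½ * h) * x) * (1ℚ + 1ℚ)
             - (1ℚ - (x * x + y * y)))
      identity = solve-∀ ℚ-ring
      0<s = Δ< h
      bound : ½ ^ J < 1ℚ - ℜ (v ⊗ v)
      bound = <-by (subst (λ n → 0ℚ < d + d + (½ * ½ ^ J * x + d * x) * (1ℚ + 1ℚ) - (1ℚ - n))
                (sym (N-W^ m)) (subst (0ℚ <_) (sym (ℚ.+-identityʳ _))
                  (ℚ.+-mono-<-≤ (ℚ.+-mono-< 0<s 0<s)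
                    ((ℚ.<⇒≤ (0<^ 0<½ (suc J)) *₀ ℚ.≮⇒≥ x≮0 +₀ ℚ.<⇒≤ 0<s *₀ ℚ.≮⇒≥ x≮0) *₀ (0≤1 +₀ 0≤1)))))
                (identity x (ℑ v) (½ ^ J))
        where
          x = ℜ v
          d = 1ℚ - x - ½ * ½ ^ J

  conj-⊗ : ∀ z w → conj (z ⊗ w) ≡ conj z ⊗ conj w
  conj-⊗ z w = cong₂ _+𝐢_ (real (ℜ z) (ℑ z) (ℜ w) (ℑ w)) (imag (ℜ z) (ℑ z) (ℜ w) (ℑ w))
    where
      real : ∀ a b c d → a * c - b * d ≡ a * c - - b * - d
      real = solve-∀ ℚ-ring
      imag : ∀ a b c d → - (a * d + b * c) ≡ a * - d + - b * c
      imag = solve-∀ ℚ-ring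

  conj-^ : ∀ z n → conj z ^ᴳ n ≡ conj (z ^ᴳ n)
  conj-^ z zero    = refl
  conj-^ z (suc n) = trans (cong (conj z ⊗_) (conj-^ z n)) (sym (conj-⊗ z (z ^ᴳ n)))

  N-conj : ∀ z → N (conj z) ≡ N z
  N-conj z = cong (λ p → ℜ z * ℜ z + p) (-p*-p≡p*p (ℑ z))

  ℑ²≤N : ∀ z → ℑ z * ℑ z ≤ N z
  ℑ²≤N z = ≤-by (0≤p² (ℜ z)) (ℚ.+-comm (ℜ z * ℜ z) (ℑ z * ℑ z))

  ℜ²≤N : ∀ z → ℜ z * ℜ z ≤ N z
  ℜ²≤N z = ≤-by (0≤p² (ℑ z)) refl

  p≤0⇒∣p∣≡-p : ∀ {p} → p ≤ 0ℚ → ∣ p ∣ ≡ - p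
  p≤0⇒∣p∣≡-p {p} p≤0 = trans (sym (ℚ.∣-p∣≡∣p∣ p))
    (ℚ.0≤p⇒∣p∣≡p (subst (0ℚ ≤_) (ℚ.+-identityˡ (- p)) (Δ p≤0)))

  -- With v = - x + yi, every u = a ± bi has a real part ℜ(u), ℜ(uv) or ℜ(uv̄)
  -- that is negative and not small: 1, v and v̄ positively span the plane.
  positively-spanning : ∀ {x y b} a → 0ℚ ≤ x → x ≤ 1ℚ → 0ℚ ≤ y → y ≤ 1ℚ → 0ℚ ≤ b →
    a ≤ - (½ * ½ * (x * y) * (∣ a ∣ + b)) ⊎ - (a * x) - b * y ≤ - (½ * ½ * (x * y) * (∣ a ∣ + b))
  positively-spanning {x} {y} {b} a 0≤x x≤1 0≤y y≤1 0≤b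
    with a ℚ.≤? - (½ * ½ * (x * y) * (∣ a ∣ + b)) | ℚ.≤-total 0ℚ a
  ... | yes a≤  | _        = inj₁ a≤
  ... | no  a≰  | inj₁ 0≤a = inj₂
    (subst (λ p → - (a * x) - b * y ≤ - (½ * ½ * (x * y) * (p + b))) (sym (ℚ.0≤p⇒∣p∣≡p 0≤a)) (≤-by
      (0≤a *₀ (0≤x *₀ (0≤¼ *₀ Δ y≤1 +₀ 0≤¼ +₀ 0≤½)) +₀ 0≤b *₀ (0≤y *₀ (0≤¼ *₀ Δ x≤1 +₀ 0≤¼ +₀ 0≤½)))
      (identity a x y b)))
    where
      identity : ∀ a x y b → - (½ * ½ * (x * y) * (a + b)) ≡ - (a * x) - b * y +
        (a * (x * (½ * ½ * (1ℚ - y) + ½ * ½ + ½)) + b * (y * (½ * ½ * (1ℚ - x) + ½ * ½ + ½)))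
      identity = solve-∀ ℚ-ring
      0≤¼ : 0ℚ ≤ ½ * ½
      0≤¼ = 0≤½ *₀ 0≤½
  -- Here a > -c with c = ¼xy(|a| + b). As ax + by = a(x + y) + (b - a)y and b - a = |a| + b, the
  -- surplus is (a + c)(x + y) plus |a| + b times `r` = y(1 - ¼x(1 + x + y)), nonnegative because x,
  -- y ≤ 1.
  ... | no  a≰  | inj₂ a≤0 = inj₂ (≤-by
    (Δ (ℚ.<⇒≤ (ℚ.≰⇒> a≰)) *₀ (0≤x +₀ 0≤y) +₀ (ℚ.0≤∣p∣ a +₀ 0≤b) *₀ 0≤r)
    (trans (cong (λ p → - (½ * ½ * (x * y) * (p + b))) ∣a∣≡-a)
      (trans (identity a x y b) (cong (λ p → - (a * x) - b * y + ((a - - (½ * ½ * (x * y) * (p + b))) * (x + y) +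
         (p + b) * r)) (sym ∣a∣≡-a)))))
    where
      ∣a∣≡-a = p≤0⇒∣p∣≡-p a≤0
      0≤¼ : 0ℚ ≤ ½ * ½
      0≤¼ = 0≤½ *₀ 0≤½
      r : ℚ
      r = y * (½ * ½ + ½ * ½ * (1ℚ - x) + ½ * ½ * ((1ℚ - x) * (1ℚ + x)) + ½ * ½ * ((1ℚ - x) + x * (1ℚ - y)))
      0≤r : 0ℚ ≤ r
      0≤r = 0≤y *₀ (0≤¼ +₀ 0≤¼ *₀ Δ x≤1 +₀ 0≤¼ *₀ (Δ x≤1 *₀ (0≤1 +₀ 0≤x))
         +₀ 0≤¼ *₀ (Δ x≤1 +₀ 0≤x *₀ Δ y≤1))
      identity : ∀ a x y b → - (½ * ½ * (x * y) * (- a + b)) ≡ - (a * x) - b * y +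
        ((a - - (½ * ½ * (x * y) * (- a + b))) * (x + y) +
        (- a + b) * (y * (½ * ½ + ½ * ½ * (1ℚ - x) + ½ * ½ * ((1ℚ - x) * (1ℚ + x))
           + ½ * ½ * ((1ℚ - x) + x * (1ℚ - y)))))
      identity = solve-∀ ℚ-ring

  ⟨⟩-* : ∀ p q → ⟨ p * q ⟩ ≡ ⟨ p ⟩ ⊗ ⟨ q ⟩
  ⟨⟩-* p q = cong₂ _+𝐢_ (real p q) (imag p q)
    where
      real : ∀ p q → p * q ≡ p * q - 0ℚ * 0ℚ
      real = solve-∀ ℚ-ring
      imag : ∀ p q → 0ℚ ≡ p * 0ℚ + 0ℚ * q
      imag = solve-∀ ℚ-ring

  ⟨_⟩^ : ∀ r n → ⟨ r ⟩ ^ᴳ n ≡ ⟨ r ^ n ⟩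
  ⟨ r ⟩^ zero    = refl
  ⟨ r ⟩^ (suc n) = trans (cong (⟨ r ⟩ ⊗_) (⟨ r ⟩^ n)) (sym (⟨⟩-* r (r ^ n)))

  ℜ-scale : ∀ u r s n → ℜ (u ⊗ (⟨ r ⟩ ⊗ s) ^ᴳ n) ≡ r ^ n * ℜ (u ⊗ s ^ᴳ n)
  ℜ-scale u r s n = trans
    (cong (λ z → ℜ (u ⊗ z)) (trans (^ᴳ-distrib-* ⟨ r ⟩ s n) (cong (_⊗ s ^ᴳ n) (⟨ r ⟩^ n))))
    (identity (ℜ u) (ℑ u) (r ^ n) (ℜ (s ^ᴳ n)) (ℑ (s ^ᴳ n)))
    where
      identity : ∀ a b r c d → a * (r * c - 0ℚ * d) - b * (r * d + 0ℚ * c) ≡ r * (a * c - b * d)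
      identity = solve-∀ ℚ-ring

  unit⇒∥-∥≤2 : ∀ {z} → N z ≡ 1ℚ → ∥ z ∥ ≤ 1ℚ + 1ℚ
  unit⇒∥-∥≤2 {z} eq = square-cancel-≤ (0≤1 +₀ 0≤1) (ℚ.≤-trans (∥-∥²≤2N z)
    (subst (λ n → n + n ≤ _) (sym eq) (ℚ.<⇒≤ (from-yes (1ℚ + 1ℚ ℚ.<? (1ℚ + 1ℚ) * (1ℚ + 1ℚ))))))

  unit⇒0<1-ℜ : ∀ {z} → N z ≡ 1ℚ → ¬ ℑ z ≡ 0ℚ → 0ℚ < 1ℚ - ℜ z
  unit⇒0<1-ℜ {x +𝐢 y} Nz≡1 y≢0 with x ℚ.<? 1ℚ
  ... | yes x<1 = Δ< x<1
  ... | no  x≮1 = contradiction yy≤0 (<⇒≱ (0<p² y≢0))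
    where
      1≤x = ℚ.≮⇒≥ x≮1
      yy≤0 : y * y ≤ 0ℚ
      yy≤0 = ≤-by (Δ 1≤x *₀ (0≤1 +₀ ℚ.≤-trans 0≤1 1≤x))
        (trans (identity x y) (trans (cong (λ n → y * y + (x - 1ℚ) * (1ℚ + x) + (1ℚ - n)) Nz≡1)
          (ℚ.+-identityʳ _)))
        where
          identity : ∀ x y → 0ℚ ≡ y * y + (x - 1ℚ) * (1ℚ + x) + (1ℚ - (x * x + y * y))
          identity = solve-∀ ℚ-ring

  -- Classically a (k+1)-st root turns sᵏ⁺¹ into a prescribed direction, but ℚ(i) is not closed
  -- under roots. Powers of `W` supply s and sᵏ⁺¹ together, and squaring brings sᵏ⁺¹ into the left
  -- half-plane without ever making it real.
  left-direction : ∀ k → ∃ λ s → N s ≡ 1ℚ × ℜ (s ^ᴳ suc k) < 0ℚ × ¬ ℑ (s ^ᴳ suc k) ≡ 0ℚ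
  left-direction k = conclude (start (½^→0 (*-pos 0<½ 0<gap)))
    where
      0<gap : 0ℚ < 1ℚ - ℜ (W ^ᴳ (1 ℕ.* suc k))
      0<gap = unit⇒0<1-ℜ {W ^ᴳ (1 ℕ.* suc k)} (N-W^ (1 ℕ.* suc k)) (ℑW^≢0 (k ℕ.+ 0))
      half< : ∀ {p} → 0ℚ < p → ½ * p < p
      half< {p} 0<p = <-by (*-pos 0<½ 0<p) (identity p)
        where
          identity : ∀ p → p ≡ ½ * p + ½ * p
          identity = solve-∀ ℚ-ring
      start : (∃ λ J → ∀ j → J ℕ.≤ j → ½ ^ j ≤ ½ * (1ℚ - ℜ (W ^ᴳ (1 ℕ.* suc k)))) →
        ∃ λ e → ℜ (W ^ᴳ (suc e ℕ.* suc k)) < 0ℚ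
      start (J , ½^≤) = left-half-plane k J 0 (ℚ.≤-<-trans (½^≤ J ℕ.≤-refl) (half< 0<gap))
      conclude : (∃ λ e → ℜ (W ^ᴳ (suc e ℕ.* suc k)) < 0ℚ) →
        ∃ λ s → N s ≡ 1ℚ × ℜ (s ^ᴳ suc k) < 0ℚ × ¬ ℑ (s ^ᴳ suc k) ≡ 0ℚ
      conclude (e , x<0) = W ^ᴳ suc e , N-W^ (suc e)
        , subst (λ z → ℜ z < 0ℚ) (sym (^ᴳ-assocʳ W (suc e) (suc k))) x<0
        , subst (λ z → ¬ ℑ z ≡ 0ℚ) (sym (^ᴳ-assocʳ W (suc e) (suc k))) (ℑW^≢0 (k ℕ.+ e ℕ.* suc k))

  N-unit-^ : ∀ {s} → N s ≡ 1ℚ → ∀ n → N (s ^ᴳ n) ≡ 1ℚ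
  N-unit-^     Ns≡1 zero    = refl
  N-unit-^ {s} Ns≡1 (suc n) = trans (N-⊗ s (s ^ᴳ n)) (cong₂ _*_ Ns≡1 (N-unit-^ Ns≡1 n))

  -- For s = 1, `s₀`, `conj s₀` the product u sᵏ⁺¹ is u, uv or uv̄, where v is the (k+1)-st power of
  -- `s₀`; the sign of ℑ(u)ℑ(v) decides between the last two.
  unit-direction-from : ∀ {k} s₀ → N s₀ ≡ 1ℚ → ℜ (s₀ ^ᴳ suc k) < 0ℚ → ¬ ℑ (s₀ ^ᴳ suc k) ≡ 0ℚ →
    ∃ λ c → 0ℚ < c × ∀ u → ∃ λ s → N s ≡ 1ℚ × ℜ (u ⊗ s ^ᴳ suc k) ≤ - (c * ∥ u ∥)
  unit-direction-from {k} s₀ Ns₀≡1 x<0 y≢0 =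
    ½ * ½ * (- x * ∣ y ∣) , *-pos (*-pos 0<½ 0<½) (*-pos 0<-x 0<∣y∣) , choose
    where
      x = ℜ (s₀ ^ᴳ suc k)
      y = ℑ (s₀ ^ᴳ suc k)
      Nv≡1 : N (s₀ ^ᴳ suc k) ≡ 1ℚ
      Nv≡1 = N-unit-^ {s₀} Ns₀≡1 (suc k)
      0<-x : 0ℚ < - x
      0<-x = subst (0ℚ <_) (ℚ.+-identityˡ (- x)) (Δ< x<0)
      0<∣y∣ : 0ℚ < ∣ y ∣
      0<∣y∣ with ∣ y ∣ ℚ.≤? 0ℚ
      ... | no  ∣y∣≰0 = ℚ.≰⇒> ∣y∣≰0
      ... | yes ∣y∣≤0 = contradiction (ℚ.∣p∣≡0⇒p≡0 y (ℚ.≤-antisym ∣y∣≤0 (ℚ.0≤∣p∣ y))) y≢0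
      -x≤1 : - x ≤ 1ℚ
      -x≤1 = square-cancel-≤ 0≤1
        (subst (_≤ 1ℚ) (sym (-p*-p≡p*p x)) (subst (x * x ≤_) Nv≡1 (ℜ²≤N (s₀ ^ᴳ suc k))))
      ∣y∣≤1 : ∣ y ∣ ≤ 1ℚ
      ∣y∣≤1 = square-cancel-≤ 0≤1
        (subst (_≤ 1ℚ) (sym (∣p∣*∣p∣ y)) (subst (y * y ≤_) Nv≡1 (ℑ²≤N (s₀ ^ᴳ suc k))))
      real-part : ∀ a b x y → - (a * - x) - b * y ≡ a * x - b * y
      real-part = solve-∀ ℚ-ring
      real-part-conj : ∀ a b x y → - (a * - x) - - (b * y) ≡ a * x - b * - y
      real-part-conj = solve-∀ ℚ-ring
      real-part-1 : ∀ a b → a ≡ a * 1ℚ - b * 0ℚ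
      real-part-1 = solve-∀ ℚ-ring
      choose : ∀ u → ∃ λ s → N s ≡ 1ℚ × ℜ (u ⊗ s ^ᴳ suc k) ≤ - (½ * ½ * (- x * ∣ y ∣) * ∥ u ∥)
      choose u = cases
        (positively-spanning {b = ∣ ℑ u ∣} (ℜ u) (ℚ.<⇒≤ 0<-x) -x≤1 (ℚ.<⇒≤ 0<∣y∣) ∣y∣≤1 (ℚ.0≤∣p∣ (ℑ u)))
        (ℚ.∣p∣≡p∨∣p∣≡-p (ℑ u * y))
        where
          bound = - (½ * ½ * (- x * ∣ y ∣) * ∥ u ∥)
          cases : ℜ u ≤ bound ⊎ - (ℜ u * - x) - ∣ ℑ u ∣ * ∣ y ∣ ≤ bound →
            ∣ ℑ u * y ∣ ≡ ℑ u * y ⊎ ∣ ℑ u * y ∣ ≡ - (ℑ u * y) →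
            ∃ λ s → N s ≡ 1ℚ × ℜ (u ⊗ s ^ᴳ suc k) ≤ bound
          cases (inj₁ h) _ = 1ᴳ , refl , subst (_≤ bound)
            (trans (real-part-1 (ℜ u) (ℑ u)) (cong (λ z → ℜ (u ⊗ z)) (sym (1ᴳ^ (suc k))))) h
          cases (inj₂ h) (inj₁ eq) = s₀ , Ns₀≡1 , subst (_≤ bound)
            (trans (cong (λ p → - (ℜ u * - x) - p) (trans (sym (ℚ.∣p*q∣≡∣p∣*∣q∣ (ℑ u) y)) eq))
              (real-part (ℜ u) (ℑ u) x y)) h
          cases (inj₂ h) (inj₂ eq) = conj s₀ , trans (N-conj s₀) Ns₀≡1 , subst (_≤ bound)
            (trans (cong (λ p → - (ℜ u * - x) - p) (trans (sym (ℚ.∣p*q∣≡∣p∣*∣q∣ (ℑ u) y)) eq))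
              (trans (real-part-conj (ℜ u) (ℑ u) x y)
                (cong (λ z → ℜ (u ⊗ z)) (sym (conj-^ s₀ (suc k)))))) h

  unit-direction : ∀ k → ∃ λ c → 0ℚ < c × ∀ u → ∃ λ s →
    N s ≡ 1ℚ × ℜ (u ⊗ s ^ᴳ suc k) ≤ - (c * ∥ u ∥)
  unit-direction k = let s₀ , Ns₀≡1 , x<0 , y≢0 = left-direction k in unit-direction-from {k} s₀ Ns₀≡1 x<0 y≢0

  -- A point of the unit circle has 1-norm at most 2; halving it brings it into the unit ball and
  -- scales the constant by ½ᵏ⁺¹.
  direction : ∀ k → ∃ λ c → 0ℚ < c × ∀ u → ∃ λ s →
    ∥ s ∥ ≤ 1ℚ × ℜ (u ⊗ s ^ᴳ suc k) ≤ - (c * ∥ u ∥)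
  direction k =
    let c , 0<c , h = unit-direction k
    in ½ ^ suc k * c , *-pos (0<^ 0<½ (suc k)) 0<c , λ u →
      let s , Ns≡1 , ≤ = h u
      in ⟨ ½ ⟩ ⊗ s
       , ℚ.≤-trans (∥-∥-⊗ ⟨ ½ ⟩ s) (≤-by (0≤½ *₀ Δ (unit⇒∥-∥≤2 {s} Ns≡1)) (identity₁ ∥ s ∥))
       , subst₂ _≤_ (sym (ℜ-scale u ½ s (suc k))) (identity₂ (½ ^ suc k) c ∥ u ∥)
           (ℚ.*-monoˡ-≤-nonNeg (½ ^ suc k) {{ℚ.nonNegative (ℚ.<⇒≤ (0<^ 0<½ (suc k)))}} ≤)
    where
      identity₁ : ∀ n → 1ℚ ≡ ½ * n + ½ * (1ℚ + 1ℚ - n)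
      identity₁ = solve-∀ ℚ-ring
      identity₂ : ∀ h c n → h * - (c * n) ≡ - (h * c * n)
      identity₂ = solve-∀ ℚ-ring

  -- Decreasing the modulus of a value

  ∥-∥-^ : ∀ {z r} → ∥ z ∥ ≤ r → ∀ n → ∥ z ^ᴳ n ∥ ≤ r ^ n
  ∥-∥-^         ≤r zero    = ℚ.≤-refl
  ∥-∥-^ {z} {r} ≤r (suc n) = ℚ.≤-trans (∥-∥-⊗ z (z ^ᴳ n))
    (*-mono-≤ 0≤∥ z ∥ (ℚ.≤-trans 0≤∥ z ^ᴳ n ∥ (∥-∥-^ ≤r n)) ≤r (∥-∥-^ ≤r n))

  ∥-∥-⊗-≤ : ∀ {z w p q} → ∥ z ∥ ≤ p → ∥ w ∥ ≤ q → ∥ z ⊗ w ∥ ≤ p * q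
  ∥-∥-⊗-≤ {z} {w} z≤p w≤q = ℚ.≤-trans (∥-∥-⊗ z w)
    (*-mono-≤ 0≤∥ z ∥ (ℚ.≤-trans 0≤∥ w ∥ w≤q) z≤p w≤q)

  ∥-∥-⊕-≤ : ∀ {z w p q} → ∥ z ∥ ≤ p → ∥ w ∥ ≤ q → ∥ z ⊕ w ∥ ≤ p + q
  ∥-∥-⊕-≤ {z} {w} z≤p w≤q = ℚ.≤-trans (∥-∥-⊕ z w) (ℚ.+-mono-≤ z≤p w≤q)

  -- For w = rs, with s a direction making ℜ(c̄₀cₖsᵏ⁺¹) negative and r small, the
  -- term c̄₀cₖwᵏ⁺¹ of order rᵏ⁺¹ dominates all others, which are O(rᵏ⁺²).
  decrease : ∀ k {C μ} → 0ℚ ≤ C → 0ℚ < μ → ∃ λ τ → 0ℚ < τ × ∃ λ c → 0ℚ < c ×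
    ∀ c₀ cₖ (L T : ℚ[i] → ℚ[i]) → ∥ c₀ ∥ ≤ C → μ ≤ ∥ c₀ ∥ * ∥ cₖ ∥ →
    (∀ w → ∥ w ∥ ≤ 1ℚ → ∥ L w ∥ ≤ τ) →
    (∀ w → ∥ w ∥ ≤ 1ℚ → ∥ T w ∥ ≤ C) →
    (∀ w → ∥ w ∥ ≤ 1ℚ → ∥ cₖ ⊕ w ⊗ T w ∥ ≤ C) →
    ∃ λ w → ∥ w ∥ ≤ 1ℚ × N (c₀ ⊕ (L w ⊕ w ^ᴳ suc k ⊗ (cₖ ⊕ w ⊗ T w))) ≤ N c₀ - c
  decrease k {C} {μ} 0≤C 0<μ = r * A , *-pos 0<r 0<A , q * A , *-pos 0<q 0<A , step
    where
      dir = direction k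
      e : ℚ
      e = proj₁ dir
      0<e : 0ℚ < e
      0<e = proj₁ (proj₂ dir)
      -- With A = rᵏ⁺¹, the main term changes `N` by at most -2qA, since c̄₀cₖ has norm at least ½μ.
      -- Everything else adds at most D r A: twice C(1 + C) for the cross term and (1 + C)² for `N`
      -- of the increment. The tolerance r A for `L` puts it at the order of the tail.
      q D : ℚ
      q = e * (½ * μ)
      D = C * (1ℚ + C) + C * (1ℚ + C) + (1ℚ + C) * (1ℚ + C)
      0<q : 0ℚ < q
      0<q = *-pos 0<e (*-pos 0<½ 0<μ)
      0≤D : 0ℚ ≤ D
      0≤D = 0≤C *₀ (0≤1 +₀ 0≤C) +₀ 0≤C *₀ (0≤1 +₀ 0≤C) +₀ (0≤1 +₀ 0≤C) *₀ (0≤1 +₀ 0≤C)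
      0<D+q : 0ℚ < D + q
      0<D+q = ℚ.+-mono-≤-< 0≤D 0<q
      -- r = q / (D + q) secures both r ≤ 1 and D r ≤ q, so half of the gain 2qA survives.
      radius = div 0<q 0<D+q
      r : ℚ
      r = proj₁ radius
      0<r : 0ℚ < r
      0<r = proj₁ (proj₂ radius)
      [D+q]r≡q : (D + q) * r ≡ q
      [D+q]r≡q = proj₂ (proj₂ radius)
      0≤r = ℚ.<⇒≤ 0<r
      r≤1 : r ≤ 1ℚ
      r≤1 = ℚ.*-cancelˡ-≤-pos (D + q) {{ℚ.positive 0<D+q}}
        (subst (_≤ (D + q) * 1ℚ) (sym [D+q]r≡q) (≤-by 0≤D (identity D q)))
        where
          identity : ∀ D q → (D + q) * 1ℚ ≡ q + D
          identity = solve-∀ ℚ-ring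
      Dr≤q : D * r ≤ q
      Dr≤q = subst (D * r ≤_) [D+q]r≡q (≤-by (ℚ.<⇒≤ 0<q *₀ 0≤r) (identity D q r))
        where
          identity : ∀ D q r → (D + q) * r ≡ D * r + q * r
          identity = solve-∀ ℚ-ring
      A : ℚ
      A = r ^ suc k
      0<A : 0ℚ < A
      0<A = 0<^ 0<r (suc k)
      0≤A = ℚ.<⇒≤ 0<A
      A≤r : A ≤ r
      A≤r = subst (A ≤_) (ℚ.*-identityʳ r)
        (ℚ.*-monoˡ-≤-nonNeg r {{ℚ.nonNegative 0≤r}} (^≤1 0≤r r≤1 k))
      step : ∀ c₀ cₖ (L T : ℚ[i] → ℚ[i]) → ∥ c₀ ∥ ≤ C → μ ≤ ∥ c₀ ∥ * ∥ cₖ ∥ →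
        (∀ w → ∥ w ∥ ≤ 1ℚ → ∥ L w ∥ ≤ r * A) →
        (∀ w → ∥ w ∥ ≤ 1ℚ → ∥ T w ∥ ≤ C) →
        (∀ w → ∥ w ∥ ≤ 1ℚ → ∥ cₖ ⊕ w ⊗ T w ∥ ≤ C) →
        ∃ λ w → ∥ w ∥ ≤ 1ℚ × N (c₀ ⊕ (L w ⊕ w ^ᴳ suc k ⊗ (cₖ ⊕ w ⊗ T w))) ≤ N c₀ - q * A
      step c₀ cₖ L T c₀≤C μ≤ L≤ T≤ F≤ = w , w≤1 , subst (_≤ N c₀ - q * A) (sym (N-⊕ c₀ y))
        (≤-by (Δ X≤ +₀ Δ X≤ +₀ Δ Ny≤ +₀ 0≤A *₀ ((0≤1 +₀ 0≤C) *₀ (0≤1 +₀ 0≤C)) *₀ Δ A≤r +₀ 0≤A *₀ Δ Dr≤q)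
          (identity (N c₀) (ℜ (conj c₀ ⊗ y)) (N y) q A C r))
        where
          u s w P E y : ℚ[i]
          u = conj c₀ ⊗ cₖ
          s = proj₁ (proj₂ (proj₂ dir) u)
          w = ⟨ r ⟩ ⊗ s
          P = w ^ᴳ suc k
          E = L w ⊕ P ⊗ (w ⊗ T w)
          y = L w ⊕ P ⊗ (cₖ ⊕ w ⊗ T w)
          s≤1 : ∥ s ∥ ≤ 1ℚ
          s≤1 = proj₁ (proj₂ (proj₂ (proj₂ dir) u))
          ℜus≤ : ℜ (u ⊗ s ^ᴳ suc k) ≤ - (e * ∥ u ∥)
          ℜus≤ = proj₂ (proj₂ (proj₂ (proj₂ dir) u))
          w≤r : ∥ w ∥ ≤ r
          w≤r = subst (∥ w ∥ ≤_) (ℚ.*-identityʳ r) (∥-∥-⊗-≤ {⟨ r ⟩} {s} (ℚ.≤-reflexive (∥⟨ 0≤r ⟩∥)) s≤1)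
          w≤1 = ℚ.≤-trans w≤r r≤1
          P≤A : ∥ P ∥ ≤ A
          P≤A = ∥-∥-^ {w} w≤r (suc k)
          E≤ : ∥ E ∥ ≤ r * A + A * (r * C)
          E≤ = ∥-∥-⊕-≤ {L w} (L≤ w w≤1) (∥-∥-⊗-≤ {P} P≤A (∥-∥-⊗-≤ {w} w≤r (T≤ w w≤1)))
          y≤ : ∥ y ∥ ≤ r * A + A * C
          y≤ = ∥-∥-⊕-≤ {L w} (L≤ w w≤1) (∥-∥-⊗-≤ {P} P≤A (F≤ w w≤1))
          y≤′ : ∥ y ∥ ≤ (1ℚ + C) * A
          y≤′ = ℚ.≤-trans y≤ (≤-by (0≤A *₀ Δ r≤1) (identity r A C))
            where
              identity : ∀ r A C → (1ℚ + C) * A ≡ r * A + A * C + A * (1ℚ - r)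
              identity = solve-∀ ℚ-ring
          Ny≤ : N y ≤ (1ℚ + C) * A * ((1ℚ + C) * A)
          Ny≤ = ℚ.≤-trans (N≤∥-∥² y) (*-mono-≤ 0≤∥ y ∥ ((0≤1 +₀ 0≤C) *₀ 0≤A) y≤′ y≤′)
          ½μ≤∥u∥ : ½ * μ ≤ ∥ u ∥
          ½μ≤∥u∥ = ≤-by (0≤½ *₀ (Δ μ≤ +₀ Δ bound)) (identity μ (∥ c₀ ∥ * ∥ cₖ ∥) ∥ u ∥)
            where
              bound : ∥ c₀ ∥ * ∥ cₖ ∥ ≤ ∥ u ∥ + ∥ u ∥
              bound = subst (λ n → n * ∥ cₖ ∥ ≤ ∥ u ∥ + ∥ u ∥) (∥-∥-conj c₀) (∥-∥∥-∥≤2∥-⊗-∥ (conj c₀) cₖ)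
              identity : ∀ m p n → n ≡ ½ * m + ½ * ((p - m) + (n + n - p))
              identity = solve-∀ ℚ-ring
          ℜuP≤ : ℜ (u ⊗ P) ≤ - (A * q)
          ℜuP≤ = subst (_≤ - (A * q)) (sym (ℜ-scale u r s (suc k)))
            (≤-by (0≤A *₀ (Δ ℜus≤ +₀ ℚ.<⇒≤ 0<e *₀ Δ ½μ≤∥u∥)) (identity A e μ (ℜ (u ⊗ s ^ᴳ suc k)) ∥ u ∥))
            where
              identity : ∀ A e μ x n → - (A * (e * (½ * μ))) ≡ A * x + A * ((- (e * n) - x) + e * (n - ½ * μ))
              identity = solve-∀ ℚ-ring
          ℜcE≤ : ℜ (conj c₀ ⊗ E) ≤ C * (r * A + A * (r * C))
          ℜcE≤ = ℚ.≤-trans (ℜ≤∥-∥ (conj c₀ ⊗ E))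
            (∥-∥-⊗-≤ {conj c₀} {E} (subst (_≤ C) (sym (∥-∥-conj c₀)) c₀≤C) E≤)
          split : ℜ (conj c₀ ⊗ y) ≡ ℜ (u ⊗ P) + ℜ (conj c₀ ⊗ E)
          split = cong ℜ (identity (conj c₀) (L w) P cₖ (w ⊗ T w))
            where
              identity : ∀ c l p k t → c ⊗ (l ⊕ p ⊗ (k ⊕ t)) ≡ c ⊗ k ⊗ p ⊕ c ⊗ (l ⊕ p ⊗ t)
              identity = solve-∀ ℚ[i]-ring
          X≤ : ℜ (conj c₀ ⊗ y) ≤ - (A * q) + C * (r * A + A * (r * C))
          X≤ = subst (_≤ - (A * q) + C * (r * A + A * (r * C))) (sym split) (ℚ.+-mono-≤ ℜuP≤ ℜcE≤)
          identity : ∀ n x m q A C r → n - q * A ≡ n + (x + x) + m +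
            ((- (A * q) + C * (r * A + A * (r * C)) - x) + (- (A * q) + C * (r * A + A * (r * C)) - x) +
             ((1ℚ + C) * A * ((1ℚ + C) * A) - m) + A * ((1ℚ + C) * (1ℚ + C)) * (r - A) +
             A * (q - (C * (1ℚ + C) + C * (1ℚ + C) + (1ℚ + C) * (1ℚ + C)) * r))
          identity = solve-∀ ℚ-ring

  ∥-∥-⊖-≤ : ∀ {z w p q} → ∥ z ∥ ≤ p → ∥ w ∥ ≤ q → ∥ z ⊖ w ∥ ≤ p + q
  ∥-∥-⊖-≤ {z} {w} z≤p w≤q = ℚ.≤-trans (∥-∥-⊖ z w) (ℚ.+-mono-≤ z≤p w≤q)

  N-⊕-≤ : ∀ z {w ε} → ∥ w ∥ ≤ ε → N (z ⊕ w) ≤ N z + (∥ z ∥ * ε + ∥ z ∥ * ε) + ε * ε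
  N-⊕-≤ z {w} {ε} w≤ε = subst (_≤ N z + (∥ z ∥ * ε + ∥ z ∥ * ε) + ε * ε) (sym (N-⊕ z w))
    (ℚ.+-mono-≤ (ℚ.+-monoʳ-≤ (N z) (ℚ.+-mono-≤ cross cross))
      (ℚ.≤-trans (N≤∥-∥² w) (*-mono-≤ 0≤∥ w ∥ (ℚ.≤-trans 0≤∥ w ∥ w≤ε) w≤ε w≤ε)))
    where
      cross : ℜ (conj z ⊗ w) ≤ ∥ z ∥ * ε
      cross = ℚ.≤-trans (ℜ≤∥-∥ (conj z ⊗ w))
        (∥-∥-⊗-≤ {conj z} (ℚ.≤-reflexive (∥-∥-conj z)) w≤ε)

  N<⇒∥-∥≤ : ∀ {z ρ} → 0ℚ ≤ ρ → N z ≤ ρ → ∥ z ∥ ≤ 1ℚ + ρ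
  N<⇒∥-∥≤ {z} {ρ} 0≤ρ N≤ρ = square-cancel-≤ (0≤1 +₀ 0≤ρ) (ℚ.≤-trans (∥-∥²≤2N z)
    (≤-by (Δ N≤ρ +₀ Δ N≤ρ +₀ 0≤1 +₀ 0≤p² ρ) (identity (N z) ρ)))
    where
      identity : ∀ n ρ → (1ℚ + ρ) * (1ℚ + ρ) ≡ n + n + ((ρ - n) + (ρ - n) + 1ℚ + ρ * ρ)
      identity = solve-∀ ℚ-ring

  iterate : ∀ {P : ℕ → ℚ[i] → Set} {Q : ℕ → ℚ[i] → ℚ[i] → Set} →
    (∀ j z → P j z → ∃ λ z′ → P (suc j) z′ × Q j z z′) →
    ∀ z₀ → P 0 z₀ → ∃ λ (z : ℕ → ℚ[i]) → z 0 ≡ z₀ × ∀ j → Q j (z j) (z (suc j))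
  iterate {P} {Q} next z₀ p₀ = (λ j → proj₁ (state j)) , refl , λ j → proj₂ (proj₂ (next j _ (proj₂ (state j))))
    where
      state : ∀ j → ∃ (P j)
      state zero    = z₀ , p₀
      state (suc j) = let z′ , p′ , _ = next j _ (proj₂ (state j)) in z′ , p′

  bernoulli : ∀ {σ} → 0ℚ ≤ σ → σ ≤ 1ℚ → ∀ n → 1ℚ - ι n * σ ≤ (1ℚ - σ) ^ n
  bernoulli {σ} 0≤σ σ≤1 zero    = ℚ.≤-reflexive (identity σ)
    where
      identity : ∀ s → 1ℚ - 0ℚ * s ≡ 1ℚ
      identity = solve-∀ ℚ-ring
  bernoulli {σ} 0≤σ σ≤1 (suc n) = subst (λ m → 1ℚ - m * σ ≤ (1ℚ - σ) ^ suc n) (sym (ι-+ 1 n))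
    (≤-by (Δ σ≤1 *₀ Δ (bernoulli 0≤σ σ≤1 n) +₀ 0≤ι n *₀ (0≤σ *₀ 0≤σ)) (identity σ (ι n) ((1ℚ - σ) ^ n)))
    where
      identity : ∀ s m p → (1ℚ - s) * p ≡ 1ℚ - (1ℚ + m) * s + ((1ℚ - s) * (p - (1ℚ - m * s)) + m * (s * s))
      identity = solve-∀ ℚ-ring

  -- Sequences with geometric increments

  Converging : ℚ → (ℕ → ℚ[i]) → Set
  Converging δ z = ∀ j → ∥ z (suc j) ⊖ z j ∥ ≤ δ * ½ ^ j

  Converging⇒close : ∀ {δ z} → 0ℚ ≤ δ → Converging δ z → ∀ j m → j ℕ.≤ m →
    ∥ z m ⊖ z j ∥ ≤ (δ + δ) * ½ ^ j
  Converging⇒close {δ} {z} 0≤δ conv j m j≤m = ℚ.≤-trans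
    (subst (λ m → ∥ z m ⊖ z j ∥ ≤ (δ + δ) * (½ ^ j - ½ ^ m)) (ℕ.m∸n+n≡m j≤m) (partial (m ℕ.∸ j)))
    (≤-by ((0≤δ +₀ 0≤δ) *₀ ℚ.<⇒≤ (0<^ 0<½ m)) (drop (δ + δ) (½ ^ j) (½ ^ m)))
    where
      drop : ∀ d p q → d * p ≡ d * (p - q) + d * q
      drop = solve-∀ ℚ-ring
      -- The induction carries the exact geometric sum; the cruder final bound would not reproduce
      -- itself.
      partial : ∀ k → ∥ z (k ℕ.+ j) ⊖ z j ∥ ≤ (δ + δ) * (½ ^ j - ½ ^ (k ℕ.+ j))
      partial zero = ℚ.≤-reflexive (trans (cong ∥_∥ (cancel (z j))) (vanish δ (½ ^ j)))
        where
          cancel : ∀ w → w ⊖ w ≡ 0ᴳ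
          cancel = solve-∀ ℚ[i]-ring
          vanish : ∀ d p → 0ℚ ≡ (d + d) * (p - p)
          vanish = solve-∀ ℚ-ring
      partial (suc k) = subst₂ _≤_ (cong ∥_∥ (telescope (z (suc k ℕ.+ j)) (z (k ℕ.+ j)) (z j)))
          (sum δ (½ ^ j) (½ ^ (k ℕ.+ j)))
          (∥-∥-⊕-≤ {z (suc k ℕ.+ j) ⊖ z (k ℕ.+ j)} (conv (k ℕ.+ j)) (partial k))
        where
          telescope : ∀ u v w → u ⊖ v ⊕ (v ⊖ w) ≡ u ⊖ w
          telescope = solve-∀ ℚ[i]-ring
          sum : ∀ d p q → d * q + (d + d) * (p - q) ≡ (d + d) * (p - ½ * q)
          sum = solve-∀ ℚ-ring

  -- Polynomials over ℚ(i) with a fixed leading coefficient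

  module Polynomial (a : ℚ[i]) (0<∥a∥ : 0ℚ < ∥ a ∥) where

    -- c₀ ∷ … ∷ cₙ₋₁ ∷ [] stands for c₀ + ⋯ + cₙ₋₁xⁿ⁻¹ + axⁿ: deflation and
    -- translation do not change the leading coefficient.
    ev : ∀ {n} → Vec ℚ[i] n → ℚ[i] → ℚ[i]
    ev []       z = a
    ev (c ∷ cs) z = c ⊕ z ⊗ ev cs z

    size : ∀ {n} → Vec ℚ[i] n → ℚ
    size []       = ∥ a ∥
    size (c ∷ cs) = ∥ c ∥ + size cs

    0≤size : ∀ {n} (cs : Vec ℚ[i] n) → 0ℚ ≤ size cs
    0≤size []       = 0≤∥ a ∥
    0≤size (c ∷ cs) = 0≤∥ c ∥ +₀ 0≤size cs

    head≤size : ∀ {n} c (cs : Vec ℚ[i] n) → ∥ c ∥ ≤ ∥ c ∥ + size cs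
    head≤size c cs = ≤-by (0≤size cs) refl

    tail≤size : ∀ {n} c (cs : Vec ℚ[i] n) → size cs ≤ ∥ c ∥ + size cs
    tail≤size c cs = ≤-by 0≤∥ c ∥ (ℚ.+-comm ∥ c ∥ (size cs))

    ev≤size : ∀ {n} (cs : Vec ℚ[i] n) {w} → ∥ w ∥ ≤ 1ℚ → ∥ ev cs w ∥ ≤ size cs
    ev≤size []       w≤1 = ℚ.≤-refl
    ev≤size (c ∷ cs) {w} w≤1 = subst (λ p → ∥ c ⊕ w ⊗ ev cs w ∥ ≤ ∥ c ∥ + p) (ℚ.*-identityˡ (size cs))
      (∥-∥-⊕-≤ {c} ℚ.≤-refl (∥-∥-⊗-≤ {w} w≤1 (ev≤size cs w≤1)))

    -- L collects the terms of degree 1 to k.  The least degree whose coefficient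
    -- is not negligible is found by recursion on the remaining coefficients.
    uniform-decrease : ∀ n k {C ε} → 0ℚ ≤ C → 0ℚ < ε → ∃ λ τ → 0ℚ < τ × ∃ λ c → 0ℚ < c ×
      ∀ c₀ (L : ℚ[i] → ℚ[i]) (cs : Vec ℚ[i] n) → ε ≤ ∥ c₀ ∥ → ∥ c₀ ∥ ≤ C → size cs ≤ C →
      (∀ w → ∥ w ∥ ≤ 1ℚ → ∥ L w ∥ ≤ τ) →
      ∃ λ w → ∥ w ∥ ≤ 1ℚ × N (c₀ ⊕ (L w ⊕ w ^ᴳ suc k ⊗ ev cs w)) ≤ N c₀ - c
    uniform-decrease zero k {C} {ε} 0≤C 0<ε =
      -- Only the leading coefficient is left; it is bounded away from 0 and takes the role of cₖ
      -- with tail 0.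
      let τ , 0<τ , c , 0<c , h = decrease k 0≤C (*-pos 0<ε 0<∥a∥)
      in τ , 0<τ , c , 0<c , λ where
        c₀ L [] ε≤ c₀≤C a≤C L≤ →
          let w , w≤1 , lower = h c₀ a L (λ _ → 0ᴳ) c₀≤C (*-mono-≤ (ℚ.<⇒≤ 0<ε) 0≤∥ a ∥ ε≤ ℚ.≤-refl) L≤
                              (λ _ _ → 0≤C) (λ w _ → subst (λ z → ∥ z ∥ ≤ C) (absorb a w) a≤C)
          in w , w≤1 , subst (λ z → N (c₀ ⊕ (L w ⊕ w ^ᴳ suc k ⊗ z)) ≤ N c₀ - c) (sym (absorb a w)) lower
      where
        absorb : ∀ b w → b ≡ b ⊕ w ⊗ 0ᴳ
        absorb = solve-∀ ℚ[i]-ring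
    uniform-decrease (suc n) k {C} {ε} 0≤C 0<ε =
      -- A coefficient of norm at most ½τ₁ is moved into `L`: its term and `L`, at most ½τ₁ each,
      -- stay within the tolerance τ₁ of the recursive call. A larger one feeds `decrease` with μ =
      -- ε(½τ₁).
      let τ₁ , 0<τ₁ , c₁ , 0<c₁ , h₁ = uniform-decrease n (suc k) 0≤C 0<ε
          τ₂ , 0<τ₂ , c₂ , 0<c₂ , h₂ = decrease k 0≤C (*-pos 0<ε (*-pos 0<½ 0<τ₁))
          τ , 0<τ , τ≤½τ₁ , τ≤τ₂ = min (*-pos 0<½ 0<τ₁) 0<τ₂
          c , 0<c , c≤c₁ , c≤c₂ = min 0<c₁ 0<c₂
      in τ , 0<τ , c , 0<c , λ where
        c₀ L (cₖ ∷ cs) ε≤ c₀≤C cs≤C L≤ → case c₀ L cₖ cs cs≤C τ₁ τ≤½τ₁ c≤c₁ c≤c₂ L≤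
          (ℚ.≤-total ∥ cₖ ∥ (½ * τ₁))
          (λ L′ L′≤ → h₁ c₀ L′ cs ε≤ c₀≤C (ℚ.≤-trans (tail≤size cₖ cs) cs≤C) L′≤)
          (λ T μ≤ → h₂ c₀ cₖ L T c₀≤C (*-mono-≤ (ℚ.<⇒≤ 0<ε) 0≤∥ cₖ ∥ ε≤ μ≤)
                      (λ w w≤1 → ℚ.≤-trans (L≤ w w≤1) τ≤τ₂))
      where
        case : ∀ c₀ (L : ℚ[i] → ℚ[i]) cₖ (cs : Vec ℚ[i] n) → size (cₖ ∷ cs) ≤ C → ∀ τ₁ {τ c c₁ c₂} →
          τ ≤ ½ * τ₁ → c ≤ c₁ → c ≤ c₂ → (∀ w → ∥ w ∥ ≤ 1ℚ → ∥ L w ∥ ≤ τ) →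
          ∥ cₖ ∥ ≤ ½ * τ₁ ⊎ ½ * τ₁ ≤ ∥ cₖ ∥ →
          (∀ L′ → (∀ w → ∥ w ∥ ≤ 1ℚ → ∥ L′ w ∥ ≤ τ₁) →
            ∃ λ w → ∥ w ∥ ≤ 1ℚ × N (c₀ ⊕ (L′ w ⊕ w ^ᴳ suc (suc k) ⊗ ev cs w)) ≤ N c₀ - c₁) →
          (∀ T → ½ * τ₁ ≤ ∥ cₖ ∥ → (∀ w → ∥ w ∥ ≤ 1ℚ → ∥ T w ∥ ≤ C) →
            (∀ w → ∥ w ∥ ≤ 1ℚ → ∥ cₖ ⊕ w ⊗ T w ∥ ≤ C) →
            ∃ λ w → ∥ w ∥ ≤ 1ℚ × N (c₀ ⊕ (L w ⊕ w ^ᴳ suc k ⊗ (cₖ ⊕ w ⊗ T w))) ≤ N c₀ - c₂) →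
          ∃ λ w → ∥ w ∥ ≤ 1ℚ × N (c₀ ⊕ (L w ⊕ w ^ᴳ suc k ⊗ ev (cₖ ∷ cs) w)) ≤ N c₀ - c
        case c₀ L cₖ cs cs≤C τ₁ τ≤ c≤c₁ c≤c₂ L≤ (inj₁ small) rest _ =
          let w , w≤1 , lower = rest (λ w → L w ⊕ w ^ᴳ suc k ⊗ cₖ) (λ w w≤1 → subst (_ ≤_) (halves τ₁)
                              (∥-∥-⊕-≤ {L w} (ℚ.≤-trans (L≤ w w≤1) τ≤)
                                (∥-∥-⊗-≤ {w ^ᴳ suc k} (ℚ.≤-trans (∥-∥-^ {w} w≤1 (suc k))
                                  (^≤1 0≤1 ℚ.≤-refl (suc k))) small)))
          in w , w≤1 , ℚ.≤-trans
               (subst (λ z → N (c₀ ⊕ z) ≤ _) (regroup (L w) w (w ^ᴳ suc k) cₖ (ev cs w)) lower)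
               (ℚ.+-monoʳ-≤ (N c₀) (ℚ.neg-antimono-≤ c≤c₁))
          where
            halves : ∀ t → ½ * t + 1ℚ * (½ * t) ≡ t
            halves = solve-∀ ℚ-ring
            regroup : ∀ l w p b e → l ⊕ p ⊗ b ⊕ w ⊗ p ⊗ e ≡ l ⊕ p ⊗ (b ⊕ w ⊗ e)
            regroup = solve-∀ ℚ[i]-ring
        case c₀ L cₖ cs cs≤C τ₁ τ≤ c≤c₁ c≤c₂ L≤ (inj₂ large) _ direct =
          let w , w≤1 , lower = direct (ev cs) large
                (λ w w≤1 → ℚ.≤-trans (ev≤size cs w≤1) (ℚ.≤-trans (tail≤size cₖ cs) cs≤C))
                (λ w w≤1 → ℚ.≤-trans (ev≤size (cₖ ∷ cs) {w} w≤1) cs≤C)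
          in w , w≤1 , ℚ.≤-trans lower (ℚ.+-monoʳ-≤ (N c₀) (ℚ.neg-antimono-≤ c≤c₂))

    -- Synthetic division by x - z: the coefficients of the quotient are the intermediate Horner
    -- values.
    quot : ∀ {n} → Vec ℚ[i] (suc n) → ℚ[i] → Vec ℚ[i] n
    quot {zero}  (c ∷ cs) z = []
    quot {suc n} (c ∷ cs) z = ev cs z ∷ quot cs z

    ev-quot : ∀ {n} (h : Vec ℚ[i] (suc n)) z x → ev h x ≡ (x ⊖ z) ⊗ ev (quot h z) x ⊕ ev h z
    ev-quot {zero}  (c ∷ []) z x = identity c x z a
      where
        identity : ∀ c x z a → c ⊕ x ⊗ a ≡ (x ⊖ z) ⊗ a ⊕ (c ⊕ z ⊗ a)
        identity = solve-∀ ℚ[i]-ring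
    ev-quot {suc n} (c ∷ cs) z x = trans (cong (λ v → c ⊕ x ⊗ v) (ev-quot cs z x))
      (identity c x z (ev (quot cs z) x) (ev cs z))
      where
        identity : ∀ c x z q v → c ⊕ x ⊗ ((x ⊖ z) ⊗ q ⊕ v) ≡ (x ⊖ z) ⊗ (v ⊕ x ⊗ q) ⊕ (c ⊕ z ⊗ v)
        identity = solve-∀ ℚ[i]-ring

    -- Repeated synthetic division at one point produces the Taylor coefficients there.
    translate : ∀ {n} → Vec ℚ[i] n → ℚ[i] → Vec ℚ[i] n
    translate {zero}  h z = []
    translate {suc n} h z = ev h z ∷ translate (quot h z) z

    ev-translate : ∀ {n} (h : Vec ℚ[i] n) z w → ev (translate h z) w ≡ ev h (z ⊕ w)
    ev-translate {zero}  [] z w = refl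
    ev-translate {suc n} h  z w = trans (cong (λ v → ev h z ⊕ w ⊗ v) (ev-translate (quot h z) z w))
      (trans (identity (ev h z) z w (ev (quot h z) (z ⊕ w))) (sym (ev-quot h z (z ⊕ w))))
      where
        identity : ∀ v z w q → v ⊕ w ⊗ q ≡ (z ⊕ w ⊖ z) ⊗ q ⊕ v
        identity = solve-∀ ℚ[i]-ring

    -- The bound sees `h` only through its size: `translate` passes on to `quot h z`, which varies
    -- with the point, and one bound has to cover all these quotients.
    Bounded : ∀ {n} → (Vec ℚ[i] n → ℚ[i] → ℚ) → Set
    Bounded {n} f = ∀ C R → 0ℚ ≤ C → 0ℚ ≤ R → ∃ λ B → 0ℚ ≤ B ×
      ∀ (h : Vec ℚ[i] n) z → size h ≤ C → ∥ z ∥ ≤ R → f h z ≤ B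

    ev-bounded : ∀ {n} → Bounded {n} (λ h z → ∥ ev h z ∥)
    ev-bounded {zero}  C R 0≤C 0≤R = C , 0≤C , λ { [] z h≤C z≤R → h≤C }
    ev-bounded {suc n} C R 0≤C 0≤R =
      let B , 0≤B , h = ev-bounded {n} C R 0≤C 0≤R
      in C + R * B , 0≤C +₀ 0≤R *₀ 0≤B , λ where
        (c ∷ cs) z cs≤C z≤R → ∥-∥-⊕-≤ {c} (ℚ.≤-trans (head≤size c cs) cs≤C)
          (∥-∥-⊗-≤ {z} z≤R (h cs z (ℚ.≤-trans (tail≤size c cs) cs≤C) z≤R))

    quot-bounded : ∀ {n} → Bounded {suc n} (λ h z → size (quot h z))
    quot-bounded {zero}  C R 0≤C 0≤R = ∥ a ∥ , 0≤∥ a ∥ , λ { (c ∷ []) z _ _ → ℚ.≤-refl }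
    quot-bounded {suc n} C R 0≤C 0≤R =
      let B , 0≤B , h = ev-bounded {suc n} C R 0≤C 0≤R
          Q , 0≤Q , k = quot-bounded {n} C R 0≤C 0≤R
      in B + Q , 0≤B +₀ 0≤Q , λ where
        (c ∷ cs) z cs≤C z≤R → let ≤C = ℚ.≤-trans (tail≤size c cs) cs≤C in
          ℚ.+-mono-≤ (h cs z ≤C z≤R) (k cs z ≤C z≤R)

    translate-bounded : ∀ {n} → Bounded {n} (λ h z → size (translate h z))
    translate-bounded {zero}  C R 0≤C 0≤R = ∥ a ∥ , 0≤∥ a ∥ , λ _ _ _ _ → ℚ.≤-refl
    translate-bounded {suc n} C R 0≤C 0≤R =
      let B , 0≤B , h = ev-bounded {suc n} C R 0≤C 0≤R
          Q , 0≤Q , k = quot-bounded {n} C R 0≤C 0≤R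
          T , 0≤T , l = translate-bounded {n} Q R 0≤Q 0≤R
      in B + T , 0≤B +₀ 0≤T , λ g z g≤C z≤R →
        ℚ.+-mono-≤ (h g z g≤C z≤R) (l (quot g z) z (k g z g≤C z≤R) z≤R)

    -- Growth at infinity and points of small value

    outgrow : ∀ c v z {β} → β ≤ ∥ v ∥ → ½ * (∥ z ∥ * β) - ∥ c ∥ ≤ ∥ c ⊕ z ⊗ v ∥
    outgrow c v z {β} β≤ = ≤-by
      (0≤½ *₀ (0≤∥ z ∥ *₀ Δ β≤ +₀ Δ (∥-∥∥-∥≤2∥-⊗-∥ z v)) +₀ Δ zv≤)
      (identity (∥ z ∥) β (∥ c ∥) (∥ v ∥) (∥ z ⊗ v ∥) (∥ c ⊕ z ⊗ v ∥))
      where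
        cancel : ∀ c t → t ≡ c ⊕ t ⊖ c
        cancel = solve-∀ ℚ[i]-ring
        zv≤ : ∥ z ⊗ v ∥ ≤ ∥ c ⊕ z ⊗ v ∥ + ∥ c ∥
        zv≤ = subst (λ t → ∥ t ∥ ≤ ∥ c ⊕ z ⊗ v ∥ + ∥ c ∥) (sym (cancel c (z ⊗ v)))
          (∥-∥-⊖ (c ⊕ z ⊗ v) c)
        identity : ∀ z b c v m s → s ≡ ½ * (z * b) - c + (½ * (z * (v - b) + (m + m - z * v)) + (s + c - m))
        identity = solve-∀ ℚ-ring

    -- Mutual induction on the degree: growth only asks that the tail stay away from 0 far out, and
    -- the tail is either the constant `a` or itself growing.
    growth : ∀ {n} (h : Vec ℚ[i] (suc n)) B → 0ℚ ≤ B →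
      ∃ λ R → 0ℚ ≤ R × ∀ z → R ≤ ∥ z ∥ → B ≤ ∥ ev h z ∥
    bounded-below : ∀ {n} (h : Vec ℚ[i] n) → ∃ λ β → 0ℚ < β ×
      ∃ λ R → 0ℚ ≤ R × ∀ z → R ≤ ∥ z ∥ → β ≤ ∥ ev h z ∥

    growth (c ∷ cs) B 0≤B =
      let β , 0<β , R , 0≤R , h = bounded-below cs
          -- X makes βX = 2(B + ∥c∥) + 1, so that ½βX - ∥c∥ = B + ½.
          X , 0<X , βX≡ = div (ℚ.+-mono-≤-< (0≤B +₀ 0≤∥ c ∥ +₀ (0≤B +₀ 0≤∥ c ∥)) 0<1) 0<β
      in R + X , 0≤R +₀ ℚ.<⇒≤ 0<X , λ z R+X≤ →
        let R≤ = ℚ.≤-trans (≤-by (ℚ.<⇒≤ 0<X) refl) R+X≤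
            X≤ = ℚ.≤-trans (≤-by 0≤R (ℚ.+-comm R X)) R+X≤
        in ℚ.≤-trans (≤-by (0≤½ *₀ (ℚ.<⇒≤ 0<β *₀ Δ X≤) +₀ 0≤½)
             (trans (identity β X (∥ z ∥) (∥ c ∥)) (trans (cong (λ t → ½ * t - ∥ c ∥ + ½ * (β * (∥ z ∥ - X))) βX≡)
               (identity′ B ∥ c ∥ (½ * (β * (∥ z ∥ - X)))))))
             (outgrow c (ev cs z) z (h z R≤))
      where
        identity : ∀ β X z c → ½ * (z * β) - c ≡ ½ * (β * X) - c + ½ * (β * (z - X))
        identity = solve-∀ ℚ-ring
        identity′ : ∀ B c t → ½ * (B + c + (B + c) + 1ℚ) - c + t ≡ B + (t + ½)
        identity′ = solve-∀ ℚ-ring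
    bounded-below []       = ∥ a ∥ , 0<∥a∥ , 0ℚ , ℚ.≤-refl , λ _ _ → ℚ.≤-refl
    bounded-below (c ∷ cs) = 1ℚ , 0<1 , growth (c ∷ cs) 1ℚ 0≤1

    -- Descent from 0. While `N` of the value does not exceed its initial value B, growth keeps the
    -- point in a fixed ball. All translates at such points have bounded coefficients, so every step
    -- gains the same c, and the descent must stop at a small value within about B / c steps.
    near-zero : ∀ {n} (h : Vec ℚ[i] (suc n)) {ε} → 0ℚ < ε → ∃ λ z → ∥ ev h z ∥ ≤ ε
    near-zero {n} h {ε} 0<ε =
      let R , 0≤R , grows = growth h (1ℚ + B) (0≤1 +₀ 0≤B)
          C , 0≤C , translates = translate-bounded {suc n} (size h) R (0≤size h) 0≤R
          τ , 0<τ , c , 0<c , decreases = uniform-decrease n 0 0≤C 0<ε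
          J , B≤Jc = archimedean B 0<c
      in loop 0<c (λ z Nz≤B ε≤ → let ≤C = translates h z ℚ.≤-refl (confined R grows z Nz≤B) in
           step c z (decreases (ev h z) (λ _ → 0ᴳ) (translate (quot h z) z) ε≤
             (ℚ.≤-trans (head≤size (ev h z) (translate (quot h z) z)) ≤C)
             (ℚ.≤-trans (tail≤size (ev h z) (translate (quot h z) z)) ≤C)
             (λ _ _ → ℚ.<⇒≤ 0<τ)))
           J 0ᴳ ℚ.≤-refl B≤Jc
      where
        B = N (ev h 0ᴳ)
        0≤B = 0≤N (ev h 0ᴳ)
        -- Outside the ball the value has norm at least 1 + B, whereas N ≤ B allows a squared norm
        -- of at most 2B < (1 + B)².
        confined : ∀ R → (∀ z → R ≤ ∥ z ∥ → 1ℚ + B ≤ ∥ ev h z ∥) → ∀ z → N (ev h z) ≤ B → ∥ z ∥ ≤ R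
        confined R grows z N≤B with ∥ z ∥ ℚ.≤? R
        ... | yes z≤R = z≤R
        ... | no  z≰R = contradiction (ℚ.≤-trans (*-mono-≤ (0≤1 +₀ 0≤B) 0≤∥ ev h z ∥ large large)
            (ℚ.≤-trans (∥-∥²≤2N (ev h z)) (ℚ.+-mono-≤ N≤B N≤B)))
            (<⇒≱ (<-by (ℚ.+-mono-<-≤ 0<1 (0≤p² B)) (identity B)))
          where
            large = grows z (ℚ.<⇒≤ (ℚ.≰⇒> z≰R))
            identity : ∀ B → (1ℚ + B) * (1ℚ + B) ≡ B + B + (1ℚ + B * B)
            identity = solve-∀ ℚ-ring
        step : ∀ c z → (∃ λ w → ∥ w ∥ ≤ 1ℚ ×
            N (ev h z ⊕ (0ᴳ ⊕ w ^ᴳ 1 ⊗ ev (translate (quot h z) z) w)) ≤ N (ev h z) - c) →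
          ∃ λ z′ → N (ev h z′) ≤ N (ev h z) - c
        step c z (w , _ , lower) = z ⊕ w , subst (λ v → N v ≤ N (ev h z) - c)
          (trans (identity (ev h z) w (ev (translate (quot h z) z) w)) (ev-translate h z w)) lower
          where
            identity : ∀ v w t → v ⊕ (0ᴳ ⊕ w ⊗ 1ᴳ ⊗ t) ≡ v ⊕ w ⊗ t
            identity = solve-∀ ℚ[i]-ring
        loop : ∀ {c} → 0ℚ < c → (∀ z → N (ev h z) ≤ B → ε ≤ ∥ ev h z ∥ → ∃ λ z′ → N (ev h z′) ≤ N (ev h z) - c) →
          ∀ J z → N (ev h z) ≤ B → N (ev h z) ≤ ι J * c → ∃ λ z → ∥ ev h z ∥ ≤ ε
        loop {c} 0<c descend J z N≤B N≤Jc with ℚ.≤-total ∥ ev h z ∥ ε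
        ... | inj₁ ≤ε = z , ≤ε
        loop {c} 0<c descend zero z N≤B N≤Jc | inj₂ ε≤ =
          let z′ , lower = descend z N≤B ε≤
          in contradiction (ℚ.≤-trans (0≤N (ev h z′)) lower)
               (<⇒≱ (<-by (ℚ.+-mono-≤-< (Δ N≤Jc) 0<c) (identity (N (ev h z)) c)))
          where
            identity : ∀ n c → 0ℚ ≡ n - c + (0ℚ * c - n + c)
            identity = solve-∀ ℚ-ring
        loop {c} 0<c descend (suc J) z N≤B N≤Jc | inj₂ ε≤ =
          let z′ , lower = descend z N≤B ε≤
          in loop 0<c descend J z′
               (ℚ.≤-trans lower (≤-by (Δ N≤B +₀ ℚ.<⇒≤ 0<c) (identity (N (ev h z)) c B)))
               (ℚ.≤-trans lower (≤-by (Δ N≤Jc) (trans (identity′ (N (ev h z)) c (ι J))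
                 (cong (λ j → N (ev h z) - c + (j * c - N (ev h z))) (sym (ι-+ 1 J))))))
          where
            identity : ∀ n c B → B ≡ n - c + (B - n + c)
            identity = solve-∀ ℚ-ring
            identity′ : ∀ n c j → j * c ≡ n - c + ((1ℚ + j) * c - n)
            identity′ = solve-∀ ℚ-ring

    -- Improving an approximate zero nearby

    -- Induction on the degree. Take z₁ with h(z₁) small. If z₁ is far from z, then h(z₁) - h(z) =
    -- (z₁ - z) q(z) with q = `quot h z₁` makes z an approximate zero of q. The point z′ found for q
    -- also serves h, as h(z′) = (z′ - z₁) q(z′) + h(z₁).
    approach : ∀ n {δ} → 0ℚ < δ → ∃ λ η → 0ℚ < η × ∀ (h : Vec ℚ[i] n) z → ∥ ev h z ∥ ≤ η →
      ∀ {ε} → 0ℚ < ε → ∃ λ z′ → ∥ ev h z′ ∥ ≤ ε × ∥ z′ ⊖ z ∥ ≤ δ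
    approach zero    0<δ = ½ * ∥ a ∥ , *-pos 0<½ 0<∥a∥ , λ where
        [] z ≤η 0<ε → contradiction ≤η (<⇒≱ (<-by (*-pos 0<½ 0<∥a∥) (identity ∥ a ∥)))
      where
        identity : ∀ p → p ≡ ½ * p + ½ * p
        identity = solve-∀ ℚ-ring
    approach (suc n) {δ} 0<δ =
      let η′ , 0<η′ , follow = approach n 0<δ
          -- η = ¼δη′: the two values differ by at most 2η, and dividing by z₁ - z, of norm at least
          -- δ, costs another factor 2.
          η = ½ * (½ * (δ * η′))
          0<η = *-pos 0<½ (*-pos 0<½ (*-pos 0<δ 0<η′))
      in η , 0<η , λ h z ≤η {ε} 0<ε →
        let ε₀ , 0<ε₀ , ε₀≤½ε , ε₀≤η = min (*-pos 0<½ 0<ε) 0<η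
            z₁ , z₁≤ε₀ = near-zero h 0<ε₀
            s = ∥ z ∥ + δ + ∥ z₁ ∥
            ε′ , 0<ε′ , sε′≡½ε = div (*-pos 0<½ 0<ε)
              (ℚ.+-mono-<-≤ (ℚ.+-mono-≤-< 0≤∥ z ∥ 0<δ) 0≤∥ z₁ ∥)
        in cases h z z₁ (ℚ.<⇒≤ 0<ε) (ℚ.≤-trans z₁≤ε₀ ε₀≤½ε) (ℚ.≤-trans z₁≤ε₀ ε₀≤η) sε′≡½ε ≤η
             (ℚ.≤-total ∥ z₁ ⊖ z ∥ δ) (λ ≤η′ → follow (quot h z₁) z ≤η′ 0<ε′)
      where
        cases : ∀ (h : Vec ℚ[i] (suc n)) z z₁ {ε ε′ η′} → 0ℚ ≤ ε → ∥ ev h z₁ ∥ ≤ ½ * ε → ∥ ev h z₁ ∥ ≤ ½ * (½ * (δ * η′)) →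
          (∥ z ∥ + δ + ∥ z₁ ∥) * ε′ ≡ ½ * ε → ∥ ev h z ∥ ≤ ½ * (½ * (δ * η′)) →
          ∥ z₁ ⊖ z ∥ ≤ δ ⊎ δ ≤ ∥ z₁ ⊖ z ∥ →
          (∥ ev (quot h z₁) z ∥ ≤ η′ → ∃ λ z′ → ∥ ev (quot h z₁) z′ ∥ ≤ ε′ × ∥ z′ ⊖ z ∥ ≤ δ) →
          ∃ λ z′ → ∥ ev h z′ ∥ ≤ ε × ∥ z′ ⊖ z ∥ ≤ δ
        cases h z z₁ {ε} 0≤ε h₁≤½ε _ _ _ (inj₁ close) _ = z₁ , ℚ.≤-trans h₁≤½ε (≤-by (0≤½ *₀ 0≤ε) (identity ε)) , close
          where
            identity : ∀ e → e ≡ ½ * e + ½ * e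
            identity = solve-∀ ℚ-ring
        cases h z z₁ {ε} {ε′} {η′} 0≤ε h₁≤½ε h₁≤η sε′≡ h≤η (inj₂ far) follow =
          let z′ , q≤ε′ , z′-z≤δ = follow q≤η′
          in z′ , subst (λ v → ∥ v ∥ ≤ ε) (sym (ev-quot h z₁ z′))
               (subst (∥ (z′ ⊖ z₁) ⊗ ev q z′ ⊕ ev h z₁ ∥ ≤_) (trans (cong (_+ ½ * ε) sε′≡) (halves ε))
                 (∥-∥-⊕-≤ {(z′ ⊖ z₁) ⊗ ev q z′} (∥-∥-⊗-≤ {z′ ⊖ z₁} (z′-z₁≤ z′ z′-z≤δ) q≤ε′) h₁≤½ε))
             , z′-z≤δ
          where
            q = quot h z₁
            halves : ∀ e → ½ * e + ½ * e ≡ e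
            halves = solve-∀ ℚ-ring
            z′-z₁≤ : ∀ z′ → ∥ z′ ⊖ z ∥ ≤ δ → ∥ z′ ⊖ z₁ ∥ ≤ ∥ z ∥ + δ + ∥ z₁ ∥
            z′-z₁≤ z′ ≤δ = subst (λ t → ∥ t ∥ ≤ ∥ z ∥ + δ + ∥ z₁ ∥) (identity z z′ z₁)
              (∥-∥-⊖-≤ {z ⊕ (z′ ⊖ z)} (∥-∥-⊕-≤ {z} ℚ.≤-refl ≤δ) ℚ.≤-refl)
              where
                identity : ∀ z z′ z₁ → z ⊕ (z′ ⊖ z) ⊖ z₁ ≡ z′ ⊖ z₁
                identity = solve-∀ ℚ[i]-ring
            product : (z₁ ⊖ z) ⊗ ev q z ≡ ev h z₁ ⊖ ev h z
            product = trans (identity z z₁ (ev q z) (ev h z₁)) (cong (ev h z₁ ⊖_) (sym (ev-quot h z₁ z)))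
              where
                identity : ∀ z z₁ q v → (z₁ ⊖ z) ⊗ q ≡ v ⊖ ((z ⊖ z₁) ⊗ q ⊕ v)
                identity = solve-∀ ℚ[i]-ring
            q≤η′ : ∥ ev q z ∥ ≤ η′
            q≤η′ = ℚ.*-cancelˡ-≤-pos δ {{ℚ.positive 0<δ}} (begin
              δ * ∥ ev q z ∥
                ≤⟨ ℚ.*-monoʳ-≤-nonNeg ∥ ev q z ∥ {{ℚ.nonNegative 0≤∥ ev q z ∥}} far ⟩
              ∥ z₁ ⊖ z ∥ * ∥ ev q z ∥
                ≤⟨ ∥-∥∥-∥≤2∥-⊗-∥ (z₁ ⊖ z) (ev q z) ⟩
              ∥ (z₁ ⊖ z) ⊗ ev q z ∥ + ∥ (z₁ ⊖ z) ⊗ ev q z ∥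
                ≡⟨ cong (λ v → ∥ v ∥ + ∥ v ∥) product ⟩
              ∥ ev h z₁ ⊖ ev h z ∥ + ∥ ev h z₁ ⊖ ev h z ∥
                ≤⟨ ℚ.+-mono-≤ diff≤ diff≤ ⟩
              ½ * (½ * (δ * η′)) + ½ * (½ * (δ * η′)) + (½ * (½ * (δ * η′)) + ½ * (½ * (δ * η′)))
                ≡⟨ quarters (δ * η′) ⟩
              δ * η′ ∎)
              where
                open ℚ.≤-Reasoning
                diff≤ = ∥-∥-⊖-≤ {ev h z₁} {ev h z} h₁≤η h≤η
                quarters : ∀ p → ½ * (½ * p) + ½ * (½ * p) + (½ * (½ * p) + ½ * (½ * p)) ≡ p
                quarters = solve-∀ ℚ-ring

    -- Lower bounds for the constant term

    -- Zeros need not lie in ℚ(i), so the condition is imposed wherever the value is within some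
    -- tolerance of 0.
    ZerosOutside : ∀ {n} → ℚ → Vec ℚ[i] n → Set
    ZerosOutside ρ h = ∃ λ η → 0ℚ < η × ∀ z → ∥ ev h z ∥ ≤ η → ρ ≤ N z

    -- A point with `N z` < ρ has norm at most 1 + ρ, so there h(z) = (z - z₁) q(z) + h(z₁) turns a
    -- small value of the quotient into a value of `h` within tolerance.
    quot-ZerosOutside : ∀ {n ρ} (h : Vec ℚ[i] (suc n)) → 0ℚ ≤ ρ → (outside : ZerosOutside ρ h) →
      ∀ z₁ → ∥ ev h z₁ ∥ ≤ ½ * proj₁ outside → ZerosOutside ρ (quot h z₁)
    quot-ZerosOutside {ρ = ρ} h 0≤ρ (η , 0<η , outside) z₁ z₁≤ =
      let η′ , 0<η′ , eq = div (*-pos 0<½ 0<η) (ℚ.+-mono-<-≤ (ℚ.+-mono-<-≤ 0<1 0≤ρ) 0≤∥ z₁ ∥)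
      in η′ , 0<η′ , λ z q≤ → decide z eq q≤ (ρ ℚ.≤? N z)
      where
        halves : ∀ e → ½ * e + ½ * e ≡ e
        halves = solve-∀ ℚ-ring
        decide : ∀ z {η′} → (1ℚ + ρ + ∥ z₁ ∥) * η′ ≡ ½ * η → ∥ ev (quot h z₁) z ∥ ≤ η′ → Dec (ρ ≤ N z) → ρ ≤ N z
        decide z eq q≤ (yes ρ≤) = ρ≤
        decide z {η′} eq q≤ (no ρ≰) = outside z (subst (λ v → ∥ v ∥ ≤ η) (sym (ev-quot h z₁ z))
          (subst (∥ (z ⊖ z₁) ⊗ ev (quot h z₁) z ⊕ ev h z₁ ∥ ≤_) (trans (cong (_+ ½ * η) eq) (halves η))
            (∥-∥-⊕-≤ {(z ⊖ z₁) ⊗ ev (quot h z₁) z} (∥-∥-⊗-≤ {z ⊖ z₁}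
              (∥-∥-⊖-≤ {z} (N<⇒∥-∥≤ {z} 0≤ρ (ℚ.<⇒≤ (ℚ.≰⇒> ρ≰))) ℚ.≤-refl) q≤) z₁≤)))

    -- Deflation at an approximate zero z gives h(0) ≈ -z q(0), with an error that tends to 0 with
    -- h(z). `E` is kept apart from `ρ` so that the first zero can contribute a better bound than
    -- the others.
    first-zero-bound : ∀ {n ρ E M} (h : Vec ℚ[i] (suc n)) → 0ℚ ≤ ρ → 0ℚ ≤ E → 0ℚ ≤ M → ZerosOutside ρ h →
      (∀ (g : Vec ℚ[i] n) → ZerosOutside ρ g → M ≤ N (ev g 0ᴳ)) →
      (∀ {ε} → 0ℚ < ε → ∃ λ z → ∥ ev h z ∥ ≤ ε × E ≤ N z) →
      E * M ≤ N (ev h 0ᴳ)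
    first-zero-bound {n} {ρ} {E} {M} h 0≤ρ 0≤E 0≤M outside bound zeros = decide (E * M ℚ.≤? N v)
      where
        v = ev h 0ᴳ
        decide : Dec (E * M ≤ N v) → E * M ≤ N v
        decide (yes ≤N) = ≤N
        decide (no  ≰N) =
          let 0<gap = Δ< (ℚ.≰⇒> ≰N)
              -- Adding h(z) to -h(0) raises `N` by at most 2∥v∥ε + ε². For ε ≤ 1 and ε ≤ δ this is
              -- at most (2∥v∥ + 1)δ, half of the supposed gap.
              δ , 0<δ , eq = div {c = ∥ v ∥ + ∥ v ∥ + 1ℚ} (*-pos 0<½ 0<gap)
                               (ℚ.+-mono-≤-< (0≤∥ v ∥ +₀ 0≤∥ v ∥) 0<1)
              ε₁ , 0<ε₁ , ε₁≤½η , ε₁≤δ = min (*-pos 0<½ (proj₁ (proj₂ outside))) 0<δ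
              ε , 0<ε , ε≤ε₁ , ε≤1 = min 0<ε₁ 0<1
              z , z≤ε , E≤ = zeros 0<ε
          in contradiction
               (ℚ.≤-trans (*-mono-≤ 0≤E (0≤N (ev (quot h z) 0ᴳ)) E≤
                   (bound (quot h z) (quot-ZerosOutside h 0≤ρ outside z (ℚ.≤-trans z≤ε (ℚ.≤-trans ε≤ε₁ ε₁≤½η)))))
                 (upper z (ℚ.<⇒≤ 0<ε) z≤ε ε≤1 (ℚ.≤-trans ε≤ε₁ ε₁≤δ) eq))
               (<⇒≱ (<-by (*-pos 0<½ 0<gap) (identity₂ (N v) (E * M))))
          where
            identity₂ : ∀ n m → m ≡ n + ½ * (m - n) + ½ * (m - n)
            identity₂ = solve-∀ ℚ-ring
            upper : ∀ z {ε δ} → 0ℚ ≤ ε → ∥ ev h z ∥ ≤ ε → ε ≤ 1ℚ → ε ≤ δ → (∥ v ∥ + ∥ v ∥ + 1ℚ) * δ ≡ ½ * (E * M - N v) →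
              N z * N (ev (quot h z) 0ᴳ) ≤ N v + ½ * (E * M - N v)
            upper z {ε} {δ} 0≤ε z≤ε ε≤1 ε≤δ eq = begin
              N z * N (ev (quot h z) 0ᴳ)
                ≡⟨ N-⊗ z (ev (quot h z) 0ᴳ) ⟨
              N (z ⊗ ev (quot h z) 0ᴳ)
                ≡⟨ cong N (trans (identity z (ev (quot h z) 0ᴳ) (ev h z))
                     (cong (λ t → ⊝ t ⊕ ev h z) (sym (ev-quot h z 0ᴳ)))) ⟩
              N (⊝ v ⊕ ev h z)
                ≤⟨ N-⊕-≤ (⊝ v) {ev h z} z≤ε ⟩
              N (⊝ v) + (∥ ⊝ v ∥ * ε + ∥ ⊝ v ∥ * ε) + ε * ε
                ≡⟨ cong₂ (λ n m → n + (m * ε + m * ε) + ε * ε) (N-⊝ v) (∥-∥-⊝ v) ⟩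
              N v + (∥ v ∥ * ε + ∥ v ∥ * ε) + ε * ε
                ≤⟨ ≤-by (0≤ε *₀ Δ ε≤1 +₀ (0≤∥ v ∥ +₀ 0≤∥ v ∥ +₀ 0≤1) *₀ Δ ε≤δ) (estimate (N v) (∥ v ∥) ε δ) ⟩
              N v + (∥ v ∥ + ∥ v ∥ + 1ℚ) * δ
                ≡⟨ cong (λ t → N v + t) eq ⟩
              N v + ½ * (E * M - N v) ∎
              where
                open ℚ.≤-Reasoning
                identity : ∀ z q h → z ⊗ q ≡ ⊝ ((0ᴳ ⊖ z) ⊗ q ⊕ h) ⊕ h
                identity = solve-∀ ℚ[i]-ring
                N-⊝ : ∀ z → N (⊝ z) ≡ N z
                N-⊝ z = cong₂ _+_ (-p*-p≡p*p (ℜ z)) (-p*-p≡p*p (ℑ z))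
                estimate : ∀ n v e d → n + (v + v + 1ℚ) * d ≡ n + (v * e + v * e) + e * e + (e * (1ℚ - e) + (v + v + 1ℚ) * (d - e))
                estimate = solve-∀ ℚ-ring

    -- The inequality form of |h(0)|² = |a|² ∏ |θ|², one zero being split off for each degree.
    zeros-bound : ∀ {n ρ} (h : Vec ℚ[i] n) → 0ℚ ≤ ρ → ZerosOutside ρ h → ρ ^ n * N a ≤ N (ev h 0ᴳ)
    zeros-bound []         0≤ρ outside = ℚ.≤-reflexive (ℚ.*-identityˡ (N a))
    zeros-bound {suc n} {ρ} h@(_ ∷ _) 0≤ρ outside@(η , 0<η , out) =
      subst (_≤ N (ev h 0ᴳ)) (sym (ℚ.*-assoc ρ (ρ ^ n) (N a)))
        (first-zero-bound h 0≤ρ 0≤ρ (0≤^ 0≤ρ n *₀ 0≤N a) outside (λ g → zeros-bound g 0≤ρ) zeros)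
      where
        zeros : ∀ {ε} → 0ℚ < ε → ∃ λ z → ∥ ev h z ∥ ≤ ε × ρ ≤ N z
        zeros 0<ε = let ε′ , 0<ε′ , ε′≤ε , ε′≤η = min 0<ε 0<η
                        z , z≤ε′ = near-zero h 0<ε′
                    in z , ℚ.≤-trans z≤ε′ ε′≤ε , out z (ℚ.≤-trans z≤ε′ ε′≤η)

    -- Genuine zeros as limits

    -- The index is shifted because `z 0` is the given starting point, whose value is only known to
    -- be within a tolerance.
    ApproachesZero : ∀ {n} → Vec ℚ[i] n → (ℕ → ℚ[i]) → Set
    ApproachesZero h z = ∀ j → ∥ ev h (z (suc j)) ∥ ≤ ½ ^ j

    opaque
      -- `approach` is iterated with radius δ ½ʲ at stage j; each new point is chosen so good that
      -- it already meets the tolerance of stage j + 1.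
      zero-near : ∀ n {δ} → 0ℚ < δ → ∃ λ η → 0ℚ < η × ∀ (h : Vec ℚ[i] n) z₀ → ∥ ev h z₀ ∥ ≤ η →
        ∃ λ z → z 0 ≡ z₀ × Converging δ z × ApproachesZero h z
      zero-near n {δ} 0<δ = η 0 , 0<η 0 , λ h z₀ ≤η →
        let z , z0≡ , steps = iterate (next h) z₀ ≤η
        in z , z0≡ , (λ j → proj₁ (steps j)) , (λ j → proj₂ (steps j))
        where
          approach-at : ∀ j → ∃ λ η → 0ℚ < η × ∀ (h : Vec ℚ[i] n) z → ∥ ev h z ∥ ≤ η →
            ∀ {ε} → 0ℚ < ε → ∃ λ z′ → ∥ ev h z′ ∥ ≤ ε × ∥ z′ ⊖ z ∥ ≤ δ * ½ ^ j
          approach-at j = approach n (*-pos 0<δ (0<^ 0<½ j))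
          η : ℕ → ℚ
          η j = proj₁ (approach-at j)
          0<η : ∀ j → 0ℚ < η j
          0<η j = proj₁ (proj₂ (approach-at j))
          next : ∀ (h : Vec ℚ[i] n) j z → ∥ ev h z ∥ ≤ η j →
            ∃ λ z′ → ∥ ev h z′ ∥ ≤ η (suc j) × (∥ z′ ⊖ z ∥ ≤ δ * ½ ^ j × ∥ ev h z′ ∥ ≤ ½ ^ j)
          next h j z ≤η =
            let ε , 0<ε , ε≤η , ε≤½^ = min (0<η (suc j)) (0<^ 0<½ j)
                z′ , ≤ε , close = proj₂ (proj₂ (approach-at j)) h z ≤η 0<ε
            in z′ , ℚ.≤-trans ≤ε ε≤η , close , ℚ.≤-trans ≤ε ε≤½^

    -- With the bound ρ = 1 - σ for all zeros but the first, and E > D for the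
    -- first, the product is at least E(1 - nσ), which exceeds D for small σ.
    no-zeros-outside : ∀ {n D} (h : Vec ℚ[i] (suc n)) → 1ℚ ≤ D → 1ℚ ≤ N a → N (ev h 0ᴳ) ≤ D →
      (∀ {δ z} → 0ℚ < δ → Converging δ z → ApproachesZero h z →
        ∃ λ E → D < E × ∃ λ M → ∀ j → M ℕ.≤ j → E ≤ N (z j)) → ⊥
    no-zeros-outside {n} {D} h 1≤D 1≤Na h0≤D large =
      let η , 0<η , zeros = zero-near (suc n) 0<1
          z₀ , z₀≤η = near-zero h 0<η
          z , _ , conv , vanish = zeros h z₀ z₀≤η
          E , D<E , M , E≤ = large {1ℚ} {z} 0<1 conv vanish
      in conclude z E M D<E vanish E≤
      where
        outside : ∀ {σ} → 0ℚ < σ → σ ≤ 1ℚ → ZerosOutside (1ℚ - σ) h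
        outside {σ} 0<σ σ≤1 =
          -- If `N z₀` < 1 - σ, then z₀ has norm at most 2, and a move of norm at most 2δ raises `N`
          -- by at most 8δ + 4δ² ≤ 12δ = σ. It cannot reach a point where `N` is at least 1.
          let δ , 0<δ , 12δ≡σ = div {c = ι 12} 0<σ (ℚ.positive⁻¹ (ι 12))
              η , 0<η , zeros = zero-near (suc n) 0<δ
          in η , 0<η , λ z₀ z₀≤η →
            let z , z0≡ , conv , vanish = zeros h z₀ z₀≤η
                E , D<E , M , E≤ = large {δ} {z} 0<δ conv vanish
            in estimate z₀ (z M) δ (ℚ.<⇒≤ 0<δ) 12δ≡σ
                 (subst₂ (λ w d → ∥ z M ⊖ w ∥ ≤ d) z0≡ (ℚ.*-identityʳ (δ + δ))
                   (Converging⇒close {δ} {z} (ℚ.<⇒≤ 0<δ) conv 0 M ℕ.z≤n))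
                 (ℚ.≤-trans 1≤D (ℚ.≤-trans (ℚ.<⇒≤ D<E) (E≤ M ℕ.≤-refl)))
                 ((1ℚ - σ) ℚ.≤? N z₀)
          where
            estimate : ∀ z₀ w δ → 0ℚ ≤ δ → ι 12 * δ ≡ σ → ∥ w ⊖ z₀ ∥ ≤ δ + δ → 1ℚ ≤ N w →
              Dec (1ℚ - σ ≤ N z₀) → 1ℚ - σ ≤ N z₀
            estimate z₀ w δ 0≤δ 12δ≡σ close 1≤Nw (yes ≤N) = ≤N
            estimate z₀ w δ 0≤δ 12δ≡σ close 1≤Nw (no  ≰N) = contradiction (ℚ.≤-trans 1≤Nw Nw≤) (<⇒≱ bound<1)
              where
                ρ>N = ℚ.≰⇒> ≰N
                Nz₀≤1 : N z₀ ≤ 1ℚ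
                Nz₀≤1 = ℚ.≤-trans (ℚ.<⇒≤ ρ>N) (≤-by (ℚ.<⇒≤ 0<σ) (identity σ))
                  where
                    identity : ∀ s → 1ℚ ≡ 1ℚ - s + s
                    identity = solve-∀ ℚ-ring
                z₀≤2 : ∥ z₀ ∥ ≤ 1ℚ + 1ℚ
                z₀≤2 = N<⇒∥-∥≤ {z₀} 0≤1 Nz₀≤1
                δ≤1 : δ ≤ 1ℚ
                δ≤1 = ℚ.≤-trans (subst (δ ≤_) 12δ≡σ (≤-by (ℚ.nonNegative⁻¹ (ι 11) *₀ 0≤δ) (identity δ))) σ≤1
                  where
                    identity : ∀ d → ι 12 * d ≡ d + ι 11 * d
                    identity = solve-∀ ℚ-ring
                bound = N z₀ + (∥ z₀ ∥ * (δ + δ) + ∥ z₀ ∥ * (δ + δ)) + (δ + δ) * (δ + δ)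
                Nw≤ : N w ≤ bound
                Nw≤ = subst (λ t → N t ≤ bound) (recombine z₀ w) (N-⊕-≤ z₀ {w ⊖ z₀} close)
                  where
                    recombine : ∀ z w → z ⊕ (w ⊖ z) ≡ w
                    recombine = solve-∀ ℚ[i]-ring
                bound<1 : bound < 1ℚ
                bound<1 = <-by (ℚ.+-mono-<-≤ (Δ< ρ>N) ((Δ z₀≤2 +₀ Δ z₀≤2) *₀ (0≤δ +₀ 0≤δ) +₀ (0≤ι 4 *₀ 0≤δ) *₀ Δ δ≤1))
                  (trans (identity (N z₀) (∥ z₀ ∥) δ) (cong (λ s → bound + ((1ℚ - s - N z₀) +
                    ((1ℚ + 1ℚ - ∥ z₀ ∥ + (1ℚ + 1ℚ - ∥ z₀ ∥)) * (δ + δ) + ι 4 * δ * (1ℚ - δ)))) 12δ≡σ))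
                  where
                    identity : ∀ n m d → 1ℚ ≡ n + (m * (d + d) + m * (d + d)) + (d + d) * (d + d) +
                      ((1ℚ - ι 12 * d - n) + ((1ℚ + 1ℚ - m + (1ℚ + 1ℚ - m)) * (d + d) + ι 4 * d * (1ℚ - d)))
                    identity = solve-∀ ℚ-ring
        conclude : ∀ z E M → D < E → ApproachesZero h z → (∀ j → M ℕ.≤ j → E ≤ N (z j)) → ⊥
        conclude z E M D<E vanish E≤ =
          -- σ = (E - D) / ((n + 1)E) gives E(1 - nσ) = D + Eσ > D.
          let σ , 0<σ , eq = div (Δ< D<E) (ℚ.+-mono-≤-< (0≤ι n *₀ 0≤E) 0<E)
          in contradiction h0≤D (<⇒≱ (ℚ.<-≤-trans (D<product σ 0<σ eq)
               (first-zero-bound h (Δ (σ≤1 σ 0<σ eq)) 0≤E (0≤^ (Δ (σ≤1 σ 0<σ eq)) n *₀ 0≤N a)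
                 (outside 0<σ (σ≤1 σ 0<σ eq)) (λ g → zeros-bound g (Δ (σ≤1 σ 0<σ eq))) zeros)))
          where
            0<E : 0ℚ < E
            0<E = ℚ.<-≤-trans 0<1 (ℚ.≤-trans 1≤D (ℚ.<⇒≤ D<E))
            0≤E : 0ℚ ≤ E
            0≤E = ℚ.<⇒≤ 0<E
            σ≤1 : ∀ σ → 0ℚ < σ → (ι n * E + E) * σ ≡ E - D → σ ≤ 1ℚ
            σ≤1 σ 0<σ eq = ℚ.*-cancelˡ-≤-pos E {{ℚ.positive 0<E}} (≤-by
              (ℚ.≤-trans 0≤1 1≤D +₀ 0≤ι n *₀ 0≤E *₀ ℚ.<⇒≤ 0<σ)
              (trans (identity E D) (trans (cong (λ t → D + t) (sym eq)) (identity′ E D (ι n) σ))))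
              where
                identity : ∀ E D → E * 1ℚ ≡ D + (E - D)
                identity = solve-∀ ℚ-ring
                identity′ : ∀ E D m s → D + (m * E + E) * s ≡ E * s + (D + m * E * s)
                identity′ = solve-∀ ℚ-ring
            D<product : ∀ σ → 0ℚ < σ → (ι n * E + E) * σ ≡ E - D → D < E * ((1ℚ - σ) ^ n * N a)
            D<product σ 0<σ eq = ℚ.<-≤-trans
              (<-by (*-pos 0<E 0<σ) (trans (identity E (ι n) σ) (trans (cong (λ t → E - t + E * σ) eq) (identity′ E D (E * σ)))))
              (ℚ.*-monoˡ-≤-nonNeg E {{ℚ.nonNegative 0≤E}} (ℚ.≤-trans (bernoulli (ℚ.<⇒≤ 0<σ) ≤1 n)
                (≤-by (0≤^ (Δ ≤1) n *₀ Δ 1≤Na) (identity″ ((1ℚ - σ) ^ n) (N a)))))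
              where
                ≤1 = σ≤1 σ 0<σ eq
                identity : ∀ E m s → E * (1ℚ - m * s) ≡ E - (m * E + E) * s + E * s
                identity = solve-∀ ℚ-ring
                identity′ : ∀ E D t → E - (E - D) + t ≡ D + t
                identity′ = solve-∀ ℚ-ring
                identity″ : ∀ p n → p * n ≡ p + p * (n - 1ℚ)
                identity″ = solve-∀ ℚ-ring
            zeros : ∀ {ε} → 0ℚ < ε → ∃ λ w → ∥ ev h w ∥ ≤ ε × E ≤ N w
            zeros 0<ε = let J , ½^≤ = ½^→0 0<ε in
              z (suc (J ℕ.⊔ M)) , ℚ.≤-trans (vanish (J ℕ.⊔ M)) (½^≤ (J ℕ.⊔ M) (ℕ.m≤m⊔n J M))
              , E≤ (suc (J ℕ.⊔ M)) (ℕ.m≤n⇒m≤1+n (ℕ.m≤n⊔m J M))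

  -- Integer polynomials at points of ℚ(i)

  evℤ : ℤ[x] → ℚ[i] → ℚ[i]
  evℤ []      z = 0ᴳ
  evℤ (a ∷ f) z = ⟨ κ a ⟩ ⊕ z ⊗ evℤ f z

  evℤ-+ : ∀ f g z → evℤ (f +ₚ g) z ≡ evℤ f z ⊕ evℤ g z
  evℤ-+ []      g       z = identity (evℤ g z)
    where
      identity : ∀ w → w ≡ 0ᴳ ⊕ w
      identity = solve-∀ ℚ[i]-ring
  evℤ-+ (a ∷ f) []      z = identity (⟨ κ a ⟩ ⊕ z ⊗ evℤ f z)
    where
      identity : ∀ w → w ≡ w ⊕ 0ᴳ
      identity = solve-∀ ℚ[i]-ring
  evℤ-+ (a ∷ f) (b ∷ g) z = trans
    (cong₂ (λ p v → ⟨ p ⟩ ⊕ z ⊗ v) (κ-+ a b) (evℤ-+ f g z))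
    (identity ⟨ κ a ⟩ ⟨ κ b ⟩ z (evℤ f z) (evℤ g z))
    where
      identity : ∀ p q z u v → p ⊕ q ⊕ z ⊗ (u ⊕ v) ≡ p ⊕ z ⊗ u ⊕ (q ⊕ z ⊗ v)
      identity = solve-∀ ℚ[i]-ring

  evℤ-scale : ∀ a f z → evℤ (map (a ℤ.*_) f) z ≡ ⟨ κ a ⟩ ⊗ evℤ f z
  evℤ-scale a []      z = identity ⟨ κ a ⟩
    where
      identity : ∀ p → 0ᴳ ≡ p ⊗ 0ᴳ
      identity = solve-∀ ℚ[i]-ring
  evℤ-scale a (b ∷ f) z = trans
    (cong₂ (λ p v → p ⊕ z ⊗ v) (trans (cong ⟨_⟩ (κ-* a b)) (⟨⟩-* (κ a) (κ b))) (evℤ-scale a f z))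
    (identity ⟨ κ a ⟩ ⟨ κ b ⟩ z (evℤ f z))
    where
      identity : ∀ p q z v → p ⊗ q ⊕ z ⊗ (p ⊗ v) ≡ p ⊗ (q ⊕ z ⊗ v)
      identity = solve-∀ ℚ[i]-ring

  evℤ-* : ∀ f g z → evℤ (f *ₚ g) z ≡ evℤ f z ⊗ evℤ g z
  evℤ-* []      g z = identity (evℤ g z)
    where
      identity : ∀ w → 0ᴳ ≡ 0ᴳ ⊗ w
      identity = solve-∀ ℚ[i]-ring
  evℤ-* (a ∷ f) g z = trans (evℤ-+ (map (a ℤ.*_) g) (0ℤ ∷ (f *ₚ g)) z)
    (trans (cong₂ (λ u v → u ⊕ (0ᴳ ⊕ z ⊗ v)) (evℤ-scale a g z) (evℤ-* f g z))
      (identity ⟨ κ a ⟩ z (evℤ f z) (evℤ g z)))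
    where
      identity : ∀ p z u v → p ⊗ v ⊕ (0ᴳ ⊕ z ⊗ (u ⊗ v)) ≡ (p ⊕ z ⊗ u) ⊗ v
      identity = solve-∀ ℚ[i]-ring

  evℤ-zero : ∀ f → (∀ i → coeff f i ≡ 0ℤ) → ∀ z → evℤ f z ≡ 0ᴳ
  evℤ-zero []      f≈0 z = refl
  evℤ-zero (a ∷ f) f≈0 z = trans
    (cong₂ (λ b v → ⟨ κ b ⟩ ⊕ z ⊗ v) (f≈0 0) (evℤ-zero f (λ i → f≈0 (suc i)) z)) (identity z)
    where
      identity : ∀ z → 0ᴳ ⊕ z ⊗ 0ᴳ ≡ 0ᴳ
      identity = solve-∀ ℚ[i]-ring

  evℤ-cong : ∀ f g → f ≈ₚ g → ∀ z → evℤ f z ≡ evℤ g z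
  evℤ-cong []      g       f≈g z = sym (evℤ-zero g (λ i → sym (f≈g i)) z)
  evℤ-cong (a ∷ f) []      f≈g z = evℤ-zero (a ∷ f) f≈g z
  evℤ-cong (a ∷ f) (b ∷ g) f≈g z =
    cong₂ (λ c v → ⟨ κ c ⟩ ⊕ z ⊗ v) (f≈g 0) (evℤ-cong f g (λ i → f≈g (suc i)) z)

  evℤ-0 : ∀ f → evℤ f 0ᴳ ≡ ⟨ κ (coeff f 0) ⟩
  evℤ-0 []      = refl
  evℤ-0 (a ∷ f) = identity ⟨ κ a ⟩ (evℤ f 0ᴳ)
    where
      identity : ∀ p v → p ⊕ 0ᴳ ⊗ v ≡ p
      identity = solve-∀ ℚ[i]-ring

  evℤ-bounded : ∀ f {R} → 0ℚ ≤ R → ∃ λ B → 0ℚ ≤ B × ∀ z → ∥ z ∥ ≤ R → ∥ evℤ f z ∥ ≤ B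
  evℤ-bounded []      0≤R = 0ℚ , ℚ.≤-refl , λ _ _ → ℚ.≤-refl
  evℤ-bounded (a ∷ f) {R} 0≤R =
    let B , 0≤B , bound = evℤ-bounded f 0≤R
    in ∥ ⟨ κ a ⟩ ∥ + R * B , 0≤∥ ⟨ κ a ⟩ ∥ +₀ 0≤R *₀ 0≤B , λ z z≤R →
      ∥-∥-⊕-≤ {⟨ κ a ⟩} ℚ.≤-refl (∥-∥-⊗-≤ {z} z≤R (bound z z≤R))

  N⟨κ⟩ : ∀ a → N ⟨ κ a ⟩ ≡ ι (ℤ.∣ a ∣ ℕ.* ℤ.∣ a ∣)
  N⟨κ⟩ a = trans (identity (κ a)) (trans (sym (κ-* a a)) (cong κ (square a)))
    where
      identity : ∀ p → p * p + 0ℚ * 0ℚ ≡ p * p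
      identity = solve-∀ ℚ-ring
      square : ∀ a → a ℤ.* a ≡ + (ℤ.∣ a ∣ ℕ.* ℤ.∣ a ∣)
      square (+ n)     = sym (ℤ.pos-* n n)
      square -[1+ n ]  = refl

  1≤N⟨κ⟩ : ∀ {a} → ¬ a ≡ 0ℤ → 1ℚ ≤ N ⟨ κ a ⟩
  1≤N⟨κ⟩ {a} a≢0 = subst (1ℚ ≤_) (sym (N⟨κ⟩ a)) (ι-mono-≤ {1} (ℕ.*-mono-≤ 1≤∣a∣ 1≤∣a∣))
    where
      1≤∣a∣ : 1 ℕ.≤ ℤ.∣ a ∣
      1≤∣a∣ = ℕ.n≢0⇒n>0 (λ eq → a≢0 (ℤ.∣i∣≡0⇒i≡0 eq))

  0<∥⟨κ⟩∥ : ∀ {a} → ¬ a ≡ 0ℤ → 0ℚ < ∥ ⟨ κ a ⟩ ∥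
  0<∥⟨κ⟩∥ {a} a≢0 = ℚ.<-≤-trans 0<1 (square-cancel-≤ 0≤∥ ⟨ κ a ⟩ ∥
    (ℚ.≤-trans (1≤N⟨κ⟩ a≢0) (N≤∥-∥² ⟨ κ a ⟩)))

  -- Lists may end in zeros, so the leading coefficient is not simply the last entry and has to be
  -- located by testing.
  LeadingTerm : ℤ[x] → Set
  LeadingTerm f = ∃ λ b → ∃ λ (b≢0 : ¬ b ≡ 0ℤ) → ∃₂ λ n (cs : Vec ℚ[i] n) →
    ∀ z → evℤ f z ≡ Polynomial.ev ⟨ κ b ⟩ (0<∥⟨κ⟩∥ b≢0) cs z

  leading-term : ∀ f → (∀ i → coeff f i ≡ 0ℤ) ⊎ LeadingTerm f
  leading-term []      = inj₁ λ _ → refl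
  leading-term (a ∷ f) = extend (leading-term f) (a ℤ.≟ 0ℤ)
    where
      identity : ∀ p z → p ⊕ z ⊗ 0ᴳ ≡ p
      identity = solve-∀ ℚ[i]-ring
      extend : (∀ i → coeff f i ≡ 0ℤ) ⊎ LeadingTerm f → Dec (a ≡ 0ℤ) →
        (∀ i → coeff (a ∷ f) i ≡ 0ℤ) ⊎ LeadingTerm (a ∷ f)
      extend (inj₂ (b , b≢0 , n , cs , eq)) _ =
        inj₂ (b , b≢0 , suc n , ⟨ κ a ⟩ ∷ cs , λ z → cong (λ v → ⟨ κ a ⟩ ⊕ z ⊗ v) (eq z))
      extend (inj₁ f≈0) (yes a≡0) = inj₁ λ { zero → a≡0 ; (suc i) → f≈0 i }
      extend (inj₁ f≈0) (no  a≢0) = inj₂ (a , a≢0 , 0 , [] , λ z →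
        trans (cong (λ v → ⟨ κ a ⟩ ⊕ z ⊗ v) (evℤ-zero f f≈0 z)) (identity ⟨ κ a ⟩ z))

  -- Limits in ℂ and the hypothesis on zeros

  ∣ℜ∣≤∥-∥ : ∀ z → ∣ ℜ z ∣ ≤ ∥ z ∥
  ∣ℜ∣≤∥-∥ z = ≤-by (ℚ.0≤∣p∣ (ℑ z)) refl

  ∣ℑ∣≤∥-∥ : ∀ z → ∣ ℑ z ∣ ≤ ∥ z ∥
  ∣ℑ∣≤∥-∥ z = ≤-by (ℚ.0≤∣p∣ (ℜ z)) (ℚ.+-comm ∣ ℜ z ∣ ∣ ℑ z ∣)

  Converging⇒Cauchy : ∀ {δ z} → 0ℚ < δ → Converging δ z → ∀ ε → 0ℚ < ε →
    ∃ λ M → ∀ m n → M ℕ.≤ m → M ℕ.≤ n → ∥ z m ⊖ z n ∥ < ε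
  Converging⇒Cauchy {δ} {z} 0<δ conv ε 0<ε =
    let 0<4δ = ℚ.+-mono-< (ℚ.+-mono-< 0<δ 0<δ) (ℚ.+-mono-< 0<δ 0<δ)
        ε′ , 0<ε′ , eq = div (*-pos 0<½ 0<ε) 0<4δ
        M , ½^≤ = ½^→0 0<ε′
    in M , λ m n M≤m M≤n → subst (λ w → ∥ w ∥ < ε) (telescope (z m) (z M) (z n))
      (ℚ.≤-<-trans (∥-∥-⊖-≤ {z m ⊖ z M}
         (Converging⇒close {δ} {z} (ℚ.<⇒≤ 0<δ) conv M m M≤m)
         (Converging⇒close {δ} {z} (ℚ.<⇒≤ 0<δ) conv M n M≤n))
       (<-by (ℚ.+-mono-<-≤ (*-pos 0<½ 0<ε) (ℚ.<⇒≤ 0<4δ *₀ Δ (½^≤ M ℕ.≤-refl)))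
         (trans (halves ε) (trans (cong (λ t → ½ * ε + t) (sym eq)) (identity δ ε (½ ^ M) ε′)))))
    where
      telescope : ∀ u v w → u ⊖ v ⊖ (w ⊖ v) ≡ u ⊖ w
      telescope = solve-∀ ℚ[i]-ring
      halves : ∀ e → e ≡ ½ * e + ½ * e
      halves = solve-∀ ℚ-ring
      identity : ∀ d e h e′ → ½ * e + (d + d + (d + d)) * e′ ≡
        (d + d) * h + (d + d) * h + (½ * e + (d + d + (d + d)) * (e′ - h))
      identity = solve-∀ ℚ-ring

  limit : ∀ {δ z} → 0ℚ < δ → Converging δ z → ℂ
  limit {δ} {z} 0<δ conv = mkℝ (λ n → ℜ (z n)) real +i mkℝ (λ n → ℑ (z n)) imag
    where
      real : IsCauchy (λ n → ℜ (z n))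
      real ε 0<ε = let M , h = Converging⇒Cauchy {δ} {z} 0<δ conv ε 0<ε in
        M , λ m n ≤m ≤n → ℚ.≤-<-trans (∣ℜ∣≤∥-∥ (z m ⊖ z n)) (h m n ≤m ≤n)
      imag : IsCauchy (λ n → ℑ (z n))
      imag ε 0<ε = let M , h = Converging⇒Cauchy {δ} {z} 0<δ conv ε 0<ε in
        M , λ m n ≤m ≤n → ℚ.≤-<-trans (∣ℑ∣≤∥-∥ (z m ⊖ z n)) (h m n ≤m ≤n)

  approximant : ℂ → ℕ → ℚ[i]
  approximant θ n = seq (re θ) n +𝐢 seq (im θ) n

  -- The operations of ℝ and ℂ act on Cauchy sequences index by index, so this is an exact equality
  -- at each index, without an error term.
  eval-approximant : ∀ f θ n → approximant (eval f θ) n ≡ evℤ f (approximant θ n)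
  eval-approximant []      θ n = refl
  eval-approximant (a ∷ f) θ n = cong (λ v → ⟨ κ a ⟩ ⊕ approximant θ n ⊗ v) (eval-approximant f θ n)

  IsZero-limit : ∀ f θ → (∀ ε → 0ℚ < ε → ∃ λ M → ∀ n → M ℕ.≤ n → ∥ evℤ f (approximant θ n) ∥ < ε) → IsZero f θ
  IsZero-limit f θ small = part ℜ ∣ℜ∣≤∥-∥ , part ℑ ∣ℑ∣≤∥-∥
    where
      part : (P : ℚ[i] → ℚ) → (∀ z → ∣ P z ∣ ≤ ∥ z ∥) → ∀ ε → 0ℚ < ε →
        ∃ λ M → ∀ n → M ℕ.≤ n → ∣ P (approximant (eval f θ) n) - 0ℚ ∣ < ε
      part P P≤ ε 0<ε = let M , h = small ε 0<ε in M , λ n M≤n →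
        subst (λ p → ∣ p ∣ < ε) (sym (trans (ℚ.+-identityʳ _) (cong P (eval-approximant f θ n))))
          (ℚ.≤-<-trans (P≤ (evℤ f (approximant θ n))) (h n M≤n))

  -- The approximants of the square root are lower ones, so squaring d + ε ≤ √ at a given index
  -- bounds `N` at that very index.
  <ʳ∣-∣⇒<N : ∀ d θ → fromℕ d <ʳ ∣ θ ∣ᶜ →
    ∃ λ E → ι (d ℕ.* d) < E × ∃ λ M → ∀ n → M ℕ.≤ n → E ≤ N (approximant θ n)
  <ʳ∣-∣⇒<N d θ (ε , 0<ε , M , h) = (ι d + ε) * (ι d + ε)
    , subst (_< (ι d + ε) * (ι d + ε)) (sym (ι-* d d))
        (<-by (ℚ.+-mono-<-≤ (*-pos 0<ε 0<ε) (0≤ι d *₀ ℚ.<⇒≤ 0<ε +₀ 0≤ι d *₀ ℚ.<⇒≤ 0<ε)) (identity (ι d) ε))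
    , M , λ n M≤n → ℚ.≤-trans
        (*-mono-≤ 0≤d+ε (ℚ.≤-trans 0≤d+ε (h n M≤n)) (h n M≤n) (h n M≤n))
        (ℚ.≤-trans (√-approx-lower (N (approximant θ n)) n)
          (ℚ.≤-reflexive (ℚ.0≤p⇒∣p∣≡p (0≤N (approximant θ n)))))
    where
      0≤d+ε : 0ℚ ≤ ι d + ε
      0≤d+ε = 0≤ι d +₀ ℚ.<⇒≤ 0<ε
      identity : ∀ d e → (d + e) * (d + e) ≡ d * d + (e * e + (d * e + d * e))
      identity = solve-∀ ℚ-ring

  -- A nonconstant g would meet the hypotheses of `no-zeros-outside` with D = d²: along a sequence
  -- converging to a zero of g the cofactor h stays bounded, so the limit is a zero of f and has
  -- modulus above d.
  small-constant-term : ∀ f g h d → d ℕ.> 0 → (∀ θ → IsZero f θ → fromℕ d <ʳ ∣ θ ∣ᶜ) →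
    (∀ z → evℤ f z ≡ evℤ g z ⊗ evℤ h z) → ℤ.∣ coeff g 0 ∣ ℕ.≤ d → ∀ i → coeff g (suc i) ≡ 0ℤ
  small-constant-term f []      h d d>0 outside f≡gh g₀≤d i = refl
  small-constant-term f (a ∷ g) h d d>0 outside f≡gh g₀≤d = decide (leading-term g)
    where
      decide : (∀ i → coeff g i ≡ 0ℤ) ⊎ LeadingTerm g → ∀ i → coeff g i ≡ 0ℤ
      decide (inj₁ g≈0) = g≈0
      decide (inj₂ (b , b≢0 , n , cs , eq)) = ⊥-elim (no-zeros-outside v 1≤D (1≤N⟨κ⟩ b≢0) v0≤D
        (λ {δ} {z} → large {δ} {z}))
        where
          open Polynomial ⟨ κ b ⟩ (0<∥⟨κ⟩∥ b≢0)
          v : Vec ℚ[i] (suc n)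
          v = ⟨ κ a ⟩ ∷ cs
          g≡v : ∀ z → evℤ (a ∷ g) z ≡ ev v z
          g≡v z = cong (λ w → ⟨ κ a ⟩ ⊕ z ⊗ w) (eq z)
          1≤D : 1ℚ ≤ ι (d ℕ.* d)
          1≤D = ι-mono-≤ {1} (ℕ.*-mono-≤ d>0 d>0)
          v0≤D : N (ev v 0ᴳ) ≤ ι (d ℕ.* d)
          v0≤D = subst (_≤ ι (d ℕ.* d)) (sym (trans (cong N (trans (sym (g≡v 0ᴳ)) (evℤ-0 (a ∷ g)))) (N⟨κ⟩ a)))
            (ι-mono-≤ (ℕ.*-mono-≤ g₀≤d g₀≤d))
          large : ∀ {δ z} → 0ℚ < δ → Converging δ z → ApproachesZero v z →
            ∃ λ E → ι (d ℕ.* d) < E × ∃ λ M → ∀ j → M ℕ.≤ j → E ≤ N (z j)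
          large {δ} {z} 0<δ conv vanish = <ʳ∣-∣⇒<N d θ (outside θ (IsZero-limit f θ (small (evℤ-bounded h 0≤R))))
            where
              θ : ℂ
              θ = limit {δ} {z} 0<δ conv
              R : ℚ
              R = ∥ z 0 ∥ + (δ + δ)
              0≤R : 0ℚ ≤ R
              0≤R = 0≤∥ z 0 ∥ +₀ (ℚ.<⇒≤ 0<δ +₀ ℚ.<⇒≤ 0<δ)
              z≤R : ∀ j → ∥ z j ∥ ≤ R
              z≤R j = subst (λ w → ∥ w ∥ ≤ R) (cancel (z 0) (z j)) (∥-∥-⊕-≤ {z 0} ℚ.≤-refl
                (subst (∥ z j ⊖ z 0 ∥ ≤_) (ℚ.*-identityʳ (δ + δ))
                  (Converging⇒close {δ} {z} (ℚ.<⇒≤ 0<δ) conv 0 j ℕ.z≤n)))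
                where
                  cancel : ∀ u w → u ⊕ (w ⊖ u) ≡ w
                  cancel = solve-∀ ℚ[i]-ring
              small : (∃ λ B → 0ℚ ≤ B × ∀ z → ∥ z ∥ ≤ R → ∥ evℤ h z ∥ ≤ B) →
                ∀ ε → 0ℚ < ε → ∃ λ M → ∀ n → M ℕ.≤ n → ∥ evℤ f (z n) ∥ < ε
              small (B , 0≤B , bound) ε 0<ε =
                let ε′ , 0<ε′ , eq′ = div 0<ε (ℚ.+-mono-≤-< 0≤B 0<1)
                    J , ½^≤ = ½^→0 0<ε′
                -- `suc J` absorbs the shift in `ApproachesZero`; ε′ = ε / (B + 1) keeps the
                -- inequality strict even for B = 0.
                in suc J , λ where
                  (suc n) (ℕ.s≤s J≤n) → subst (λ w → ∥ w ∥ < ε) (sym (f≡gh (z (suc n))))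
                    (ℚ.≤-<-trans
                      (∥-∥-⊗-≤ {evℤ (a ∷ g) (z (suc n))} (subst (λ w → ∥ w ∥ ≤ ε′) (sym (g≡v (z (suc n))))
                         (ℚ.≤-trans (vanish n) (½^≤ n J≤n))) (bound (z (suc n)) (z≤R (suc n))))
                      (<-by 0<ε′ (trans (sym eq′) (identity B ε′))))
                where
                  identity : ∀ B e → (B + 1ℚ) * e ≡ e * B + e
                  identity = solve-∀ ℚ-ring

-- Coefficients of products in ℤ[x]

open Zeros using (_⊗_; ⊗-comm; evℤ; evℤ-cong; evℤ-*; small-constant-term)

coeff-+ : ∀ f g i → coeff (f +ₚ g) i ≡ coeff f i ℤ.+ coeff g i
coeff-+ []      g       i       = sym (ℤ.+-identityˡ (coeff g i))
coeff-+ (a ∷ f) []      i       = sym (ℤ.+-identityʳ (coeff (a ∷ f) i))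
coeff-+ (a ∷ f) (b ∷ g) zero    = refl
coeff-+ (a ∷ f) (b ∷ g) (suc i) = coeff-+ f g i

coeff-scale : ∀ a f i → coeff (map (a ℤ.*_) f) i ≡ a ℤ.* coeff f i
coeff-scale a []      i       = sym (ℤ.*-zeroʳ a)
coeff-scale a (b ∷ f) zero    = refl
coeff-scale a (b ∷ f) (suc i) = coeff-scale a f i

coeff-∷* : ∀ a f g i → coeff ((a ∷ f) *ₚ g) i ≡ a ℤ.* coeff g i ℤ.+ coeff (0ℤ ∷ (f *ₚ g)) i
coeff-∷* a f g i = trans (coeff-+ (map (a ℤ.*_) g) (0ℤ ∷ (f *ₚ g)) i)
  (cong (ℤ._+ coeff (0ℤ ∷ (f *ₚ g)) i) (coeff-scale a g i))

coeff-*-0 : ∀ f g → coeff (f *ₚ g) 0 ≡ coeff f 0 ℤ.* coeff g 0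
coeff-*-0 []      g = refl
coeff-*-0 (a ∷ f) g = trans (coeff-∷* a f g 0) (ℤ.+-identityʳ (a ℤ.* coeff g 0))

coeff-*-1 : ∀ f g → coeff (f *ₚ g) 1 ≡ coeff f 0 ℤ.* coeff g 1 ℤ.+ coeff f 1 ℤ.* coeff g 0
coeff-*-1 []      g = refl
coeff-*-1 (a ∷ f) g = trans (coeff-∷* a f g 1) (cong (λ b → a ℤ.* coeff g 1 ℤ.+ b) (coeff-*-0 f g))

coeff-zero-* : ∀ f g → (∀ i → coeff f i ≡ 0ℤ) → ∀ i → coeff (f *ₚ g) i ≡ 0ℤ
coeff-zero-* []      g f≈0 i = refl
coeff-zero-* (a ∷ f) g f≈0 i = trans (coeff-∷* a f g i)
  (trans (cong₂ ℤ._+_ (cong (ℤ._* coeff g i) (f≈0 0)) (shift i)) refl)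
  where
    shift : ∀ i → coeff (0ℤ ∷ (f *ₚ g)) i ≡ 0ℤ
    shift zero    = refl
    shift (suc i) = coeff-zero-* f g (λ j → f≈0 (suc j)) i

coeff-constant-* : ∀ f g → (∀ i → coeff f (suc i) ≡ 0ℤ) → ∀ i → coeff (f *ₚ g) i ≡ coeff f 0 ℤ.* coeff g i
coeff-constant-* []      g f≈0 i = refl
coeff-constant-* (a ∷ f) g f≈0 i = trans (coeff-∷* a f g i)
  (trans (cong (λ b → a ℤ.* coeff g i ℤ.+ b) (shift i)) (ℤ.+-identityʳ (a ℤ.* coeff g i)))
  where
    shift : ∀ i → coeff (0ℤ ∷ (f *ₚ g)) i ≡ 0ℤ
    shift zero    = refl
    shift (suc i) = coeff-zero-* f g f≈0 i

coeff-*-constant : ∀ f g → (∀ i → coeff g (suc i) ≡ 0ℤ) → ∀ i → coeff (f *ₚ g) i ≡ coeff f i ℤ.* coeff g 0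
coeff-*-constant []      g g≈0 i       = refl
coeff-*-constant (a ∷ f) g g≈0 zero    = coeff-*-0 (a ∷ f) g
coeff-*-constant (a ∷ f) g g≈0 (suc i) = trans (coeff-∷* a f g (suc i)) (trans
  (cong₂ ℤ._+_ (trans (cong (a ℤ.*_) (g≈0 i)) (ℤ.*-zeroʳ a)) (coeff-*-constant f g g≈0 i))
  (ℤ.+-identityˡ (coeff f i ℤ.* coeff g 0)))

-- Content, units and divisibility

∣-content : ∀ {b} f → (∀ i → b ℤ∣.∣ coeff f i) → b ℤ∣.∣ foldr ℤ.gcd 0ℤ f
∣-content         []      b∣f = ℕ._∣0 _
∣-content {b} (a ∷ f) b∣f = ℤ.gcd-greatest {a} {foldr ℤ.gcd 0ℤ f} {b} (b∣f 0) (∣-content {b} f (λ i → b∣f (suc i)))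

IsUnit : ℤ[x] → Set
IsUnit g = RawSemiring._∣_ ℤ[x]-rawSemiring g (1ℤ ∷ [])

-- An integer of absolute value 1 is its own inverse.
unit-constant : ∀ {g} → (∀ i → coeff g (suc i) ≡ 0ℤ) → ℤ.∣ coeff g 0 ∣ ≡ 1 → IsUnit g
unit-constant {g} g≈0 ∣g₀∣≡1 = record { quotient = coeff g 0 ∷ [] ; equality = inverse }
  where
    square : ∀ a → ℤ.∣ a ∣ ≡ 1 → a ℤ.* a ≡ 1ℤ
    square (+ 1)         refl = refl
    square -[1+ 0 ]      refl = refl
    inverse : (coeff g 0 ∷ []) *ₚ g ≈ₚ 1ℤ ∷ []
    inverse i = trans (coeff-constant-* (coeff g 0 ∷ []) g (λ _ → refl) i) (term i)
      where
        term : ∀ i → coeff g 0 ℤ.* coeff g i ≡ coeff (1ℤ ∷ []) i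
        term zero    = square (coeff g 0) ∣g₀∣≡1
        term (suc i) = trans (cong (coeff g 0 ℤ.*_) (g≈0 i)) (ℤ.*-zeroʳ (coeff g 0))

-- Only 1 and p divide p, so m is coprime to p and the k factors p can be cancelled one by one.
prime∤⇒∣cofactor : ∀ {p m} → Prime p → ¬ p ℕ.∣ m → ∀ k {d} → m ℕ.∣ p ℕ.^ k ℕ.* d → m ℕ.∣ d
prime∤⇒∣cofactor {p} {m} pr p∤m zero    {d} m∣ = subst (m ℕ.∣_) (ℕ.*-identityˡ d) m∣
prime∤⇒∣cofactor {p} {m} pr p∤m (suc k) {d} m∣ = prime∤⇒∣cofactor pr p∤m k
  (coprime-divisor coprime (subst (m ℕ.∣_) (ℕ.*-assoc p (p ℕ.^ k) d) m∣))
  where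
    coprime : Coprime m p
    coprime (e∣m , e∣p) with prime⇒irreducible pr e∣p
    ... | inj₁ e≡1  = e≡1
    ... | inj₂ refl = contradiction e∣m p∤m

-- Irreducibility

open import Algebra.Definitions.RawSemiring ℤ[x]-rawSemiring using (Irreducible)
open import Data.Integer.Base using (+_; -_; _*_)
open import Data.Integer.Divisibility using (_∣_)
open import Data.Nat.Base as ℕ using (ℕ; _^_; _>_)
open import Data.Nat.Primality using (Prime)
open import Data.Sum.Base using (_⊎_)
open import Relation.Binary.PropositionalEquality using (_≡_)
open import Relation.Nullary using (¬_)

theorem22 : (f : ℤ[x]) → Primitive f →
    (p k d : ℕ) → Prime p → k > 0 → d > 0 →
    (coeff f 0 ≡ + (p ^ k ℕ.* d)) ⊎ (coeff f 0 ≡ - (+ (p ^ k ℕ.* d))) →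
    ¬ (+ p ∣ coeff f 1 * + d) →
    (∀ (θ : ℂ) → IsZero f θ → fromℕ d <ʳ ∣ θ ∣ᶜ) →
    Irreducible f
theorem22 f content≡1 p k d pr k>0 d>0 f₀≡ p∤f₁d outside = record
  { p∤1      = λ where record { quotient = q ; equality = qf≈1 } → not-unit q qf≈1
  ; split-∣1 = λ {g} {h} f≈gh → split g h f≈gh (p ℕ.∣? ℤ.∣ coeff g 0 ∣)
  }
  where
    ∣f₀∣≡ : ℤ.∣ coeff f 0 ∣ ≡ p ℕ.^ k ℕ.* d
    ∣f₀∣≡ = [ cong ℤ.∣_∣ , (λ eq → trans (cong ℤ.∣_∣ eq) (ℤ.∣-i∣≡∣i∣ (+ (p ℕ.^ k ℕ.* d)))) ]′ f₀≡

    p∣p^kd : p ℕ.∣ p ℕ.^ k ℕ.* d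
    p∣p^kd = positive-power k>0
      where
        positive-power : ∀ {k} → k > 0 → p ℕ.∣ p ℕ.^ k ℕ.* d
        positive-power {suc k} _ = ℕ.∣m⇒∣m*n d (ℕ.m∣m*n (p ℕ.^ k))

    -- As k > 0, p divides the constant term of f, hence that of `q *ₚ f`, which would be 1.
    not-unit : ∀ q → ¬ (q *ₚ f ≈ₚ 1ℤ ∷ [])
    not-unit q qf≈1 = ℕ.nonTrivial⇒≢1 {{prime⇒nonTrivial pr}} (ℕ.∣1⇒≡1 (subst (p ℕ.∣_) ∣q₀f₀∣≡1
      (ℕ.∣n⇒∣m*n ℤ.∣ coeff q 0 ∣ (subst (p ℕ.∣_) (sym ∣f₀∣≡) p∣p^kd))))
      where
        ∣q₀f₀∣≡1 : ℤ.∣ coeff q 0 ∣ ℕ.* ℤ.∣ coeff f 0 ∣ ≡ 1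
        ∣q₀f₀∣≡1 = trans (sym (ℤ.abs-* (coeff q 0) (coeff f 0)))
          (cong ℤ.∣_∣ (trans (sym (coeff-*-0 q f)) (qf≈1 0)))

    constant : ∀ g h → (∀ z → evℤ f z ≡ evℤ g z ⊗ evℤ h z) → ¬ p ℕ.∣ ℤ.∣ coeff g 0 ∣ →
      ℤ.∣ coeff g 0 ∣ ℕ.∣ p ℕ.^ k ℕ.* d → ∀ i → coeff g (suc i) ≡ 0ℤ
    constant g h f≡gh p∤g₀ g₀∣ = small-constant-term f g h d d>0 outside f≡gh
      (ℕ.∣⇒≤ {{ℕ.>-nonZero d>0}} (prime∤⇒∣cofactor pr p∤g₀ k g₀∣))

    unit : ∀ g → (∀ i → coeff g (suc i) ≡ 0ℤ) → (∀ i → coeff g 0 ℤ∣.∣ coeff f i) → IsUnit g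
    unit g g≈0 g₀∣f = unit-constant {g} g≈0
      (ℕ.∣1⇒≡1 (subst (coeff g 0 ℤ∣.∣_) content≡1 (∣-content {coeff g 0} f g₀∣f)))

    split : ∀ g h → f ≈ₚ g *ₚ h → Dec (p ℕ.∣ ℤ.∣ coeff g 0 ∣) → IsUnit g ⊎ IsUnit h
    split g h f≈gh = λ where
        (no  p∤g₀) → let g≈0 = constant g h f≡gh p∤g₀ (subst (ℤ.∣ coeff g 0 ∣ ℕ.∣_) g₀h₀≡ (ℕ.m∣m*n _)) in
          inj₁ (unit g g≈0 λ i → Signed.∣⇒∣ᵤ (Signed.divides (coeff h i)
            (trans (f≈gh i) (trans (coeff-constant-* g h g≈0 i) (ℤ.*-comm (coeff g 0) (coeff h i))))))
        (yes p∣g₀) → let h≈0 = constant h g f≡hg (p∤h₀ p∣g₀) (subst (ℤ.∣ coeff h 0 ∣ ℕ.∣_) g₀h₀≡ (ℕ.n∣m*n ℤ.∣ coeff g 0 ∣)) in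
          inj₂ (unit h h≈0 λ i → Signed.∣⇒∣ᵤ (Signed.divides (coeff g i)
            (trans (f≈gh i) (coeff-*-constant g h h≈0 i))))
      where
        f≡gh : ∀ z → evℤ f z ≡ evℤ g z ⊗ evℤ h z
        f≡gh z = trans (evℤ-cong f (g *ₚ h) f≈gh z) (evℤ-* g h z)
        -- The factors are exchanged at the level of values in ℚ(i), where multiplication commutes.
        f≡hg : ∀ z → evℤ f z ≡ evℤ h z ⊗ evℤ g z
        f≡hg z = trans (f≡gh z) (⊗-comm (evℤ g z) (evℤ h z))
        g₀h₀≡ : ℤ.∣ coeff g 0 ∣ ℕ.* ℤ.∣ coeff h 0 ∣ ≡ p ℕ.^ k ℕ.* d
        g₀h₀≡ = trans (sym (ℤ.abs-* (coeff g 0) (coeff h 0)))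
          (trans (cong ℤ.∣_∣ (sym (trans (f≈gh 0) (coeff-*-0 g h)))) ∣f₀∣≡)
        p∤h₀ : p ℕ.∣ ℤ.∣ coeff g 0 ∣ → ¬ p ℕ.∣ ℤ.∣ coeff h 0 ∣
        p∤h₀ p∣g₀ p∣h₀ = p∤f₁d (subst (p ℕ.∣_) (sym (ℤ.abs-* (coeff f 1) (+ d))) (ℕ.∣m⇒∣m*n d
          (subst (λ a → p ℕ.∣ ℤ.∣ a ∣) (sym (trans (f≈gh 1) (coeff-*-1 g h)))
            (Signed.∣⇒∣ᵤ (Signed.∣m∣n⇒∣m+n
              (Signed.∣m⇒∣m*n (coeff h 1) (Signed.∣ᵤ⇒∣ {+ p} {coeff g 0} p∣g₀))
              (Signed.∣n⇒∣m*n (coeff g 1) (Signed.∣ᵤ⇒∣ {+ p} {coeff h 0} p∣h₀)))))))
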